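{- Let $q\equiv1\pmod4$ be a prime power, $n\ge3$ odd, and $Q=(q^n-1)/(q-1)$. Write $Q=k\,p_1\cdots p_s$ with $p_1,\dots,p_s$ distinct primes dividing $Q$ (and not dividing $k$), set $\delta=1-\sum_{i=1}^s1/p_i$, and assume $\delta>0$. If $$q^{\frac n2-1}>\sqrt2\Big(\frac{s-1}{\delta}+2\Big)W(k),$$ then $\mathcal{N}_0(q^n-1)>0$.
   Context: For a divisor $m$ of $q^n-1$, an element $\xi\in\mathbb{F}_{q^n}^*$ is $m$-free if $\xi=\zeta^d$ with $d\mid m$ and $\zeta\in\mathbb{F}_{q^n}^*$ implies $d=1$. $\mathcal{N}_0(m)$ is the number of $m$-free $\xi\in\mathbb{F}_{q^n}^*$ with $\mathrm{Tr}(\xi^2)=0$, where $\mathrm{Tr}(\xi)=\sum_{i=0}^{n-1}\xi^{q^i}$. $W(t)$ is the number of square-free divisors of $t$. -}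

module Defs where

open import Level using (0ℓ)
open import Data.Nat as ℕ using (ℕ; zero; suc; _∸_; _≤_; _%_)
open import Data.Nat.Divisibility using (_∣_; _∣?_)
open import Data.Nat.Primality using (Prime)
open import Data.Fin using (Fin; toℕ)
open import Data.Fin.Properties using (all?)
open import Relation.Nullary.Decidable using (_→-dec_)
open import Data.List using (List; []; _∷_; length; filter; upTo; map; all)
open import Data.List.Relation.Unary.All using (All)
open import Data.Product using (Σ; ∃; _×_; _,_)
open import Data.Rational as ℚ using (ℚ)
open import Data.Integer as ℤ using (ℤ)
open import Relation.Nullary using (¬_; Dec)
open import Relation.Nullary.Decidable using (_×-dec_; ¬?)
open import Relation.Binary.PropositionalEquality using (_≡_)
open import Algebra.Bundles using (CommutativeRing)

record FiniteField (N : ℕ) : Set₁ where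
  field
    commRing : CommutativeRing 0ℓ 0ℓ
  open CommutativeRing commRing public
  field
    0≉1     : ¬ (0# ≈ 1#)
    inverse : ∀ x → ¬ (x ≈ 0#) → ∃ λ y → x * y ≈ 1#
    enum    : Fin N → Carrier
    enum-surjective : ∀ x → ∃ λ i → enum i ≈ x
    enum-injective  : ∀ i j → enum i ≈ enum j → i ≡ j

module _ {N : ℕ} (F : FiniteField N) where
  open FiniteField F

  pow : Carrier → ℕ → Carrier
  pow x zero    = 1#
  pow x (suc d) = x * pow x d

  Tr : (q n : ℕ) → Carrier → Carrier
  Tr q zero    ξ = 0#
  Tr q (suc i) ξ = pow ξ (q ℕ.^ i) + Tr q i ξ

  IsFree : ℕ → Carrier → Set
  IsFree m ξ = ¬ (ξ ≈ 0#) ×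
               (∀ d ζ → d ∣ m → ¬ (ζ ≈ 0#) → ξ ≈ pow ζ d → d ≡ 1)

IsPrimePower : ℕ → Set
IsPrimePower q = ∃ λ p → ∃ λ e → Prime p × 1 ≤ e × q ≡ p ℕ.^ e

-- Square-free numbers and W(t) = number of square-free divisors of t.
-- A positive integer d is square-free iff no m ≥ 2 has m² ∣ d; since
-- m² ∣ d with d ≥ 1 forces m ≤ d, it suffices to test m ∈ {0..d}.
SquareFree : ℕ → Set
SquareFree d = (i : Fin (suc d)) → 2 ≤ toℕ i → ¬ (toℕ i ℕ.* toℕ i ∣ d)

squareFree? : (d : ℕ) → Dec (SquareFree d)
squareFree? d = all? (λ i → (2 ℕ.≤? toℕ i) →-dec ¬? ((toℕ i ℕ.* toℕ i) ∣? d))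

W : ℕ → ℕ
W t = length (filter (λ d → (d ∣? t) ×-dec squareFree? d) (map suc (upTo t)))

-- Rational helpers
-- 1/p as a rational (junk value 0 for p = 0; only applied to primes)
recip : ℕ → ℚ
recip zero    = ℚ.0ℚ
recip (suc p) = ℤ.+ 1 ℚ./ suc p

sumRecip : List ℕ → ℚ
sumRecip []       = ℚ.0ℚ
sumRecip (p ∷ ps) = recip p ℚ.+ sumRecip ps

ℕ→ℚ : ℕ → ℚ
ℕ→ℚ m = ℤ.+ m ℚ./ 1

ℤ→ℚ : ℤ → ℚ
ℤ→ℚ z = z ℚ./ 1

{-# OPTIONS --safe #-}
module Submission where

-- Write the nonzero elements as powers of a primitive root g and let D be the set of exponents i
-- with Tr(gⁱ) = 0.  Since Tr is an 𝔽_q-linear functional, D is (the preimage of) the Singer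
-- difference set modulo Q: the number of i with i, i + t ∈ D depends only on whether Q ∣ t.
-- For a set of primes dividing Q let κ be the normalised sum of the characters of ℤ/Q of exact
-- order their product.  Up to a factor κ is idempotent under convolution, and the difference set
-- property then bounds Σ_{i ∈ D} κ(i) by (q - 1) q^(n/2 - 1), the absolute value of a Gauss sum,
-- by mere positivity of a sum of squares.  The sieve with the primes pⱼ now gives i ∈ D prime to Q.
-- As Q is odd, i is congruent to 2a modulo Q, where a may be chosen prime to q^n - 1; multiplying
-- by elements of 𝔽_q does not affect the vanishing of the trace, so ξ = g^a works.

-- All estimates stay in ℚ. Characters are grouped by exact order, and the sum over such a group is
-- a Ramanujan sum, hence rational; positivity of a sum of squares then does the work of the
-- absolute value of a Gauss sum. The bound (q - 1) q^(n/2 - 1) itself need not be rational, as n is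
-- odd, so the sieve runs with a rational `b` whose square dominates (q - 1)² q^(n-2), and the
-- hypothesis enters squared.
--
-- The constant (s - 1)/δ + 2 arises as follows. Expanding the condition at the primes of k gives
-- 2^ω(k) ≤ W(k) terms; one is the total weight and each of the others is at most b. Removing the
-- multiples of a sieving prime p costs 1/p of this main sum and at most (1 - 1/p) 2^ω(k) b more. So
-- the total weight keeps the factor δ, while the errors stay below δ 2^ω(k) b from the expansion
-- plus (s - 1 + δ) 2^ω(k) b from the sieving primes; the quotient (s - 1 + 2δ)/δ is the constant.

open import Defs

-- Divisibility and coprimality through prime divisors.

module NumberTheory where
  open import Data.Nat
  open import Data.Nat.Properties
  open import Data.Nat.Divisibility
  open import Data.Nat.Primality
  open import Data.Nat.Primality.Factorisation using (factorise; PrimeFactorisation)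
  open import Data.Nat.Coprimality using (Coprime; coprime-divisor; coprime-/gcd)
  open import Data.Nat.GCD using (gcd; gcd[m,n]∣m; gcd[m,n]∣n; gcd[m,n]≢0)
  open import Data.Nat.DivMod using (m/n*n≡m)
  open import Data.Nat.Induction using (<-rec)
  open import Data.List using (List; []; _∷_)
  open import Data.List.Relation.Unary.All using (All; []; _∷_)
  open import Data.Nat.ListAction using (product)
  open import Data.Product
  open import Data.Sum using (inj₁; inj₂)
  open import Data.Empty using (⊥; ⊥-elim)
  open import Relation.Nullary
  open import Relation.Binary.PropositionalEquality

  prime-divisor : ∀ n → n ≢ 0 → n ≢ 1 → ∃ λ p → Prime p × p ∣ n
  prime-divisor n n≢0 n≢1 = first (PrimeFactorisation.factors f) (PrimeFactorisation.isFactorisation f) (PrimeFactorisation.factorsPrime f)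
    where
    instance n≠0 = ≢-nonZero n≢0
    f = factorise n
    first : ∀ ps → n ≡ product ps → All Prime ps → ∃ λ p → Prime p × p ∣ n
    first []       n≡1 _          = ⊥-elim (n≢1 n≡1)
    first (p ∷ ps) n≡  (p-pr ∷ _) = p , p-pr , divides (product ps) (trans n≡ (*-comm p (product ps)))

  coprime-by-primes : ∀ {a b} → a ≢ 0 → (∀ p → Prime p → p ∣ a → p ∣ b → ⊥) → Coprime a b
  coprime-by-primes {a} a≢0 no-p {d} (d∣a , d∣b) with d ≟ 1
  ... | yes d≡1 = d≡1
  ... | no  d≢1 with prime-divisor d (λ { refl → a≢0 (0∣⇒≡0 d∣a) }) d≢1
  ...   | p , p-pr , p∣d = ⊥-elim (no-p p p-pr (∣-trans p∣d d∣a) (∣-trans p∣d d∣b))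

  coprime-*-∣ : ∀ {a b j} → Coprime a b → a ∣ j → b ∣ j → a * b ∣ j
  coprime-*-∣ {a} {b} a⊥b a∣j (divides k refl) =
    *-monoˡ-∣ b (coprime-divisor a⊥b (subst (a ∣_) (*-comm k b) a∣j))

  prime∣^ : ∀ {p m} k → Prime p → p ∣ m ^ k → p ∣ m
  prime∣^ {p}     zero    p-pr p∣1 = ⊥-elim (¬prime[1] (subst Prime (∣1⇒≡1 p∣1) p-pr))
  prime∣^ {p} {m} (suc k) p-pr p∣  with euclidsLemma m (m ^ k) p-pr p∣
  ... | inj₁ p∣m  = p∣m
  ... | inj₂ p∣mᵏ = prime∣^ k p-pr p∣mᵏ

  prime∣prime : ∀ {p r} → Prime p → Prime r → p ∣ r → p ≡ r
  prime∣prime p-pr r-pr p∣r with prime⇒irreducible r-pr p∣r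
  ... | inj₁ refl = ⊥-elim (¬prime[1] p-pr)
  ... | inj₂ p≡r  = p≡r

  ^-coprime : ∀ {p n} v → Prime p → ¬ p ∣ n → Coprime (p ^ v) n
  ^-coprime {p} v p-pr p∤n = coprime-by-primes (≢-nonZero⁻¹ (p ^ v) {{m^n≢0 p v {{prime⇒nonZero p-pr}}}})
    λ r r-pr r∣pᵛ r∣n → p∤n (subst (_∣ _) (prime∣prime r-pr p-pr (prime∣^ v r-pr r∣pᵛ)) r∣n)

  prime≢0 : ∀ {p} → Prime p → p ≢ 0
  prime≢0 p-pr refl = ¬prime[0] p-pr

  prime>1 : ∀ {p} → Prime p → 1 < p
  prime>1 {p} p-pr = nonTrivial⇒n>1 p {{prime⇒nonTrivial p-pr}}

  valuation : ∀ {p} → Prime p → ∀ d → d ≢ 0 → ∃₂ λ v d′ → d ≡ p ^ v * d′ × ¬ p ∣ d′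
  valuation {p} p-pr = <-rec _ step
    where
    step : ∀ d → (∀ {e} → e < d → e ≢ 0 → ∃₂ λ v d′ → e ≡ p ^ v * d′ × ¬ p ∣ d′) →
           d ≢ 0 → ∃₂ λ v d′ → d ≡ p ^ v * d′ × ¬ p ∣ d′
    step d rec d≢0 with p ∣? d
    ... | no  p∤d            = 0 , d , sym (*-identityˡ d) , p∤d
    ... | yes (divides e refl) with rec (m<m*n e p {{≢-nonZero e≢0}} (prime>1 p-pr)) e≢0
      where
      e≢0 : e ≢ 0
      e≢0 refl = d≢0 refl
    ...   | v , d′ , e≡ , p∤d′ = suc v , d′ , trans (*-comm e p) (trans (cong (p *_) e≡) (sym (*-assoc p (p ^ v) d′))) , p∤d′

  gcd-split : ∀ m n → m ≢ 0 → ∃ λ d → ∃₂ λ e f → m ≡ e * d × n ≡ f * d × Coprime e f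
  gcd-split m n m≢0 = gcd m n , m / gcd m n , n / gcd m n ,
    sym (m/n*n≡m (gcd[m,n]∣m m n)) , sym (m/n*n≡m (gcd[m,n]∣n m n)) , coprime-/gcd m n
    where instance _ = ≢-nonZero (gcd[m,n]≢0 m n (inj₁ m≢0))

  -- A prime `p` of m / gcd m n cannot divide n / gcd m n, so its exponent in `n` is its exponent
  -- `v` in the gcd, while `m` carries at least one more. The factors stand in the order in which
  -- `IsOrder-^` takes them.
  ∤-prime-power : ∀ m n → m ≢ 0 → n ≢ 0 → ¬ m ∣ n →
    ∃ λ p → ∃ λ v → ∃₂ λ m′ n′ → Prime p × m ≡ m′ * p ^ suc v × n ≡ p ^ v * n′ × ¬ p ∣ n′
  ∤-prime-power m n m≢0 n≢0 m∤n with gcd-split m n m≢0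
  ... | d , e , f , refl , refl , e⊥f with prime-divisor e (λ { refl → m≢0 refl }) (λ { refl → m∤n (subst (_∣ f * d) (sym (+-identityʳ d)) (n∣m*n f)) })
  ...   | p , p-pr , divides e′ refl with valuation p-pr d (λ { refl → m≢0 (*-zeroʳ (e′ * p)) })
  ...     | v , d′ , refl , p∤d′ = p , v , e′ * d′ , f * d′ , p-pr , eq₁ , eq₂ , p∤fd′
    where
    open import Data.Nat.Tactic.RingSolver using (solve-∀)
    lem₁ : ∀ a p pv b → a * p * (pv * b) ≡ a * b * (p * pv)
    lem₁ = solve-∀
    lem₂ : ∀ f pv b → f * (pv * b) ≡ pv * (f * b)
    lem₂ = solve-∀
    eq₁ = lem₁ e′ p (p ^ v) d′
    eq₂ = lem₂ f (p ^ v) d′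
    p∤fd′ : ¬ p ∣ f * d′
    p∤fd′ p∣ with euclidsLemma f d′ p-pr p∣
    ... | inj₁ p∣f  = ¬prime[1] (subst Prime (e⊥f (n∣m*n e′ , p∣f)) p-pr)
    ... | inj₂ p∣d′ = p∤d′ p∣d′

-- Rational arithmetic, indicators and sums over one period.

module RationalSums where
  open import Level using (0ℓ)
  open import Data.Nat as ℕ using (ℕ; zero; suc)
  import Data.Nat.Properties as ℕ
  open import Data.Integer as ℤ using (ℤ)
  import Data.Integer.Properties as ℤ
  open import Data.Rational using (ℚ; 0ℚ; 1ℚ; _+_; _*_; _-_; -_; _≤_; _<_; positive; nonNegative; toℚᵘ; ∣_∣)
  import Data.Rational as ℚ
  open import Data.Rational.Properties as ℚ
    using (+-*-commutativeRing; toℚᵘ-injective; toℚᵘ-homo-+; toℚᵘ-homo-*; toℚᵘ-fromℚᵘ)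
  open import Data.Rational.Unnormalised as ℚᵘ using (mkℚᵘ; *≡*)
  import Data.Rational.Unnormalised.Properties as ℚᵘ
  open import Data.Fin as Fin using (Fin; toℕ)
  import Data.Fin.Properties as Fin
  open import Data.Fin.Permutation using (Permutation; permutation; _⟨$⟩ʳ_)
  open import Data.Product
  open import Data.Sum using (inj₁; inj₂)
  open import Data.Empty using (⊥-elim)
  open import Function using (_∘_)
  open import Function.Definitions using (Injective)
  open import Relation.Nullary
  open import Relation.Nullary.Decidable using (dec⇒maybe)
  open import Relation.Binary.PropositionalEquality
  open import Algebra.Bundles using (CommutativeRing)
  open import Tactic.RingSolver.Core.AlmostCommutativeRing using (AlmostCommutativeRing; fromCommutativeRing)
  open import Tactic.RingSolver using (solve-∀)

  ℚ-ring : AlmostCommutativeRing 0ℓ 0ℓ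
  ℚ-ring = fromCommutativeRing +-*-commutativeRing (λ x → dec⇒maybe (0ℚ ℚ.≟ x))

  open import Algebra.Properties.Semiring.Sum (CommutativeRing.semiring +-*-commutativeRing)
    using (sum; sum-cong-≗; ∑-distrib-+; ∑-comm; *-distribˡ-sum)

  ι : ℕ → ℚ
  ι = ℕ→ℚ

  -- The operations of ℚ reduce to lowest terms, so the identity is checked on unnormalised
  -- fractions with denominator 1.
  ι-+ : ∀ m n → ι (m ℕ.+ n) ≡ ι m + ι n
  ι-+ m n = toℚᵘ-injective (begin
    toℚᵘ (ι (m ℕ.+ n))                              ≈⟨ toℚᵘ-fromℚᵘ (mkℚᵘ (ℤ.+ (m ℕ.+ n)) 0) ⟩
    mkℚᵘ (ℤ.+ (m ℕ.+ n)) 0                          ≈⟨ *≡* (cong (ℤ._* ℤ.1ℤ) (cong₂ ℤ._+_ (sym (ℤ.*-identityʳ (ℤ.+ m))) (sym (ℤ.*-identityʳ (ℤ.+ n))))) ⟩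
    mkℚᵘ (ℤ.+ m) 0 ℚᵘ.+ mkℚᵘ (ℤ.+ n) 0              ≈⟨ ℚᵘ.+-cong (toℚᵘ-fromℚᵘ (mkℚᵘ (ℤ.+ m) 0)) (toℚᵘ-fromℚᵘ (mkℚᵘ (ℤ.+ n) 0)) ⟨
    toℚᵘ (ι m) ℚᵘ.+ toℚᵘ (ι n)                      ≈⟨ toℚᵘ-homo-+ (ι m) (ι n) ⟨
    toℚᵘ (ι m + ι n)                                ∎)
    where open ℚᵘ.≃-Reasoning

  ι-* : ∀ m n → ι (m ℕ.* n) ≡ ι m * ι n
  ι-* zero    n = sym (ℚ.*-zeroˡ (ι n))
  ι-* (suc m) n = begin
    ι (n ℕ.+ m ℕ.* n)     ≡⟨ ι-+ n (m ℕ.* n) ⟩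
    ι n + ι (m ℕ.* n)     ≡⟨ cong₂ _+_ (sym (ℚ.*-identityˡ (ι n))) (ι-* m n) ⟩
    1ℚ * ι n + ι m * ι n  ≡⟨ ℚ.*-distribʳ-+ (ι n) 1ℚ (ι m) ⟨
    (1ℚ + ι m) * ι n      ≡⟨ cong (_* ι n) (ι-+ 1 m) ⟨
    ι (suc m) * ι n       ∎
    where open ≡-Reasoning

  ι-nonNeg : ∀ m → 0ℚ ≤ ι m
  ι-nonNeg zero    = ℚ.≤-refl
  ι-nonNeg (suc m) = subst (0ℚ ≤_) (sym (ι-+ 1 m)) (ℚ.+-mono-≤ {0ℚ} {1ℚ} (ℚ.nonNegative⁻¹ 1ℚ) (ι-nonNeg m))

  ι-mono-≤ : ∀ {m n} → m ℕ.≤ n → ι m ≤ ι n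
  ι-mono-≤ {m} m≤n with ℕ.m≤n⇒∃[o]m+o≡n m≤n
  ... | o , refl = subst (ι m ≤_) (sym (ι-+ m o)) (subst (_≤ ι m + ι o) (ℚ.+-identityʳ (ι m)) (ℚ.+-monoʳ-≤ (ι m) (ι-nonNeg o)))

  ι-pos : ∀ m → 0ℚ < ι (suc m)
  ι-pos m = ℚ.<-≤-trans (ℚ.positive⁻¹ 1ℚ) (ι-mono-≤ {1} {suc m} (ℕ.s≤s ℕ.z≤n))

  ι*recip : ∀ m → ι (suc m) * recip (suc m) ≡ 1ℚ
  ι*recip m = toℚᵘ-injective (begin
    toℚᵘ (ι (suc m) * recip (suc m))             ≈⟨ toℚᵘ-homo-* (ι (suc m)) (recip (suc m)) ⟩
    toℚᵘ (ι (suc m)) ℚᵘ.* toℚᵘ (recip (suc m))   ≈⟨ ℚᵘ.*-cong (toℚᵘ-fromℚᵘ (mkℚᵘ (ℤ.+ suc m) 0)) (toℚᵘ-fromℚᵘ (mkℚᵘ (ℤ.+ 1) m)) ⟩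
    mkℚᵘ (ℤ.+ suc m) 0 ℚᵘ.* mkℚᵘ (ℤ.+ 1) m       ≈⟨ *≡* (trans (ℤ.*-identityʳ _) (trans (ℤ.*-identityʳ (ℤ.+ suc m)) (sym (trans (ℤ.*-identityˡ _) (cong (λ k → ℤ.+ suc k) (ℕ.+-identityʳ m)))))) ⟩
    mkℚᵘ (ℤ.+ 1) 0                               ∎)
    where open ℚᵘ.≃-Reasoning

  ι-cancelˡ : ∀ {m a b} → m ≢ 0 → ι m * a ≡ ι m * b → a ≡ b
  ι-cancelˡ {zero}          m≢0 eq = ⊥-elim (m≢0 refl)
  ι-cancelˡ {suc m} {a} {b} m≢0 eq = trans (sym (undo a)) (trans (cong (recip (suc m) *_) eq) (undo b))
    where
    undo : ∀ a → recip (suc m) * (ι (suc m) * a) ≡ a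
    undo a = trans (sym (ℚ.*-assoc (recip (suc m)) (ι (suc m)) a))
      (trans (cong (_* a) (trans (ℚ.*-comm (recip (suc m)) (ι (suc m))) (ι*recip m))) (ℚ.*-identityˡ a))

  *-nonNeg : ∀ {a b} → 0ℚ ≤ a → 0ℚ ≤ b → 0ℚ ≤ a * b
  *-nonNeg {a} {b} 0≤a 0≤b = subst (_≤ a * b) (ℚ.*-zeroʳ a) (ℚ.*-monoˡ-≤-nonNeg a {{nonNegative 0≤a}} 0≤b)

  *-pos : ∀ {a b} → 0ℚ < a → 0ℚ < b → 0ℚ < a * b
  *-pos {a} {b} 0<a 0<b = subst (_< a * b) (ℚ.*-zeroʳ a) (ℚ.*-monoʳ-<-pos a {{positive 0<a}} 0<b)

  *-monoˡ-≤ : ∀ {c a b} → 0ℚ ≤ c → a ≤ b → c * a ≤ c * b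
  *-monoˡ-≤ {c} 0≤c = ℚ.*-monoˡ-≤-nonNeg c {{nonNegative 0≤c}}

  ≤⇒0≤- : ∀ {a b} → a ≤ b → 0ℚ ≤ b - a
  ≤⇒0≤- {a} {b} a≤b = subst (_≤ b - a) (ℚ.+-inverseʳ a) (ℚ.+-monoˡ-≤ (- a) a≤b)

  0≤-⇒≤ : ∀ {a b} → 0ℚ ≤ b - a → a ≤ b
  0≤-⇒≤ {a} {b} 0≤ = subst₂ _≤_ (ℚ.+-identityˡ a) (lem b a) (ℚ.+-monoˡ-≤ a 0≤)
    where
    lem : ∀ b a → b - a + a ≡ b
    lem = solve-∀ ℚ-ring

  square-nonNeg : ∀ a → 0ℚ ≤ a * a
  square-nonNeg a with ℚ.≤-total 0ℚ a
  ... | inj₁ 0≤a = *-nonNeg 0≤a 0≤a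
  ... | inj₂ a≤0 = subst (0ℚ ≤_) (neg-square a) (*-nonNeg (ℚ.neg-antimono-≤ a≤0) (ℚ.neg-antimono-≤ a≤0))
    where
    neg-square : ∀ a → - a * - a ≡ a * a
    neg-square = solve-∀ ℚ-ring

  square-cancel-≤ : ∀ {a b} → 0ℚ ≤ b → a * a ≤ b * b → a ≤ b
  square-cancel-≤ {a} {b} 0≤b a²≤b² with a ℚ.≤? b
  ... | yes a≤b = a≤b
  ... | no  a≰b = ⊥-elim (ℚ.<-irrefl refl (ℚ.≤-<-trans (ℚ.≤-trans a²≤b² (*-monoˡ-≤ 0≤b (ℚ.<⇒≤ b<a)))
                      (ℚ.*-monoˡ-<-pos a {{positive (ℚ.≤-<-trans 0≤b b<a)}} b<a)))
    where b<a = ℚ.≰⇒> a≰b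

  square-≤⇒∣∣≤ : ∀ {a b} → 0ℚ ≤ b → a * a ≤ b * b → ∣ a ∣ ≤ b
  square-≤⇒∣∣≤ {a} {b} 0≤b a²≤b² = square-cancel-≤ 0≤b (subst (_≤ b * b) (trans (sym (ℚ.0≤p⇒∣p∣≡p (square-nonNeg a))) (ℚ.∣p*q∣≡∣p∣*∣q∣ a a)) a²≤b²)

  p≤∣p∣ : ∀ p → p ≤ ∣ p ∣
  p≤∣p∣ p with ℚ.≤-total 0ℚ p
  ... | inj₁ 0≤p = ℚ.≤-reflexive (sym (ℚ.0≤p⇒∣p∣≡p 0≤p))
  ... | inj₂ p≤0 = ℚ.≤-trans p≤0 (ℚ.0≤∣p∣ p)

  𝟙 : ∀ {P : Set} → Dec P → ℚ
  𝟙 (yes _) = 1ℚ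
  𝟙 (no _)  = 0ℚ

  𝟙-yes : ∀ {P : Set} (d : Dec P) → P → 𝟙 d ≡ 1ℚ
  𝟙-yes (yes _) p = refl
  𝟙-yes (no ¬p) p = ⊥-elim (¬p p)

  𝟙-no : ∀ {P : Set} (d : Dec P) → ¬ P → 𝟙 d ≡ 0ℚ
  𝟙-no (yes p) ¬p = ⊥-elim (¬p p)
  𝟙-no (no _)  ¬p = refl

  𝟙-⇔ : ∀ {P P′ : Set} (d : Dec P) (d′ : Dec P′) → (P → P′) → (P′ → P) → 𝟙 d ≡ 𝟙 d′
  𝟙-⇔ (yes p) d′ f g = sym (𝟙-yes d′ (f p))
  𝟙-⇔ (no ¬p) d′ f g = sym (𝟙-no d′ (¬p ∘ g))

  𝟙-nonNeg : ∀ {P : Set} (d : Dec P) → 0ℚ ≤ 𝟙 d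
  𝟙-nonNeg (yes _) = ℚ.nonNegative⁻¹ 1ℚ
  𝟙-nonNeg (no _)  = ℚ.≤-refl

  sum-const : ∀ n c → sum {n} (λ _ → c) ≡ ι n * c
  sum-const zero    c = sym (ℚ.*-zeroˡ c)
  sum-const (suc n) c = begin
    c + sum {n} (λ _ → c)  ≡⟨ cong₂ _+_ (sym (ℚ.*-identityˡ c)) (sum-const n c) ⟩
    1ℚ * c + ι n * c       ≡⟨ ℚ.*-distribʳ-+ c 1ℚ (ι n) ⟨
    (1ℚ + ι n) * c         ≡⟨ cong (_* c) (ι-+ 1 n) ⟨
    ι (suc n) * c          ∎
    where open ≡-Reasoning

  sum-zero : ∀ {n} (f : Fin n → ℚ) → (∀ i → f i ≡ 0ℚ) → sum f ≡ 0ℚ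
  sum-zero {n} f f≡0 = trans (sum-cong-≗ f≡0) (trans (sum-const n 0ℚ) (ℚ.*-zeroʳ (ι n)))

  sum-𝟙-unique : ∀ {n} {P : Fin n → Set} (P? : ∀ i → Dec (P i)) i₀ → P i₀ → (∀ i → P i → i ≡ i₀) →
                 sum (λ i → 𝟙 (P? i)) ≡ 1ℚ
  sum-𝟙-unique P? Fin.zero pi₀ unique = cong₂ _+_ (𝟙-yes (P? Fin.zero) pi₀)
    (sum-zero (λ i → 𝟙 (P? (Fin.suc i))) λ i → 𝟙-no (P? (Fin.suc i)) (Fin.0≢1+n ∘ sym ∘ unique (Fin.suc i)))
  sum-𝟙-unique P? (Fin.suc i₀) pi₀ unique = trans (cong₂ _+_ (𝟙-no (P? Fin.zero) (Fin.0≢1+n ∘ unique Fin.zero))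
    (sum-𝟙-unique (λ i → P? (Fin.suc i)) i₀ pi₀ (λ i p → Fin.suc-injective (unique (Fin.suc i) p)))) (ℚ.+-identityˡ 1ℚ)

  -- If `j` were missed, punching it out of the codomain would inject Fin (suc n) into Fin n.
  Fin-surjective : ∀ {n} (f : Fin n → Fin n) → Injective _≡_ _≡_ f → ∀ j → ∃ λ i → f i ≡ j
  Fin-surjective {suc n} f f-inj j with Fin.any? (λ i → f i Fin.≟ j)
  ... | yes found = found
  ... | no  none  = ⊥-elim (ℕ.<-irrefl refl (Fin.injective⇒≤ {f = λ i → Fin.punchOut (avoid i)}
                      (λ {i} {i′} eq → f-inj (Fin.punchOut-injective (avoid i) (avoid i′) eq))))
    where
    avoid : ∀ i → j ≢ f i
    avoid i j≡fi = none (i , sym j≡fi)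

  injective⇒permutation : ∀ {n} (f : Fin n → Fin n) → Injective _≡_ _≡_ f → ∃ λ (π : Permutation n n) → ∀ i → π ⟨$⟩ʳ i ≡ f i
  injective⇒permutation f f-inj = permutation f (λ j → proj₁ (surj j)) (λ j → proj₂ (surj j))
    (λ i → f-inj (proj₂ (surj (f i)))) , λ i → refl
    where surj = Fin-surjective f f-inj

  ∑ : ℕ → (ℕ → ℚ) → ℚ
  ∑ n f = sum {n} (λ i → f (toℕ i))

  ∑-cong : ∀ n {f g} → (∀ i → f i ≡ g i) → ∑ n f ≡ ∑ n g
  ∑-cong n f≡g = sum-cong-≗ {n} (λ i → f≡g (toℕ i))

  ∑-+ : ∀ n f g → ∑ n (λ i → f i + g i) ≡ ∑ n f + ∑ n g
  ∑-+ n f g = ∑-distrib-+ {n} (f ∘ toℕ) (g ∘ toℕ)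

  ∑-*ˡ : ∀ n c f → ∑ n (λ i → c * f i) ≡ c * ∑ n f
  ∑-*ˡ n c f = sym (*-distribˡ-sum {n} c (f ∘ toℕ))

  ∑-swap : ∀ m n (f : ℕ → ℕ → ℚ) → ∑ m (λ i → ∑ n (λ j → f i j)) ≡ ∑ n (λ j → ∑ m (λ i → f i j))
  ∑-swap m n f = ∑-comm {m} {n} (λ i j → f (toℕ i) (toℕ j))

  ∑-const : ∀ n c → ∑ n (λ _ → c) ≡ ι n * c
  ∑-const = sum-const

  ∑-- : ∀ n f g → ∑ n (λ i → f i - g i) ≡ ∑ n f - ∑ n g
  ∑-- n f g = trans (∑-+ n f (λ i → - g i)) (cong (∑ n f +_) (trans (∑-cong n (λ i → neg (g i))) (trans (∑-*ˡ n (- 1ℚ) g) (sym (neg (∑ n g))))))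
    where
    neg : ∀ a → - a ≡ - 1ℚ * a
    neg = solve-∀ ℚ-ring

  ∑-last : ∀ n f → ∑ (suc n) f ≡ ∑ n f + f n
  ∑-last zero    f = trans (ℚ.+-identityʳ (f 0)) (sym (ℚ.+-identityˡ (f 0)))
  ∑-last (suc n) f = trans (cong (f 0 +_) (∑-last n (f ∘ suc))) (sym (ℚ.+-assoc (f 0) (∑ n (f ∘ suc)) (f (suc n))))

  ∑-mono-≤ : ∀ n {f g} → (∀ i → i ℕ.< n → f i ≤ g i) → ∑ n f ≤ ∑ n g
  ∑-mono-≤ zero    f≤g = ℚ.≤-refl
  ∑-mono-≤ (suc n) f≤g = ℚ.+-mono-≤ (f≤g 0 ℕ.z<s) (∑-mono-≤ n (λ i i<n → f≤g (suc i) (ℕ.s<s i<n)))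

  ∑-nonNeg : ∀ n {f} → (∀ i → 0ℚ ≤ f i) → 0ℚ ≤ ∑ n f
  ∑-nonNeg n {f} 0≤f = subst (_≤ ∑ n f) (trans (∑-const n 0ℚ) (ℚ.*-zeroʳ (ι n))) (∑-mono-≤ n (λ i _ → 0≤f i))

  -- Functions on ℤ/m are carried as periodic functions on ℕ, with `∑ m` the sum over one period, so
  -- that shifts need no reduction modulo m.
  Periodic : ℕ → (ℕ → ℚ) → Set
  Periodic m f = ∀ i → f (i ℕ.+ m) ≡ f i

  periodic-* : ∀ {m f} k → Periodic m f → Periodic (k ℕ.* m) f
  periodic-* {m} {f} zero    per i = cong f (ℕ.+-identityʳ i)
  periodic-* {m} {f} (suc k) per i = trans (cong f (sym (ℕ.+-assoc i m (k ℕ.* m)))) (trans (periodic-* k per (i ℕ.+ m)) (per i))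

  -- One more shift drops `f t` at the front and gains `f (m + t)`, the same value, at the end.
  ∑-shift : ∀ {m f} → Periodic m f → ∀ t → ∑ m (λ i → f (i ℕ.+ t)) ≡ ∑ m f
  ∑-shift {m} {f} per zero    = ∑-cong m (λ i → cong f (ℕ.+-identityʳ i))
  ∑-shift {m} {f} per (suc t) = begin
    ∑ m (λ i → f (i ℕ.+ suc t))                         ≡⟨ ∑-cong m (λ i → cong f (ℕ.+-suc i t)) ⟩
    ∑ m (λ i → f (suc i ℕ.+ t))                         ≡⟨ lem (∑ m (λ i → f (suc i ℕ.+ t))) (f t) ⟩
    ∑ (suc m) (λ i → f (i ℕ.+ t)) - f t                 ≡⟨ cong (_- f t) (∑-last m (λ i → f (i ℕ.+ t))) ⟩
    ∑ m (λ i → f (i ℕ.+ t)) + f (m ℕ.+ t) - f t         ≡⟨ cong (λ x → ∑ m (λ i → f (i ℕ.+ t)) + x - f t) (trans (cong f (ℕ.+-comm m t)) (per t)) ⟩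
    ∑ m (λ i → f (i ℕ.+ t)) + f t - f t                 ≡⟨ lem′ (∑ m (λ i → f (i ℕ.+ t))) (f t) ⟩
    ∑ m (λ i → f (i ℕ.+ t))                             ≡⟨ ∑-shift {m} {f} per t ⟩
    ∑ m f                                               ∎
    where
    open ≡-Reasoning
    lem : ∀ a b → a ≡ b + a - b
    lem = solve-∀ ℚ-ring
    lem′ : ∀ a b → a + b - b ≡ a
    lem′ = solve-∀ ℚ-ring

-- Polynomial functions, orders of elements and a primitive root.

module FiniteFields where
  open NumberTheory
  open import Data.Nat as ℕ using (ℕ; zero; suc; _<_; _≤_; s≤s)
  import Data.Nat.Properties as ℕ
  open import Data.Nat.Divisibility using (_∣_; divides; m%n≡0⇒n∣m; ∣⇒≤; n∣m*n; m∣m*n; *-cancelˡ-∣)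
  open import Data.Nat.DivMod using (_%_; _/_; m≡m%n+[m/n]*n; m%n<n)
  open import Data.Nat.Coprimality as Cop using (Coprime; coprime-divisor)
  open import Data.Nat.Induction using (<-rec)
  open import Data.Fin as Fin using (Fin; zero; suc; toℕ; inject≤)
  import Data.Fin.Properties as Fin
  open import Data.Product
  open import Data.Sum using (_⊎_; inj₁; inj₂; [_,_]′)
  open import Data.Empty using (⊥-elim)
  open import Function using (_∘_)
  open import Relation.Nullary
  import Relation.Nullary.Decidable as Dec
  open import Relation.Unary using (Decidable)
  open import Relation.Binary.PropositionalEquality as ≡ using (_≡_; _≢_)

  module FieldTheory {N : ℕ} (F : FiniteField N) where
    open FiniteField F public hiding (zero)
    open import Relation.Binary.Reasoning.Setoid setoid
    open import Algebra.Properties.CommutativeSemiring.Exp commutativeSemiring as Exp public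
      using (_^_)
    open import Algebra.Properties.Ring ring public
      using (+-cancelˡ; +-cancelʳ; //-rightDividesˡ; //-rightDividesʳ) renaming (x∙y⁻¹≈ε⇒x≈y to x-y≈0⇒x≈y)
    open import Algebra.Properties.CommutativeSemigroup *-commutativeSemigroup using (x∙yz≈y∙xz)
    open import Algebra.Properties.CommutativeSemigroup +-commutativeSemigroup using (interchange)

    pow≡^ : ∀ x n → pow F x n ≡ x ^ n
    pow≡^ x zero    = ≡.refl
    pow≡^ x (suc n) = ≡.cong (x *_) (pow≡^ x n)

    1^n≈1 : ∀ n → 1# ^ n ≈ 1#
    1^n≈1 zero    = refl
    1^n≈1 (suc n) = trans (*-identityˡ _) (1^n≈1 n)

    idx : Carrier → Fin N
    idx x = proj₁ (enum-surjective x)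

    enum-idx : ∀ x → enum (idx x) ≈ x
    enum-idx x = proj₂ (enum-surjective x)

    idx-injective : ∀ {x y} → idx x ≡ idx y → x ≈ y
    idx-injective {x} {y} eq = trans (sym (enum-idx x)) (trans (reflexive (≡.cong enum eq)) (enum-idx y))

    idx-cong : ∀ {x y} → x ≈ y → idx x ≡ idx y
    idx-cong {x} {y} x≈y = enum-injective _ _ (trans (enum-idx x) (trans x≈y (sym (enum-idx y))))

    infix 4 _≟_
    _≟_ : ∀ x y → Dec (x ≈ y)
    x ≟ y = Dec.map′ idx-injective idx-cong (idx x Fin.≟ idx y)

    any-element? : {P : Carrier → Set} → (∀ {x y} → x ≈ y → P x → P y) → Decidable P → Dec (∃ P)
    any-element? resp P? = Dec.map′ (λ (i , p) → enum i , p)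
      (λ (x , p) → idx x , resp (sym (enum-idx x)) p) (Fin.any? (P? ∘ enum))

    x*y≈0⇒y≈0 : ∀ {x y} → ¬ x ≈ 0# → x * y ≈ 0# → y ≈ 0#
    x*y≈0⇒y≈0 {x} {y} x≉0 xy≈0 with inverse x x≉0
    ... | z , xz≈1 = begin
      y           ≈⟨ *-identityˡ y ⟨
      1# * y      ≈⟨ *-congʳ xz≈1 ⟨
      x * z * y   ≈⟨ trans (*-congʳ (*-comm x z)) (*-assoc z x y) ⟩
      z * (x * y) ≈⟨ *-congˡ xy≈0 ⟩
      z * 0#      ≈⟨ zeroʳ z ⟩
      0#          ∎

    *-cancelˡ : ∀ {x} y z → ¬ x ≈ 0# → x * y ≈ x * z → y ≈ z
    *-cancelˡ {x} y z x≉0 xy≈xz with inverse x x≉0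
    ... | w , xw≈1 = begin
      y           ≈⟨ *-identityˡ y ⟨
      1# * y      ≈⟨ *-congʳ xw≈1 ⟨
      x * w * y   ≈⟨ trans (*-congʳ (*-comm x w)) (*-assoc w x y) ⟩
      w * (x * y) ≈⟨ *-congˡ xy≈xz ⟩
      w * (x * z) ≈⟨ trans (*-congʳ (*-comm x w)) (*-assoc w x z) ⟨
      x * w * z   ≈⟨ *-congʳ xw≈1 ⟩
      1# * z      ≈⟨ *-identityˡ z ⟩
      z           ∎

    *-≉0 : ∀ {x y} → ¬ x ≈ 0# → ¬ y ≈ 0# → ¬ x * y ≈ 0#
    *-≉0 x≉0 y≉0 xy≈0 = y≉0 (x*y≈0⇒y≈0 x≉0 xy≈0)

    ^-≉0 : ∀ {x} n → ¬ x ≈ 0# → ¬ x ^ n ≈ 0#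
    ^-≉0 zero    x≉0 1≈0 = 0≉1 (sym 1≈0)
    ^-≉0 (suc n) x≉0     = *-≉0 x≉0 (^-≉0 n x≉0)

    x-y+y≈x : ∀ x y → (x - y) + y ≈ x
    x-y+y≈x x y = //-rightDividesˡ y x

    x+y-y≈x : ∀ x y → (x + y) - y ≈ x
    x+y-y≈x x y = //-rightDividesʳ y x

    -- Deg d c f: f is a polynomial function of degree at most d whose coefficient of x^d is c,
    -- phrased through division by x - r so that the root bound is a plain induction.
    Deg : ℕ → Carrier → (Carrier → Carrier) → Set
    Deg zero    c f = ∀ x → f x ≈ c
    Deg (suc d) c f = ∀ r → ∃ λ g → Deg d c g × (∀ x → f x ≈ (x - r) * g x + f r)

    Deg-cong : ∀ d {c c′ f} → c ≈ c′ → Deg d c f → Deg d c′ f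
    Deg-cong zero    c≈c′ fd x = trans (fd x) c≈c′
    Deg-cong (suc d) c≈c′ fd r with fd r
    ... | g , gd , eq = g , Deg-cong d c≈c′ gd , eq

    Deg-+ : ∀ d {c c′ f f′} → Deg d c f → Deg d c′ f′ → Deg d (c + c′) (λ x → f x + f′ x)
    Deg-+ zero    fd fd′ x = +-cong (fd x) (fd′ x)
    Deg-+ (suc d) fd fd′ r with fd r | fd′ r
    ... | g , gd , eq | g′ , gd′ , eq′ = (λ x → g x + g′ x) , Deg-+ d gd gd′ , λ x →
      trans (+-cong (eq x) (eq′ x))
        (trans (interchange _ _ _ _) (+-congʳ (sym (distribˡ (x - r) (g x) (g′ x)))))

    Deg-scale : ∀ d s {c f} → Deg d c f → Deg d (s * c) (λ x → s * f x)
    Deg-scale zero    s fd x = *-congˡ (fd x)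
    Deg-scale (suc d) s fd r with fd r
    ... | g , gd , eq = (λ x → s * g x) , Deg-scale d s gd , λ x →
      trans (*-congˡ (eq x))
        (trans (distribˡ s _ _) (+-congʳ (x∙yz≈y∙xz s (x - r) (g x))))

    Deg-suc : ∀ d {c f} → Deg d c f → Deg (suc d) 0# f
    Deg-suc zero {c} {f} fd r = (λ _ → 0#) , (λ _ → refl) , λ x → begin
      f x                  ≈⟨ fd x ⟩
      c                    ≈⟨ fd r ⟨
      f r                  ≈⟨ +-identityˡ _ ⟨
      0# + f r             ≈⟨ +-congʳ (zeroʳ _) ⟨
      (x - r) * 0# + f r   ∎
    Deg-suc (suc d) fd r with fd r
    ... | g , gd , eq = g , Deg-suc d gd , eq

    Deg-≤ : ∀ {d e c f} → Deg d c f → d < e → Deg e 0# f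
    Deg-≤ {d} {f = f} fd d<e with ℕ.m≤n⇒∃[o]m+o≡n d<e
    ... | o , ≡.refl = go o
      where
      go : ∀ o → Deg (suc d ℕ.+ o) 0# f
      go zero    = ≡.subst (λ e → Deg (suc e) 0# f) (≡.sym (ℕ.+-identityʳ d)) (Deg-suc d fd)
      go (suc o) = ≡.subst (λ e → Deg (suc e) 0# f) (≡.sym (ℕ.+-suc d o)) (Deg-suc (suc d ℕ.+ o) (go o))

    -- If `g` is the quotient of `f` by x - r, then x f(x) = (x - r)(f(x) + r g(x)) + r f(r). The
    -- summand r g has lower degree than f, so the leading coefficient stays `c`.
    Deg-x* : ∀ d {c f} → Deg d c f → Deg (suc d) c (λ x → x * f x)
    Deg-x* zero {c} {f} fd r = f , fd , λ x → begin
      x * f x                       ≈⟨ *-congʳ (x-y+y≈x x r) ⟨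
      ((x - r) + r) * f x           ≈⟨ distribʳ _ _ _ ⟩
      (x - r) * f x + r * f x       ≈⟨ +-congˡ (*-congˡ (trans (fd x) (sym (fd r)))) ⟩
      (x - r) * f x + r * f r       ∎
    Deg-x* (suc d) {c} {f} fd r with fd r
    ... | g , gd , eq = (λ x → f x + r * g x) ,
      Deg-cong (suc d) (trans (+-congˡ (zeroʳ r)) (+-identityʳ c)) (Deg-+ (suc d) fd (Deg-scale (suc d) r (Deg-suc d gd))) , λ x → begin
      x * f x                                        ≈⟨ *-congʳ (x-y+y≈x x r) ⟨
      ((x - r) + r) * f x                            ≈⟨ distribʳ _ _ _ ⟩
      (x - r) * f x + r * f x                        ≈⟨ +-congˡ (*-congˡ (eq x)) ⟩
      (x - r) * f x + r * ((x - r) * g x + f r)      ≈⟨ +-congˡ (trans (distribˡ r _ _) (+-congʳ (x∙yz≈y∙xz r (x - r) (g x)))) ⟩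
      (x - r) * f x + ((x - r) * (r * g x) + r * f r) ≈⟨ +-assoc _ _ _ ⟨
      (x - r) * f x + (x - r) * (r * g x) + r * f r  ≈⟨ +-congʳ (distribˡ _ _ _) ⟨
      (x - r) * (f x + r * g x) + r * f r            ∎

    Deg-^ : ∀ n → Deg n 1# (_^ n)
    Deg-^ zero    x = refl
    Deg-^ (suc n) = Deg-x* n (Deg-^ n)

    -- The first root splits off a factor x - r that is nonzero at the other roots, so these are
    -- roots of the quotient, which has one degree less and the same leading coefficient.
    Deg-roots : ∀ d {c f} → Deg d c f → ¬ c ≈ 0# → (r : Fin (suc d) → Carrier) →
                (∀ i j → r i ≈ r j → i ≡ j) → ¬ (∀ i → f (r i) ≈ 0#)
    Deg-roots zero    fd c≉0 r r-inj f≈0 = c≉0 (trans (sym (fd _)) (f≈0 zero))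
    Deg-roots (suc d) {c} {f} fd c≉0 r r-inj f≈0 with fd (r zero)
    ... | g , gd , eq = Deg-roots d gd c≉0 (r ∘ suc) (λ i j e → Fin.suc-injective (r-inj _ _ e)) λ i →
      x*y≈0⇒y≈0 (λ e → case-≢ (r-inj (suc i) zero (x-y≈0⇒x≈y _ _ e))) (begin
        (r (suc i) - r zero) * g (r (suc i))               ≈⟨ +-identityʳ _ ⟨
        (r (suc i) - r zero) * g (r (suc i)) + 0#          ≈⟨ +-congˡ (f≈0 zero) ⟨
        (r (suc i) - r zero) * g (r (suc i)) + f (r zero)  ≈⟨ eq _ ⟨
        f (r (suc i))                                      ≈⟨ f≈0 (suc i) ⟩
        0#                                                 ∎)
      where
      case-≢ : ∀ {i : Fin (suc d)} → ¬ (Fin.suc i ≡ Fin.zero)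
      case-≢ ()

    Deg-nonvanishing : ∀ {d c f} → Deg d c f → ¬ c ≈ 0# → d < N → ¬ (∀ x → f x ≈ 0#)
    Deg-nonvanishing {d} fd c≉0 d<N f≈0 = Deg-roots d fd c≉0 (λ i → enum (inject≤ i d<N))
      (λ i j e → Fin.inject≤-injective d<N d<N i j (enum-injective _ _ e)) (λ i → f≈0 _)

    ^-+ : ∀ x m n → x ^ (m ℕ.+ n) ≈ x ^ m * x ^ n
    ^-+ = Exp.^-homo-*

    ^-∣ : ∀ x m {n} → x ^ m ≈ 1# → m ∣ n → x ^ n ≈ 1#
    ^-∣ x m xᵐ≈1 (divides k ≡.refl) = begin
      x ^ (k ℕ.* m)  ≡⟨ ≡.cong (x ^_) (ℕ.*-comm k m) ⟩
      x ^ (m ℕ.* k)  ≈⟨ Exp.^-assocʳ x m k ⟨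
      (x ^ m) ^ k    ≈⟨ Exp.^-congˡ k xᵐ≈1 ⟩
      1# ^ k         ≈⟨ 1^n≈1 k ⟩
      1#             ∎

    record IsOrder (x : Carrier) (n : ℕ) : Set where
      field
        n≢0   : n ≢ 0
        x^n≈1 : x ^ n ≈ 1#
        n∣    : ∀ j → x ^ j ≈ 1# → n ∣ j
    open IsOrder public

    ^-cancel : ∀ {x} i k → ¬ x ≈ 0# → x ^ i ≈ x ^ (i ℕ.+ k) → x ^ k ≈ 1#
    ^-cancel {x} i k x≉0 eq = *-cancelˡ _ _ (^-≉0 i x≉0) (begin
      x ^ i * x ^ k     ≈⟨ ^-+ x i k ⟨
      x ^ (i ℕ.+ k)     ≈⟨ eq ⟨
      x ^ i             ≈⟨ *-identityʳ _ ⟨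
      x ^ i * 1#        ∎)

    -- Two of N + 1 powers coincide, which yields some positive exponent with value 1#; strong
    -- induction descends from it to the least one. The least one divides every other exponent,
    -- since a nonzero remainder would be smaller still.
    order : ∀ x → ¬ x ≈ 0# → ∃ (IsOrder x)
    order x x≉0 with Fin.pigeonhole (ℕ.n<1+n N) (λ i → idx (x ^ toℕ i))
    ... | i , j , i<j , eq with ℕ.m≤n⇒∃[o]m+o≡n i<j
    ...   | k , i+k≡j = <-rec (λ m → m ≢ 0 → x ^ m ≈ 1# → ∃ (IsOrder x)) step (suc k) (λ ())
            (^-cancel (toℕ i) (suc k) x≉0 (trans (idx-injective eq) (reflexive (≡.cong (x ^_) (≡.trans (≡.sym i+k≡j) (≡.sym (ℕ.+-suc (toℕ i) k)))))))
      where
      step : ∀ m → (∀ {l} → l < m → l ≢ 0 → x ^ l ≈ 1# → ∃ (IsOrder x)) → m ≢ 0 → x ^ m ≈ 1# → ∃ (IsOrder x)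
      step zero    rec m≢0 xᵐ≈1 = ⊥-elim (m≢0 ≡.refl)
      step m@(suc _) rec m≢0 xᵐ≈1 with ℕ.anyUpTo? (λ l → ¬? (l ℕ.≟ 0) ×-dec (x ^ l ≟ 1#)) m
      ... | yes (l , l<m , l≢0 , xˡ≈1) = rec l<m l≢0 xˡ≈1
      ... | no  minimal = m , record { n≢0 = m≢0 ; x^n≈1 = xᵐ≈1 ; n∣ = λ j xʲ≈1 →
            m%n≡0⇒n∣m j m (Dec.decidable-stable (j % m ℕ.≟ 0) λ j%m≢0 →
              minimal (j % m , m%n<n j m , j%m≢0 , (begin
                x ^ (j % m)                              ≈⟨ *-identityʳ _ ⟨
                x ^ (j % m) * 1#                         ≈⟨ *-congˡ (^-∣ x m xᵐ≈1 (n∣m*n (j / m))) ⟨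
                x ^ (j % m) * x ^ (j / m ℕ.* m)          ≈⟨ ^-+ x (j % m) _ ⟨
                x ^ (j % m ℕ.+ j / m ℕ.* m)              ≡⟨ ≡.cong (x ^_) (m≡m%n+[m/n]*n j m) ⟨
                x ^ j                                    ≈⟨ xʲ≈1 ⟩
                1#                                       ∎))) }

    IsOrder-≉0 : ∀ {x n} → IsOrder x n → ¬ x ≈ 0#
    IsOrder-≉0 {x} {zero}  o x≈0 = n≢0 o ≡.refl
    IsOrder-≉0 {x} {suc n} o x≈0 = 0≉1 (trans (sym (trans (*-congʳ x≈0) (zeroˡ _))) (x^n≈1 o))

    ^-≈⇒∣ : ∀ {x n} → IsOrder x n → ∀ i k → x ^ i ≈ x ^ (i ℕ.+ k) → n ∣ k
    ^-≈⇒∣ o i k eq = n∣ o k (^-cancel i k (IsOrder-≉0 o) eq)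

    ^-injective : ∀ {x n} → IsOrder x n → ∀ {i j} → i < n → j < n → x ^ i ≈ x ^ j → i ≡ j
    ^-injective {x} {n} o {i} {j} i<n j<n eq with ℕ.≤-total i j
    ... | yes-≤ = go yes-≤
      where
      small : ∀ {i j} → j < n → x ^ i ≈ x ^ j → i ≤ j → i ≡ j
      small {i} {j} j<n eq i≤j with ℕ.m≤n⇒∃[o]m+o≡n i≤j
      ... | zero  , i+k≡j = ≡.trans (≡.sym (ℕ.+-identityʳ i)) i+k≡j
      ... | suc k , ≡.refl = ⊥-elim (ℕ.<⇒≱ (ℕ.≤-<-trans (ℕ.m≤n+m (suc k) i) j<n) (∣⇒≤ (^-≈⇒∣ o i (suc k) eq)))
      go : i ≤ j ⊎ j ≤ i → i ≡ j
      go (inj₁ i≤j) = small j<n eq i≤j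
      go (inj₂ j≤i) = ≡.sym (small i<n (sym eq) j≤i)

    -- Raising (x y)^j = 1 to the power b removes y and leaves x^(b j) = 1, so a ∣ b j and by
    -- coprimality a ∣ j; likewise for b.
    IsOrder-* : ∀ {x y a b} → IsOrder x a → IsOrder y b → Coprime a b → IsOrder (x * y) (a ℕ.* b)
    IsOrder-* {x} {y} {a} {b} ox oy a⊥b = record
      { n≢0   = λ ab≡0 → [ n≢0 ox , n≢0 oy ]′ (ℕ.m*n≡0⇒m≡0∨n≡0 a ab≡0)
      ; x^n≈1 = trans (Exp.^-distrib-* x y (a ℕ.* b))
                  (trans (*-cong (^-∣ x a (x^n≈1 ox) (m∣m*n b)) (^-∣ y b (x^n≈1 oy) (n∣m*n a))) (*-identityˡ 1#))
      ; n∣    = λ j eq → coprime-*-∣ a⊥b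
                  (coprime-divisor a⊥b (n∣ ox (b ℕ.* j) (begin
                    x ^ (b ℕ.* j)                   ≈⟨ *-identityʳ _ ⟨
                    x ^ (b ℕ.* j) * 1#              ≈⟨ *-congˡ (^-∣ y b (x^n≈1 oy) (m∣m*n j)) ⟨
                    x ^ (b ℕ.* j) * y ^ (b ℕ.* j)   ≈⟨ Exp.^-distrib-* x y (b ℕ.* j) ⟨
                    (x * y) ^ (b ℕ.* j)             ≈⟨ ^-∣ (x * y) j eq (n∣m*n b) ⟩
                    1#                              ∎)))
                  (coprime-divisor (Cop.sym a⊥b) (n∣ oy (a ℕ.* j) (begin
                    y ^ (a ℕ.* j)                   ≈⟨ *-identityˡ _ ⟨
                    1# * y ^ (a ℕ.* j)              ≈⟨ *-congʳ (^-∣ x a (x^n≈1 ox) (m∣m*n j)) ⟨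
                    x ^ (a ℕ.* j) * y ^ (a ℕ.* j)   ≈⟨ Exp.^-distrib-* x y (a ℕ.* j) ⟨
                    (x * y) ^ (a ℕ.* j)             ≈⟨ ^-∣ (x * y) j eq (n∣m*n a) ⟩
                    1#                              ∎)))
      }

    IsOrder-^ : ∀ {x} a {b} → IsOrder x (a ℕ.* b) → IsOrder (x ^ a) b
    IsOrder-^ {x} a {b} o = record
      { n≢0   = λ { ≡.refl → n≢0 o (ℕ.*-zeroʳ a) }
      ; x^n≈1 = trans (Exp.^-assocʳ x a b) (x^n≈1 o)
      ; n∣    = λ j eq → *-cancelˡ-∣ a (n∣ o (a ℕ.* j) (trans (sym (Exp.^-assocʳ x a j)) eq))
      }
      where
      instance a≢0 = ℕ.≢-nonZero {a} λ { ≡.refl → n≢0 o ≡.refl }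

    -- Some prime power p^(v+1) divides the order of x while p^v is the exact power in n. The p-part
    -- of g is exchanged for that of x: x^m′ has order p^(v+1), g^(p^v) has the order n′ prime to p,
    -- and their product has order p n.
    larger-order : ∀ {g n x} → IsOrder g n → ¬ x ≈ 0# → ¬ x ^ n ≈ 1# → ∃₂ λ g′ n′ → IsOrder g′ n′ × n < n′
    larger-order {g} {n} {x} og x≉0 xⁿ≉1 with order x x≉0
    ... | m , ox with ∤-prime-power m n (n≢0 ox) (n≢0 og) (λ m∣n → xⁿ≉1 (^-∣ x m (x^n≈1 ox) m∣n))
    ...   | p , v , m′ , n′ , p-pr , ≡.refl , ≡.refl , p∤n′ =
      _ , _ , IsOrder-* (IsOrder-^ m′ ox) (IsOrder-^ (p ℕ.^ v) og) (^-coprime (suc v) p-pr p∤n′) ,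
      ≡.subst (p ℕ.^ v ℕ.* n′ <_) (≡.sym (ℕ.*-assoc p (p ℕ.^ v) n′))
        (ℕ.<-≤-trans (ℕ.m<m*n _ p {{ℕ.≢-nonZero (n≢0 og)}} (prime>1 p-pr)) (ℕ.≤-reflexive (ℕ.*-comm _ p)))

    zero∷powers : Carrier → ∀ {n} → Fin (suc n) → Carrier
    zero∷powers g zero    = 0#
    zero∷powers g (suc i) = g ^ toℕ i

    zero∷powers-injective : ∀ {g n} → IsOrder g n → ∀ i j → zero∷powers g {n} i ≈ zero∷powers g j → i ≡ j
    zero∷powers-injective o zero    zero    eq = ≡.refl
    zero∷powers-injective o zero    (suc j) eq = ⊥-elim (^-≉0 (toℕ j) (IsOrder-≉0 o) (sym eq))
    zero∷powers-injective o (suc i) zero    eq = ⊥-elim (^-≉0 (toℕ i) (IsOrder-≉0 o) eq)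
    zero∷powers-injective o (suc i) (suc j) eq = ≡.cong suc (Fin.toℕ-injective (^-injective o (Fin.toℕ<n i) (Fin.toℕ<n j) eq))

    order<N : ∀ {g n} → IsOrder g n → n < N
    order<N {g} o = Fin.injective⇒≤ {f = λ i → idx (zero∷powers g i)} (λ {i} {j} eq → zero∷powers-injective o i j (idx-injective eq))

    -- Otherwise x^(n+1) - x would vanish at every element, 0 included, although its degree n + 1 is
    -- below N. The condition `n ≢ 0` keeps x below the leading term.
    non-root-of-unity : ∀ {n} → n ≢ 0 → suc n < N → ∃ λ x → ¬ x ≈ 0# × ¬ x ^ n ≈ 1#
    non-root-of-unity {n} n≢0 1+n<N with any-element? {λ x → ¬ x ≈ 0# × ¬ x ^ n ≈ 1#}
      (λ x≈y (p , q) → (λ e → p (trans x≈y e)) , λ e → q (trans (Exp.^-congˡ n x≈y) e))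
      (λ x → ¬? (x ≟ 0#) ×-dec ¬? (x ^ n ≟ 1#))
    ... | yes found = found
    ... | no  none  = ⊥-elim (Deg-nonvanishing {suc n} {1#}
        (Deg-cong (suc n) (+-identityʳ 1#) (Deg-+ (suc n) (Deg-^ (suc n)) (Deg-≤ {1} {c = - 1# * 1#} (Deg-scale 1 (- 1#) (Deg-^ 1)) (s≤s (ℕ.n≢0⇒n>0 n≢0)))))
        (λ e → 0≉1 (sym e)) 1+n<N vanish)
      where
      vanish : ∀ x → x ^ suc n + - 1# * (x ^ 1) ≈ 0#
      vanish x with x ≟ 0#
      ... | yes x≈0 = trans (+-cong (trans (*-congʳ x≈0) (zeroˡ _)) (trans (*-congˡ (trans (*-congʳ x≈0) (zeroˡ _))) (zeroʳ _))) (+-identityˡ 0#)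
      ... | no  x≉0 with x ^ n ≟ 1#
      ...   | no  xⁿ≉1 = ⊥-elim (none (x , x≉0 , xⁿ≉1))
      ...   | yes xⁿ≈1 = begin
        x * x ^ n + - 1# * (x * 1#)    ≈⟨ +-congʳ (*-congˡ xⁿ≈1) ⟩
        x * 1# + - 1# * (x * 1#)       ≈⟨ +-congʳ (*-identityˡ _) ⟨
        1# * (x * 1#) + - 1# * (x * 1#) ≈⟨ distribʳ _ _ _ ⟨
        (1# - 1#) * (x * 1#)           ≈⟨ *-congʳ (-‿inverseʳ 1#) ⟩
        0# * (x * 1#)                  ≈⟨ zeroˡ _ ⟩
        0#                             ∎

    order-1 : IsOrder 1# 1
    order-1 = record { n≢0 = λ () ; x^n≈1 = *-identityˡ 1# ; n∣ = λ j _ → divides j (≡.sym (ℕ.*-identityʳ j)) }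

    primitive-root : ∃₂ λ g n → IsOrder g n × suc n ≡ N
    primitive-root = grow N 1# 1 order-1 (ℕ.m≤n+m N 1)
      where
      Goal = ∃₂ λ g n → IsOrder g n × suc n ≡ N
      -- `k` is fuel with n + k at least N. The order rises in every round and stays below N by
      -- `order<N`, so the fuel cannot run out.
      grow : ∀ k g n → IsOrder g n → N ≤ n ℕ.+ k → Goal
      grow zero    g n o N≤ = ⊥-elim (ℕ.<⇒≱ (order<N o) (≡.subst (N ≤_) (ℕ.+-identityʳ n) N≤))
      grow (suc k) g n o N≤ = decide (suc n ℕ.≟ N)
        where
        enlarge : (∃₂ λ g′ n′ → IsOrder g′ n′ × n < n′) → Goal
        enlarge (g′ , n′ , o′ , n<n′) = grow k g′ n′ o′
          (ℕ.≤-trans N≤ (ℕ.≤-trans (ℕ.≤-reflexive (ℕ.+-suc n k)) (ℕ.+-monoˡ-≤ k n<n′)))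
        decide : Dec (suc n ≡ N) → Goal
        decide (yes eq)    = g , n , o , eq
        decide (no 1+n≢N) =
          let x , x≉0 , xⁿ≉1 = non-root-of-unity (n≢0 o) (ℕ.≤∧≢⇒< (order<N o) 1+n≢N)
          in enlarge (larger-order o x≉0 xⁿ≉1)

-- Characteristic, Frobenius map and reindexing of sums over the field.

module FrobeniusMap where
  open RationalSums using (Fin-surjective; injective⇒permutation)
  open FiniteFields
  open import Level using (0ℓ)
  open import Data.Nat as ℕ using (ℕ; zero; suc; _<_; _∸_; s≤s; z≤n; _!)
  import Data.Nat.Properties as ℕ
  open import Data.Nat.Combinatorics using (_C_; nCn≡1; nCk≡n!/k![n-k]!; k![n∸k]!∣n!)
  open import Data.Nat.Divisibility using (_∣_; divides; m∣m*n; ∣⇒≤; ∣1⇒≡1)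
  open import Data.Nat.DivMod using (m/n*n≡m)
  open import Data.Nat.Primality using (Prime; euclidsLemma; ¬prime[0]; ¬prime[1])
  open import Data.Fin as Fin using (Fin; zero; suc; toℕ; fromℕ; inject₁)
  import Data.Fin.Properties as Fin
  open import Data.Product using (∃; proj₁; proj₂; _,_)
  open import Data.Sum using (inj₁; inj₂)
  open import Data.Empty using (⊥-elim)
  open import Function using (_∘_)
  open import Relation.Nullary
  open import Relation.Binary.PropositionalEquality as ≡ using (_≡_)
  open import Algebra.Bundles using (CommutativeMonoid)

  prime∤! : ∀ {p} → Prime p → ∀ k → k < p → ¬ p ∣ k !
  prime∤! p-pr zero    k<p p∣1 = ¬prime[1] (≡.subst Prime (∣1⇒≡1 p∣1) p-pr)
  prime∤! p-pr (suc k) k<p p∣ with euclidsLemma (suc k) (k !) p-pr p∣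
  ... | inj₁ p∣k  = ℕ.<⇒≱ k<p (∣⇒≤ p∣k)
  ... | inj₂ p∣k! = prime∤! p-pr k (ℕ.<-trans (ℕ.n<1+n k) k<p) p∣k!

  -- The prime p divides p! = C(p, k) k! (p - k)! but neither of the two smaller factorials.
  prime∣C : ∀ {p} → Prime p → ∀ k → 0 < k → k < p → p ∣ p C k
  prime∣C {zero}  p-pr k 0<k k<p = ⊥-elim (¬prime[0] p-pr)
  prime∣C {p@(suc p′)} p-pr k 0<k k<p with euclidsLemma (p C k) (k ! ℕ.* (p ∸ k) !) p-pr
      (≡.subst (p ∣_) (≡.sym (≡.trans (≡.cong (ℕ._* (k ! ℕ.* (p ∸ k) !)) (nCk≡n!/k![n-k]! (ℕ.<⇒≤ k<p))) (m/n*n≡m {{k ℕ.!* (p ∸ k) !≢0}} (k![n∸k]!∣n! (ℕ.<⇒≤ k<p))))) (m∣m*n (p′ !)))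
  ... | inj₁ p∣C = p∣C
  ... | inj₂ p∣k![p-k]! with euclidsLemma (k !) ((p ∸ k) !) p-pr p∣k![p-k]!
  ...   | inj₁ p∣k! = ⊥-elim (prime∤! p-pr k k<p p∣k!)
  ...   | inj₂ p∣[p-k]! = ⊥-elim (prime∤! p-pr (p ∸ k) (ℕ.∸-monoʳ-< 0<k (ℕ.<⇒≤ k<p)) p∣[p-k]!)

  module Reindexing {N : ℕ} (F : FiniteField N) where
    open FieldTheory F

    enumeration-surjective : ∀ {m} → m ≡ N → (e : Fin m → Carrier) → (∀ i j → e i ≈ e j → i ≡ j) →
                             ∀ y → ∃ λ i → e i ≈ y
    enumeration-surjective ≡.refl e e-inj y with Fin-surjective (idx ∘ e) (λ {i} {j} eq → e-inj i j (idx-injective eq)) (idx y)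
    ... | i , eq = i , idx-injective eq

    module _ (C : CommutativeMonoid 0ℓ 0ℓ) where
      private module C = CommutativeMonoid C
      open import Algebra.Properties.CommutativeMonoid.Sum C using (sum; sum-permute; sum-cong-≋)

      -- An injective family of N elements differs from `enum` by a permutation of indices. The
      -- target is any commutative monoid because sums in the field and rational sums over the field
      -- are both reindexed.
      sum-reindex : (φ : Carrier → C.Carrier) → (∀ {x y} → x ≈ y → φ x C.≈ φ y) →
                    ∀ {m} → m ≡ N → (e : Fin m → Carrier) → (∀ i j → e i ≈ e j → i ≡ j) →
                    sum (λ i → φ (enum i)) C.≈ sum (λ i → φ (e i))
      sum-reindex φ φ-cong ≡.refl e e-inj = C.trans (sum-permute (λ i → φ (enum i)) π)
          (sum-cong-≋ (λ i → φ-cong (trans (reflexive (≡.cong enum (π≡ i))) (enum-idx (e i)))))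
        where
        π∃ = injective⇒permutation (idx ∘ e) (λ {i} {j} eq → e-inj i j (idx-injective eq))
        π = proj₁ π∃
        π≡ = proj₂ π∃

  module Frobenius {N p k : ℕ} (F : FiniteField N) (p-pr : Prime p) (N≡pᵏ : N ≡ p ℕ.^ k) where
    open FieldTheory F
    open Reindexing F
    open import Relation.Binary.Reasoning.Setoid setoid
    open import Algebra.Properties.CommutativeSemiring.Exp commutativeSemiring as Exp using ()
    open import Algebra.Properties.CommutativeSemiring.Binomial commutativeSemiring using (binomialTerm) renaming (theorem to binomial-theorem)
    open import Algebra.Properties.Semiring.Sum semiring using (sum; sum-cong-≋; sum-init-last; sum-replicate; sum-replicate-zero; ∑-distrib-+)
    open import Algebra.Properties.Semiring.Mult semiring using (_×_; ×-homo-1; ×-assoc-*; ×1-homo-*; ×-congʳ)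

    -- Translation by 1 permutes the field, so it does not change the sum of all elements.
    card×1≈0 : N × 1# ≈ 0#
    card×1≈0 = +-cancelˡ (sum enum) _ _ (begin
      sum enum + N × 1#                 ≈⟨ +-congˡ (sum-replicate N) ⟨
      sum enum + sum {N} (λ _ → 1#)       ≈⟨ ∑-distrib-+ enum (λ _ → 1#) ⟨
      sum (λ i → enum i + 1#)                   ≈⟨ sum-reindex +-commutativeMonoid (λ x → x) (λ eq → eq) ≡.refl (λ i → enum i + 1#) (λ i j eq → enum-injective i j (+-cancelʳ 1# _ _ eq)) ⟨
      sum enum                                  ≈⟨ +-identityʳ _ ⟨
      sum enum + 0#                             ∎)

    -- As N = p^k, the multiple p^k × 1# vanishes; it is a power of p × 1#, and a field has no zero
    -- divisors.
    char : p × 1# ≈ 0#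
    char = descend k (≡.subst (λ m → m × 1# ≈ 0#) N≡pᵏ card×1≈0)
      where
      descend : ∀ j → (p ℕ.^ j) × 1# ≈ 0# → p × 1# ≈ 0#
      descend zero    eq = ⊥-elim (0≉1 (trans (sym eq) (×-homo-1 1#)))
      descend (suc j) eq with p × 1# ≟ 0#
      ... | yes p≈0 = p≈0
      ... | no  p≉0 = descend j (x*y≈0⇒y≈0 p≉0 (trans (sym (×1-homo-* p (p ℕ.^ j))) eq))

    char-multiple : ∀ {m} x → p ∣ m → m × x ≈ 0#
    char-multiple x (divides c ≡.refl) = begin
      (c ℕ.* p) × x          ≈⟨ ×-congʳ (c ℕ.* p) (*-identityˡ x) ⟨
      (c ℕ.* p) × (1# * x)   ≈⟨ ×-assoc-* (c ℕ.* p) 1# x ⟨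
      ((c ℕ.* p) × 1#) * x   ≈⟨ *-congʳ (×1-homo-* c p) ⟩
      (c × 1#) * (p × 1#) * x ≈⟨ *-congʳ (trans (*-congˡ char) (zeroʳ _)) ⟩
      0# * x                 ≈⟨ zeroˡ x ⟩
      0#                     ∎

    frobenius : ∀ x y → (x + y) ^ p ≈ x ^ p + y ^ p
    frobenius x y = go p ≡.refl
      where
      go : ∀ r → r ≡ p → (x + y) ^ r ≈ x ^ r + y ^ r
      go zero     r≡p = ⊥-elim (¬prime[0] (≡.subst Prime (≡.sym r≡p) p-pr))
      go r@(suc r′) r≡p = begin
        (x + y) ^ r                                                          ≈⟨ binomial-theorem r x y ⟩
        t zero + sum (t ∘ suc)                                               ≈⟨ +-cong first (sum-init-last (t ∘ suc)) ⟩
        y ^ r + (sum (λ i → t (suc (inject₁ i))) + t (suc (fromℕ r′)))       ≈⟨ +-congˡ (+-cong (trans (sum-cong-≋ middle) (sum-replicate-zero r′)) final) ⟩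
        y ^ r + (0# + x ^ r)                                                 ≈⟨ +-congˡ (+-identityˡ _) ⟩
        y ^ r + x ^ r                                                        ≈⟨ +-comm _ _ ⟩
        x ^ r + y ^ r                                                        ∎
        where
        t = binomialTerm x y r
        first : t zero ≈ y ^ r
        first = trans (×-homo-1 _) (*-identityˡ _)
        middle : ∀ i → t (suc (inject₁ i)) ≈ 0#
        middle i = char-multiple _ (≡.subst (λ s → s ∣ r C suc (toℕ (inject₁ i))) r≡p
          (prime∣C (≡.subst Prime (≡.sym r≡p) p-pr) (suc (toℕ (inject₁ i))) (s≤s z≤n)
            (≡.subst (λ a → suc a < r) (≡.sym (Fin.toℕ-inject₁ i)) (s≤s (Fin.toℕ<n i)))))
        last-term : ∀ j → j ≡ r → (r C j) × (x ^ j * y ^ (r ∸ j)) ≈ x ^ r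
        last-term j ≡.refl = begin
          (r C r) × (x ^ r * y ^ (r ∸ r))    ≡⟨ ≡.cong₂ (λ a b → a × (x ^ r * y ^ b)) (nCn≡1 r) (ℕ.n∸n≡0 r) ⟩
          1 × (x ^ r * 1#)                   ≈⟨ ×-homo-1 _ ⟩
          x ^ r * 1#                         ≈⟨ *-identityʳ _ ⟩
          x ^ r                              ∎
        final : t (suc (fromℕ r′)) ≈ x ^ r
        final = last-term (suc (toℕ (fromℕ r′))) (≡.cong suc (Fin.toℕ-fromℕ r′))

    frobenius-^ : ∀ j x y → (x + y) ^ (p ℕ.^ j) ≈ x ^ (p ℕ.^ j) + y ^ (p ℕ.^ j)
    frobenius-^ zero    x y = trans (*-identityʳ _) (sym (+-cong (*-identityʳ x) (*-identityʳ y)))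
    frobenius-^ (suc j) x y = begin
      (x + y) ^ (p ℕ.* p ℕ.^ j)                        ≈⟨ Exp.^-assocʳ (x + y) p (p ℕ.^ j) ⟨
      ((x + y) ^ p) ^ (p ℕ.^ j)                        ≈⟨ Exp.^-congˡ (p ℕ.^ j) (frobenius x y) ⟩
      (x ^ p + y ^ p) ^ (p ℕ.^ j)                      ≈⟨ frobenius-^ j (x ^ p) (y ^ p) ⟩
      (x ^ p) ^ (p ℕ.^ j) + (y ^ p) ^ (p ℕ.^ j)        ≈⟨ +-cong (Exp.^-assocʳ x p (p ℕ.^ j)) (Exp.^-assocʳ y p (p ℕ.^ j)) ⟩
      x ^ (p ℕ.* p ℕ.^ j) + y ^ (p ℕ.* p ℕ.^ j)        ∎

-- Rational sums of characters modulo primes and their convolution.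

module ResidueKernels where
  open NumberTheory
  open RationalSums
  open import Data.Nat as ℕ using (ℕ; zero; suc)
  import Data.Nat.Properties as ℕ
  open import Data.Nat.Divisibility using (_∣_; divides; ∣-trans; ∣⇒≤; m%n≡0⇒n∣m; m∣m*n; n∣m*n; ∣1⇒≡1)
  open import Data.Nat.DivMod using (_%_; m%n<n; %-distribˡ-+; [m+kn]%n≡m%n; m%n%n≡m%n; m<n⇒m%n≡m)
  open import Data.Nat.Primality using (Prime; euclidsLemma; ¬prime[0]; ¬prime[1])
  open import Data.Nat.ListAction using (product)
  open import Data.Rational using (ℚ; 0ℚ; 1ℚ; _+_; _*_; _-_; -_; _<_; ∣_∣)
  import Data.Rational.Properties as ℚ
  open import Data.Fin as Fin using (Fin; toℕ; fromℕ<)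
  import Data.Fin.Properties as Fin
  open import Data.Fin.Permutation using (_⟨$⟩ʳ_)
  open import Data.List using (List; []; _∷_)
  open import Data.List.Relation.Unary.All as All using (All; []; _∷_)
  open import Data.List.Relation.Unary.AllPairs using ([]; _∷_)
  open import Data.List.Relation.Unary.Unique.Propositional using (Unique)
  open import Data.Product
  open import Data.Sum using (inj₁; inj₂)
  open import Data.Empty using (⊥-elim)
  open import Relation.Nullary
  open import Relation.Binary.PropositionalEquality
  open import Algebra.Bundles using (CommutativeRing)
  open import Tactic.RingSolver using (solve-∀)
  open import Algebra.Properties.Semiring.Sum (CommutativeRing.semiring ℚ.+-*-commutativeRing)
    using (sum; sum-cong-≗; sum-permute)
  open ≡-Reasoning

  -- Congruence modulo 0 is taken to be equality. This makes residues total in the modulus, so the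
  -- kernels carry no nonzeroness proof, and the congruence lemmas hold for 0 as well.
  res : ℕ → ℕ → ℕ
  res zero    x = x
  res (suc p) x = x % suc p

  res-+ : ∀ p {x y} t → res p x ≡ res p y → res p (x ℕ.+ t) ≡ res p (y ℕ.+ t)
  res-+ zero    t eq = cong (ℕ._+ t) eq
  res-+ (suc p) {x} {y} t eq = trans (%-distribˡ-+ x t (suc p))
    (trans (cong (λ r → (r ℕ.+ t % suc p) % suc p) eq) (sym (%-distribˡ-+ y t (suc p))))

  res-∣ : ∀ p {m} x → p ∣ m → res p (x ℕ.+ m) ≡ res p x
  res-∣ zero    x (divides k refl) = trans (cong (x ℕ.+_) (ℕ.*-zeroʳ k)) (ℕ.+-identityʳ x)
  res-∣ (suc p) x (divides k refl) = [m+kn]%n≡m%n x k (suc p)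

  res-+-cancel : ∀ p {x y} t → res p (x ℕ.+ t) ≡ res p (y ℕ.+ t) → res p x ≡ res p y
  res-+-cancel zero    {x} {y} t eq = ℕ.+-cancelʳ-≡ t x y eq
  -- Adding t * p after t makes a multiple of suc p in all, which undoes the shift by t.
  res-+-cancel (suc p) {x} {y} t eq = trans (sym (full x)) (trans (res-+ (suc p) {x ℕ.+ t} {y ℕ.+ t} (t ℕ.* p) eq) (full y))
    where
    full : ∀ x → res (suc p) (x ℕ.+ t ℕ.+ t ℕ.* p) ≡ res (suc p) x
    full x = trans (cong (res (suc p)) (trans (ℕ.+-assoc x t (t ℕ.* p)) (cong (x ℕ.+_) (sym (ℕ.*-suc t p))))) (res-∣ (suc p) x (n∣m*n t))

  res≡0⇒∣ : ∀ p {x} → res p x ≡ res p 0 → p ∣ x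
  res≡0⇒∣ zero    refl = divides 0 refl
  res≡0⇒∣ (suc p) {x} eq = m%n≡0⇒n∣m x (suc p) eq

  ∣⇒res≡0 : ∀ p {x} → p ∣ x → res p x ≡ res p 0
  ∣⇒res≡0 p = res-∣ p 0

  res-shift⇒∣ : ∀ p x {k} → res p x ≡ res p (x ℕ.+ k) → p ∣ k
  res-shift⇒∣ p x {k} eq = res≡0⇒∣ p (res-+-cancel p x (trans (cong (res p) (ℕ.+-comm k x)) (sym eq)))

  I : ℕ → ℕ → ℕ → ℚ
  I p x y = 𝟙 (res p x ℕ.≟ res p y)

  I-sym : ∀ p x y → I p x y ≡ I p y x
  I-sym p x y = 𝟙-⇔ (res p x ℕ.≟ res p y) (res p y ℕ.≟ res p x) sym sym

  I-shift : ∀ p x y t → I p (x ℕ.+ t) (y ℕ.+ t) ≡ I p x y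
  I-shift p x y t = 𝟙-⇔ (res p (x ℕ.+ t) ℕ.≟ res p (y ℕ.+ t)) (res p x ℕ.≟ res p y) (res-+-cancel p t) (res-+ p t)

  I-respʳ : ∀ p x y z → res p y ≡ res p z → I p x y ≡ I p x z
  I-respʳ p x y z eq = 𝟙-⇔ (res p x ℕ.≟ res p y) (res p x ℕ.≟ res p z) (λ e → trans e eq) (λ e → trans e (sym eq))

  -- Turns a product of two indicators in z into a constant times one of them, so that `∑-κκ` can be
  -- summed term by term.
  I-* : ∀ p x y z → I p x z * I p y z ≡ I p x y * I p x z
  I-* p x y z with res p x ℕ.≟ res p z
  ... | yes x≡z = trans (ℚ.*-comm 1ℚ (I p y z)) (cong (_* 1ℚ) (trans (I-sym p y z)
    (𝟙-⇔ (res p z ℕ.≟ res p y) (res p x ℕ.≟ res p y) (trans x≡z) (trans (sym x≡z)))))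
  ... | no  _   = trans (ℚ.*-zeroˡ (I p y z)) (sym (ℚ.*-zeroʳ (I p x y)))

  -- The numbers z + j m with j < p form a complete residue system: a coincidence of two of them
  -- would make `p` divide a difference smaller than p times `m`.
  residue-sum : ∀ {p m} → Prime p → ¬ p ∣ m → ∀ h → (∀ x y → res p x ≡ res p y → h x ≡ h y) → ∀ z →
                ∑ p (λ j → h (z ℕ.+ j ℕ.* m)) ≡ ∑ p h
  residue-sum {zero}  p-pr p∤m h h-resp z = refl
  residue-sum {p@(suc p′)} {m} p-pr p∤m h h-resp z = begin
    ∑ p (λ j → h (z ℕ.+ j ℕ.* m))                    ≡⟨ sum-cong-≗ {p} (λ j → h-resp (ζ j) (toℕ (π ⟨$⟩ʳ j)) (trans (sym (m%n%n≡m%n (ζ j) p)) (cong (_% p) (sym (toℕ-π j))))) ⟩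
    sum {p} (λ j → h (toℕ (π ⟨$⟩ʳ j)))               ≡⟨ sum-permute (λ j → h (toℕ j)) π ⟨
    ∑ p h                                            ∎
    where
    ζ : Fin p → ℕ
    ζ j = z ℕ.+ toℕ j ℕ.* m
    f : Fin p → Fin p
    f j = fromℕ< (m%n<n (ζ j) p)
    toℕ-f : ∀ j → toℕ (f j) ≡ ζ j % p
    toℕ-f j = Fin.toℕ-fromℕ< (m%n<n (ζ j) p)
    small : ∀ i k → i ℕ.+ k ℕ.< p → res p (z ℕ.+ i ℕ.* m) ≡ res p (z ℕ.+ (i ℕ.+ k) ℕ.* m) → i ≡ i ℕ.+ k
    small i zero    _   _  = sym (ℕ.+-identityʳ i)
    small i (suc k) i+k<p eq with euclidsLemma (suc k) m p-pr (res-shift⇒∣ p (z ℕ.+ i ℕ.* m)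
      (trans eq (cong (res p) (trans (cong (z ℕ.+_) (ℕ.*-distribʳ-+ m i (suc k))) (sym (ℕ.+-assoc z (i ℕ.* m) (suc k ℕ.* m)))))))
    ... | inj₁ p∣k = ⊥-elim (ℕ.<⇒≱ (ℕ.≤-<-trans (ℕ.m≤n+m (suc k) i) i+k<p) (∣⇒≤ p∣k))
    ... | inj₂ p∣m = ⊥-elim (p∤m p∣m)
    inj : ∀ i j → i ℕ.< p → j ℕ.< p → res p (z ℕ.+ i ℕ.* m) ≡ res p (z ℕ.+ j ℕ.* m) → i ≡ j
    inj i j i<p j<p eq with ℕ.≤-total i j
    ... | inj₁ i≤j with ℕ.m≤n⇒∃[o]m+o≡n i≤j
    ...   | k , refl = small i k j<p eq
    inj i j i<p j<p eq | inj₂ j≤i with ℕ.m≤n⇒∃[o]m+o≡n j≤i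
    ...   | k , refl = sym (small j k i<p (sym eq))
    π∃ = injective⇒permutation f λ {i} {j} eq → Fin.toℕ-injective (inj (toℕ i) (toℕ j) (Fin.toℕ<n i) (Fin.toℕ<n j)
      (trans (sym (toℕ-f i)) (trans (cong toℕ eq) (toℕ-f j))))
    π = proj₁ π∃
    toℕ-π : ∀ j → toℕ (π ⟨$⟩ʳ j) ≡ ζ j % p
    toℕ-π j = trans (cong toℕ (proj₂ π∃ j)) (toℕ-f j)

  ∑-I : ∀ {p m} → Prime p → ¬ p ∣ m → ∀ x z → ∑ p (λ j → I p x (z ℕ.+ j ℕ.* m)) ≡ 1ℚ
  ∑-I {zero}  p-pr p∤m x z = ⊥-elim (¬prime[0] p-pr)
  ∑-I {p@(suc p′)} {m} p-pr p∤m x z = trans (residue-sum p-pr p∤m (I p x) (I-respʳ p x) z)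
    (sum-𝟙-unique {p} (λ j → res p x ℕ.≟ res p (toℕ j)) (fromℕ< (m%n<n x p))
      (sym (trans (cong (_% p) (Fin.toℕ-fromℕ< (m%n<n x p))) (m%n%n≡m%n x p)))
      λ j eq → Fin.toℕ-injective (trans (sym (m<n⇒m%n≡m (Fin.toℕ<n j))) (trans (sym eq) (sym (Fin.toℕ-fromℕ< (m%n<n x p))))))

  recip-pred : ℕ → ℚ
  recip-pred p = recip (p ℕ.∸ 1)

  recip-pred-inverse : ∀ {p} → Prime p → recip-pred p * (ι p - 1ℚ) ≡ 1ℚ
  recip-pred-inverse {zero}        p-pr = ⊥-elim (¬prime[0] p-pr)
  recip-pred-inverse {suc zero}    p-pr = ⊥-elim (¬prime[1] p-pr)
  recip-pred-inverse {suc (suc p)} p-pr = trans (ℚ.*-comm (recip-pred (suc (suc p))) _)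
    (trans (cong (_* recip (suc p)) (trans (cong (_- 1ℚ) (ι-+ 1 (suc p))) (lem (ι (suc p))))) (ι*recip p))
    where
    lem : ∀ a → 1ℚ + a - 1ℚ ≡ a
    lem = solve-∀ ℚ-ring

  -- The sum over the p - 1 nontrivial characters of ℤ/p, normalised to 1 at x ≡ y.
  κ : ℕ → ℕ → ℕ → ℚ
  κ p x y = recip-pred p * (ι p * I p x y - 1ℚ)

  ∑-κ : ∀ {p m} → Prime p → ¬ p ∣ m → ∀ x z → ∑ p (λ j → κ p x (z ℕ.+ j ℕ.* m)) ≡ 0ℚ
  ∑-κ {p} {m} p-pr p∤m x z = begin
    ∑ p (λ j → recip-pred p * (ι p * i j - 1ℚ))         ≡⟨ ∑-*ˡ p (recip-pred p) (λ j → ι p * i j - 1ℚ) ⟩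
    recip-pred p * ∑ p (λ j → ι p * i j - 1ℚ)           ≡⟨ cong (recip-pred p *_) (∑-- p (λ j → ι p * i j) (λ _ → 1ℚ)) ⟩
    recip-pred p * (∑ p (λ j → ι p * i j) - ∑ p (λ _ → 1ℚ)) ≡⟨ cong₂ (λ a b → recip-pred p * (a - b)) (trans (∑-*ˡ p (ι p) i) (cong (ι p *_) (∑-I p-pr p∤m x z))) (∑-const p 1ℚ) ⟩
    recip-pred p * (ι p * 1ℚ - ι p * 1ℚ)                ≡⟨ lem (recip-pred p) (ι p) ⟩
    0ℚ                                         ∎
    where
    i : ℕ → ℚ
    i j = I p x (z ℕ.+ j ℕ.* m)
    lem : ∀ a b → a * (b * 1ℚ - b * 1ℚ) ≡ 0ℚ
    lem = solve-∀ ℚ-ring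

  -- Orthogonality of the p - 1 nontrivial characters: their normalised sum convolved with itself is
  -- p/(p - 1) times itself.
  ∑-κκ : ∀ {p m} → Prime p → ¬ p ∣ m → ∀ x y z →
         ∑ p (λ j → κ p x (z ℕ.+ j ℕ.* m) * κ p y (z ℕ.+ j ℕ.* m)) ≡ ι p * (recip-pred p * κ p x y)
  ∑-κκ {p} {m} p-pr p∤m x y z = begin
    ∑ p (λ j → κ p x (ζ j) * κ p y (ζ j))
      ≡⟨ ∑-cong p (λ j → trans (expand (recip-pred p) (ι p) (i j) (i′ j)) (cong (λ a → recip-pred p * recip-pred p * (ι p * ι p * a - ι p * i j - ι p * i′ j + 1ℚ)) (I-* p x y (ζ j)))) ⟩
    ∑ p (λ j → recip-pred p * recip-pred p * (ι p * ι p * (c * i j) - ι p * i j - ι p * i′ j + 1ℚ))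
      ≡⟨ ∑-cong p (λ j → regroup (recip-pred p) (ι p) c (i j) (i′ j)) ⟩
    ∑ p (λ j → a₁ * i j + a₂ * i′ j + a₃)
      ≡⟨ trans (∑-+ p (λ j → a₁ * i j + a₂ * i′ j) (λ _ → a₃)) (cong (_+ ∑ p (λ _ → a₃)) (∑-+ p (λ j → a₁ * i j) (λ j → a₂ * i′ j))) ⟩
    ∑ p (λ j → a₁ * i j) + ∑ p (λ j → a₂ * i′ j) + ∑ p (λ _ → a₃)
      ≡⟨ cong₂ _+_ (cong₂ _+_ (trans (∑-*ˡ p a₁ i) (cong (a₁ *_) (∑-I p-pr p∤m x z))) (trans (∑-*ˡ p a₂ i′) (cong (a₂ *_) (∑-I p-pr p∤m y z)))) (∑-const p a₃) ⟩
    a₁ * 1ℚ + a₂ * 1ℚ + ι p * a₃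
      ≡⟨ collect (recip-pred p) (ι p) c ⟩
    ι p * (recip-pred p * (recip-pred p * (ι p * c - 1ℚ))) ∎
    where
    ζ : ℕ → ℕ
    ζ j = z ℕ.+ j ℕ.* m
    i i′ : ℕ → ℚ
    i j = I p x (ζ j)
    i′ j = I p y (ζ j)
    c = I p x y
    a₁ = recip-pred p * recip-pred p * (ι p * ι p * c - ι p)
    a₂ = - (recip-pred p * recip-pred p * ι p)
    a₃ = recip-pred p * recip-pred p
    expand : ∀ r p i i′ → r * (p * i - 1ℚ) * (r * (p * i′ - 1ℚ)) ≡ r * r * (p * p * (i * i′) - p * i - p * i′ + 1ℚ)
    expand = solve-∀ ℚ-ring
    regroup : ∀ r p c i i′ → r * r * (p * p * (c * i) - p * i - p * i′ + 1ℚ) ≡ r * r * (p * p * c - p) * i + - (r * r * p) * i′ + r * r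
    regroup = solve-∀ ℚ-ring
    collect : ∀ r p c → r * r * (p * p * c - p) * 1ℚ + - (r * r * p) * 1ℚ + p * (r * r) ≡ p * (r * (r * (p * c - 1ℚ)))
    collect = solve-∀ ℚ-ring

  -- For distinct primes with product m this is the Ramanujan sum c_m(x - y) divided by φ(m).
  κs : List ℕ → ℕ → ℕ → ℚ
  κs []       x y = 1ℚ
  κs (p ∷ ps) x y = κ p x y * κs ps x y

  κs-sym : ∀ ps x y → κs ps x y ≡ κs ps y x
  κs-sym []       x y = refl
  κs-sym (p ∷ ps) x y = cong₂ (λ a b → recip-pred p * (ι p * a - 1ℚ) * b) (I-sym p x y) (κs-sym ps x y)

  κs-shift : ∀ ps x y t → κs ps (x ℕ.+ t) (y ℕ.+ t) ≡ κs ps x y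
  κs-shift []       x y t = refl
  κs-shift (p ∷ ps) x y t = cong₂ (λ a b → recip-pred p * (ι p * a - 1ℚ) * b) (I-shift p x y t) (κs-shift ps x y t)

  κ-periodic : ∀ {p m} x → p ∣ m → Periodic m (κ p x)
  κ-periodic {p} x p∣m i = cong (λ a → recip-pred p * (ι p * a - 1ℚ)) (I-respʳ p x (i ℕ.+ _) i (res-∣ p i p∣m))

  κs-periodic : ∀ {ps m} x → All (_∣ m) ps → Periodic m (κs ps x)
  κs-periodic x []           i = refl
  κs-periodic x (p∣m ∷ ps∣m) i = cong₂ _*_ (κ-periodic x p∣m i) (κs-periodic x ps∣m i)

  κ-diag : ∀ {p x y} → Prime p → res p x ≡ res p y → κ p x y ≡ 1ℚ
  κ-diag {p} {x} {y} p-pr eq = trans (cong (λ a → recip-pred p * (a - 1ℚ)) (trans (cong (ι p *_) (𝟙-yes (res p x ℕ.≟ res p y) eq)) (ℚ.*-identityʳ (ι p)))) (recip-pred-inverse p-pr)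

  κs-diag : ∀ {ps x} → All Prime ps → All (_∣ x) ps → κs ps x 0 ≡ 1ℚ
  κs-diag []           []           = refl
  κs-diag (p-pr ∷ prs) (p∣x ∷ ps∣x) = trans (cong₂ _*_ (κ-diag p-pr (∣⇒res≡0 _ p∣x)) (κs-diag prs ps∣x)) (ℚ.*-identityˡ 1ℚ)

  -- This is 1/φ(m) for m the product of distinct primes; convolution over ℤ/M reproduces `κs ps`
  -- with the factor `ι M * cs ps`.
  cs : List ℕ → ℚ
  cs []       = 1ℚ
  cs (p ∷ ps) = recip-pred p * cs ps

  recip-pred-pos : ∀ {p} → Prime p → 0ℚ < recip-pred p
  recip-pred-pos {zero}        p-pr = ⊥-elim (¬prime[0] p-pr)
  recip-pred-pos {suc zero}    p-pr = ⊥-elim (¬prime[1] p-pr)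
  recip-pred-pos {suc (suc p)} p-pr = ℚ.positive⁻¹ (recip (suc p)) {{ℚ.normalize-pos 1 (suc p)}}

  cs-pos : ∀ {ps} → All Prime ps → 0ℚ < cs ps
  cs-pos []           = ℚ.positive⁻¹ 1ℚ
  cs-pos (p-pr ∷ prs) = *-pos (recip-pred-pos p-pr) (cs-pos prs)

  all∣product : ∀ ps → All (_∣ product ps) ps
  all∣product []       = []
  all∣product (p ∷ ps) = m∣m*n (product ps) ∷ All.map (λ q∣ → ∣-trans q∣ (n∣m*n p)) (all∣product ps)

  prime∤product : ∀ {p ps} → Prime p → All Prime ps → All (p ≢_) ps → ¬ p ∣ product ps
  prime∤product p-pr []           []           p∣1 = ¬prime[1] (subst Prime (∣1⇒≡1 p∣1) p-pr)
  prime∤product {ps = q ∷ ps} p-pr (q-pr ∷ prs) (p≢q ∷ p≢ps) p∣ with euclidsLemma q (product ps) p-pr p∣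
  ... | inj₁ p∣q  = p≢q (prime∣prime p-pr q-pr p∣q)
  ... | inj₂ p∣ps = prime∤product p-pr prs p≢ps p∣ps

  -- Translating z by multiples of m moves only h, so h may be replaced by its average.
  ∑-average : ∀ {p m M h G C} → Periodic M h → Periodic M G → Periodic m G → (∀ z → ∑ p (λ j → h (z ℕ.+ j ℕ.* m)) ≡ C) →
        ι p * ∑ M (λ z → h z * G z) ≡ C * ∑ M G
  ∑-average {p} {m} {M} {h} {G} {C} h-per G-per G-per′ avg = begin
    ι p * ∑ M (λ z → h z * G z)                                            ≡⟨ ∑-const p _ ⟨
    ∑ p (λ j → ∑ M (λ z → h z * G z))                                      ≡⟨ ∑-cong p (λ j → ∑-shift {M} {λ z → h z * G z} (λ i → cong₂ _*_ (h-per i) (G-per i)) (j ℕ.* m)) ⟨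
    ∑ p (λ j → ∑ M (λ z → h (z ℕ.+ j ℕ.* m) * G (z ℕ.+ j ℕ.* m)))          ≡⟨ ∑-cong p (λ j → ∑-cong M (λ z → trans (cong (h (z ℕ.+ j ℕ.* m) *_) (periodic-* {m} {G} j G-per′ z)) (ℚ.*-comm (h (z ℕ.+ j ℕ.* m)) (G z)))) ⟩
    ∑ p (λ j → ∑ M (λ z → G z * h (z ℕ.+ j ℕ.* m)))                        ≡⟨ ∑-swap p M (λ j z → G z * h (z ℕ.+ j ℕ.* m)) ⟩
    ∑ M (λ z → ∑ p (λ j → G z * h (z ℕ.+ j ℕ.* m)))                        ≡⟨ ∑-cong M (λ z → trans (∑-*ˡ p (G z) (λ j → h (z ℕ.+ j ℕ.* m))) (trans (cong (G z *_) (avg z)) (ℚ.*-comm (G z) C))) ⟩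
    ∑ M (λ z → C * G z)                                                    ≡⟨ ∑-*ˡ M C G ⟩
    C * ∑ M G                                                              ∎

  -- The Chinese remainder theorem in the form of `∑-average`: translating by multiples of
  -- `product ps` fixes the kernels at the primes of `ps` and runs through all residues modulo the
  -- new prime `p`, so the factor at `p` may be replaced by its average, given by `∑-κκ`.
  ∑-κsκs : ∀ {M ps} → All Prime ps → Unique ps → All (_∣ M) ps → ∀ x y →
           ∑ M (λ z → κs ps x z * κs ps y z) ≡ ι M * cs ps * κs ps x y
  ∑-κsκs {M} [] [] [] x y = trans (∑-const M (1ℚ * 1ℚ)) (lem (ι M))
    where
    lem : ∀ a → a * (1ℚ * 1ℚ) ≡ a * 1ℚ * 1ℚ
    lem = solve-∀ ℚ-ring
  ∑-κsκs {M} {p ∷ ps} (p-pr ∷ prs) (p≢ ∷ uniq) (p∣M ∷ ps∣M) x y = ι-cancelˡ (prime≢0 p-pr) (begin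
    ι p * ∑ M (λ z → κ p x z * κs ps x z * (κ p y z * κs ps y z))
      ≡⟨ cong (ι p *_) (∑-cong M (λ z → medial (κ p x z) (κs ps x z) (κ p y z) (κs ps y z))) ⟩
    ι p * ∑ M (λ z → κ p x z * κ p y z * (κs ps x z * κs ps y z))
      ≡⟨ ∑-average {p} {product ps} {M} {λ z → κ p x z * κ p y z} {λ z → κs ps x z * κs ps y z}
           (λ i → cong₂ _*_ (κ-periodic x p∣M i) (κ-periodic y p∣M i))
           (λ i → cong₂ _*_ (κs-periodic x ps∣M i) (κs-periodic y ps∣M i))
           (λ i → cong₂ _*_ (κs-periodic x (all∣product ps) i) (κs-periodic y (all∣product ps) i))
           (∑-κκ p-pr (prime∤product p-pr prs p≢) x y) ⟩
    ι p * (recip-pred p * κ p x y) * ∑ M (λ z → κs ps x z * κs ps y z)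
      ≡⟨ cong (ι p * (recip-pred p * κ p x y) *_) (∑-κsκs prs uniq ps∣M x y) ⟩
    ι p * (recip-pred p * κ p x y) * (ι M * cs ps * κs ps x y)
      ≡⟨ collect (ι p) (recip-pred p) (κ p x y) (ι M) (cs ps) (κs ps x y) ⟩
    ι p * (ι M * (recip-pred p * cs ps) * (κ p x y * κs ps x y)) ∎)
    where
    medial : ∀ a b c d → a * b * (c * d) ≡ a * c * (b * d)
    medial = solve-∀ ℚ-ring
    collect : ∀ p r k m c l → p * (r * k) * (m * c * l) ≡ p * (m * (r * c) * (k * l))
    collect = solve-∀ ℚ-ring

  -- The kernel at the head prime already averages to 0. The list has to be nonempty: for the empty
  -- one the kernel is the trivial character, with sum M.
  ∑-κs : ∀ {M p ps} → All Prime (p ∷ ps) → Unique (p ∷ ps) → All (_∣ M) (p ∷ ps) → ∀ x →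
         ∑ M (κs (p ∷ ps) x) ≡ 0ℚ
  ∑-κs {M} {p} {ps} (p-pr ∷ prs) (p≢ ∷ uniq) (p∣M ∷ ps∣M) x = ι-cancelˡ (prime≢0 p-pr) (begin
    ι p * ∑ M (λ z → κ p x z * κs ps x z)  ≡⟨ ∑-average {p} {product ps} {M} (κ-periodic x p∣M) (κs-periodic x ps∣M) (κs-periodic x (all∣product ps)) (∑-κ p-pr (prime∤product p-pr prs p≢) x) ⟩
    0ℚ * ∑ M (κs ps x)                     ≡⟨ trans (ℚ.*-zeroˡ (∑ M (κs ps x))) (sym (ℚ.*-zeroʳ (ι p))) ⟩
    ι p * 0ℚ                               ∎)

-- Character sums over a weight with difference-set correlations, and the sieve.

module Sieve where
  open RationalSums
  open ResidueKernels
  open import Data.Nat as ℕ using (ℕ; zero; suc)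
  import Data.Nat.Properties as ℕ
  open import Data.Nat.Divisibility using (_∣_; _∣?_; divides; ∣-trans)
  open import Data.Nat.Primality using (Prime; ¬prime[0])
  open import Data.Rational using (ℚ; 0ℚ; 1ℚ; _+_; _*_; _-_; -_; _≤_; _<_; positive; ∣_∣)
  import Data.Rational.Properties as ℚ
  open import Data.List using (List; []; _∷_; length)
  open import Data.List.Relation.Unary.All as All using (All; []; _∷_)
  open import Data.List.Relation.Unary.AllPairs using ([]; _∷_)
  open import Data.List.Relation.Unary.Unique.Propositional using (Unique)
  open import Data.Product
  open import Data.Sum using (inj₁; inj₂; _⊎_)
  open import Data.Empty using (⊥-elim)
  open import Function using (_∘_)
  open import Relation.Nullary
  open import Relation.Binary.PropositionalEquality
  open import Tactic.RingSolver using (solve-∀)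

  ∑-*-∑ : ∀ m n f g → ∑ m f * ∑ n g ≡ ∑ m (λ i → ∑ n (λ j → f i * g j))
  ∑-*-∑ m n f g = begin
    ∑ m f * ∑ n g                       ≡⟨ ℚ.*-comm (∑ m f) (∑ n g) ⟩
    ∑ n g * ∑ m f                       ≡⟨ ∑-*ˡ m (∑ n g) f ⟨
    ∑ m (λ i → ∑ n g * f i)             ≡⟨ ∑-cong m (λ i → trans (ℚ.*-comm (∑ n g) (f i)) (sym (∑-*ˡ n (f i) g))) ⟩
    ∑ m (λ i → ∑ n (λ j → f i * g j))   ∎
    where open ≡-Reasoning

  module Autocorrelated
    (M Q : ℕ) (w : ℕ → ℚ) (M≢0 : M ≢ 0) (Q∣M : Q ∣ M) (w-periodic : Periodic M w)
    (lam D : ℚ) (correlation : ∀ t → ∑ M (λ y → w y * w (y ℕ.+ t)) ≡ lam + D * 𝟙 (Q ∣? t))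
    where

    -- For the trace set this equals (q - 1)² q^(n-2), the square of the Gauss sum bound.
    D′ : ℚ
    D′ = D * ∑ M (λ t → 𝟙 (Q ∣? t))

    record Divisors (ps : List ℕ) : Set where
      constructor divisors
      field
        primes : All Prime ps
        unique : Unique ps
        ∣Q     : All (_∣ Q) ps

      ∣M : All (_∣ M) ps
      ∣M = All.map (λ p∣Q → ∣-trans p∣Q Q∣M) ∣Q

    open Divisors

    -- Substituting x = t + y turns the double sum into the sum over t of the kernel times the
    -- autocorrelation at t. The constant `lam` is killed because a nontrivial kernel sums to 0; the
    -- part with `D` lives on multiples of Q, where the kernel is 1.
    energy : ∀ {p ps} → Divisors (p ∷ ps) →
             ∑ M (λ x → ∑ M (λ y → w x * w y * κs (p ∷ ps) x y)) ≡ D′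
    energy {p} {ps} div = begin
      ∑ M (λ x → ∑ M (λ y → w x * w y * K x y))                   ≡⟨ ∑-swap M M (λ x y → w x * w y * K x y) ⟩
      ∑ M (λ y → ∑ M (λ x → w x * w y * K x y))                   ≡⟨ ∑-cong M (λ y → ∑-shift {M} {λ x → w x * w y * K x y} (λ x → cong₂ (λ a b → a * w y * b) (w-periodic x) (K-periodicˡ y x)) y) ⟨
      ∑ M (λ y → ∑ M (λ t → w (t ℕ.+ y) * w y * K (t ℕ.+ y) y))   ≡⟨ ∑-cong M (λ y → ∑-cong M (λ t → trans (cong₂ (λ a b → w a * w y * b) (ℕ.+-comm t y) (κs-shift (p ∷ ps) t 0 y)) (rotate (w (y ℕ.+ t)) (w y) (K t 0)))) ⟩
      ∑ M (λ y → ∑ M (λ t → K t 0 * (w y * w (y ℕ.+ t))))         ≡⟨ ∑-swap M M (λ y t → K t 0 * (w y * w (y ℕ.+ t))) ⟩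
      ∑ M (λ t → ∑ M (λ y → K t 0 * (w y * w (y ℕ.+ t))))         ≡⟨ ∑-cong M (λ t → trans (∑-*ˡ M (K t 0) (λ y → w y * w (y ℕ.+ t))) (trans (cong (K t 0 *_) (correlation t)) (onlyQ t))) ⟩
      ∑ M (λ t → lam * K 0 t + D * 𝟙 (Q ∣? t))                    ≡⟨ trans (∑-+ M (λ t → lam * K 0 t) (λ t → D * 𝟙 (Q ∣? t))) (cong₂ _+_ (trans (∑-*ˡ M lam (K 0)) (cong (lam *_) (∑-κs (primes div) (unique div) (∣M div) 0))) (∑-*ˡ M D (λ t → 𝟙 (Q ∣? t)))) ⟩
      lam * 0ℚ + D′                                               ≡⟨ trans (cong (_+ D′) (ℚ.*-zeroʳ lam)) (ℚ.+-identityˡ D′) ⟩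
      D′                                                          ∎
      where
      open ≡-Reasoning
      K : ℕ → ℕ → ℚ
      K = κs (p ∷ ps)
      K-periodicˡ : ∀ y x → K (x ℕ.+ M) y ≡ K x y
      K-periodicˡ y x = trans (κs-sym (p ∷ ps) (x ℕ.+ M) y) (trans (κs-periodic y (∣M div) x) (κs-sym (p ∷ ps) y x))
      rotate : ∀ a b c → a * b * c ≡ c * (b * a)
      rotate = solve-∀ ℚ-ring
      onlyQ : ∀ t → K t 0 * (lam + D * 𝟙 (Q ∣? t)) ≡ lam * K 0 t + D * 𝟙 (Q ∣? t)
      onlyQ t with Q ∣? t
      ... | yes Q∣t = trans (cong (_* (lam + D * 1ℚ)) K≡1) (trans (l₁ lam D) (cong (λ a → lam * a + D * 1ℚ) (sym (trans (κs-sym (p ∷ ps) 0 t) K≡1))))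
        where
        K≡1 : K t 0 ≡ 1ℚ
        K≡1 = κs-diag (primes div) (All.map (λ p∣Q → ∣-trans p∣Q Q∣t) (∣Q div))
        l₁ : ∀ a b → 1ℚ * (a + b * 1ℚ) ≡ a * 1ℚ + b * 1ℚ
        l₁ = solve-∀ ℚ-ring
      ... | no  _   = trans (l₂ (K t 0) lam D) (cong (λ a → lam * a + D * 0ℚ) (κs-sym (p ∷ ps) t 0))
        where
        l₂ : ∀ k a b → k * (a + b * 0ℚ) ≡ a * k + b * 0ℚ
        l₂ = solve-∀ ℚ-ring

    -- κs reproduces itself under convolution, so expanding 0 ≤ Σ_z (V z - V 0 κs(z, 0))²
    -- leaves exactly the energy minus (V 0)².
    ∑-wκs-square : ∀ {p ps} → Divisors (p ∷ ps) →
                   let S = ∑ M (λ x → w x * κs (p ∷ ps) x 0) in S * S ≤ D′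
    -- The sum of squares is n₀ (D′ - S²), where `n₀` is the positive convolution factor of the
    -- kernel, and `n₀` is cancelled.
    ∑-wκs-square {p} {ps} div = 0≤-⇒≤ (ℚ.*-cancelˡ-≤-pos n₀ {{positive n₀-pos}} (subst₂ _≤_ (sym (ℚ.*-zeroʳ n₀)) expand (∑-nonNeg M (λ z → square-nonNeg (V z - S * K z 0)))))
      where
      open ≡-Reasoning
      K : ℕ → ℕ → ℚ
      K = κs (p ∷ ps)
      V : ℕ → ℚ
      V z = ∑ M (λ x → w x * K x z)
      S n₀ : ℚ
      S = V 0
      n₀ = ι M * cs (p ∷ ps)
      n₀-pos : 0ℚ < n₀
      n₀-pos = *-pos (ι-pos′ M M≢0) (cs-pos (primes div))
        where
        ι-pos′ : ∀ m → m ≢ 0 → 0ℚ < ι m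
        ι-pos′ zero    m≢0 = ⊥-elim (m≢0 refl)
        ι-pos′ (suc m) _   = ι-pos m
      reproduce : ∀ x y → ∑ M (λ z → K x z * K y z) ≡ n₀ * K x y
      reproduce = ∑-κsκs (primes div) (unique div) (∣M div)
      K00 : K 0 0 ≡ 1ℚ
      K00 = κs-diag (primes div) (All.map (λ _ → divides 0 refl) (∣M div))
      VV : ∑ M (λ z → V z * V z) ≡ n₀ * D′
      VV = begin
        ∑ M (λ z → V z * V z)                                                  ≡⟨ ∑-cong M (λ z → ∑-*-∑ M M (λ x → w x * K x z) (λ y → w y * K y z)) ⟩
        ∑ M (λ z → ∑ M (λ x → ∑ M (λ y → w x * K x z * (w y * K y z))))         ≡⟨ ∑-swap M M (λ z x → ∑ M (λ y → w x * K x z * (w y * K y z))) ⟩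
        ∑ M (λ x → ∑ M (λ z → ∑ M (λ y → w x * K x z * (w y * K y z))))         ≡⟨ ∑-cong M (λ x → ∑-swap M M (λ z y → w x * K x z * (w y * K y z))) ⟩
        ∑ M (λ x → ∑ M (λ y → ∑ M (λ z → w x * K x z * (w y * K y z))))         ≡⟨ ∑-cong M (λ x → ∑-cong M (λ y → pair x y)) ⟩
        ∑ M (λ x → ∑ M (λ y → n₀ * (w x * w y * K x y)))                        ≡⟨ ∑-cong M (λ x → ∑-*ˡ M n₀ (λ y → w x * w y * K x y)) ⟩
        ∑ M (λ x → n₀ * ∑ M (λ y → w x * w y * K x y))                          ≡⟨ ∑-*ˡ M n₀ (λ x → ∑ M (λ y → w x * w y * K x y)) ⟩
        n₀ * ∑ M (λ x → ∑ M (λ y → w x * w y * K x y))                          ≡⟨ cong (n₀ *_) (energy div) ⟩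
        n₀ * D′                                                                ∎
        where
        medial : ∀ a b c d → a * b * (c * d) ≡ a * c * (b * d)
        medial = solve-∀ ℚ-ring
        pull : ∀ a n k → a * (n * k) ≡ n * (a * k)
        pull = solve-∀ ℚ-ring
        pair : ∀ x y → ∑ M (λ z → w x * K x z * (w y * K y z)) ≡ n₀ * (w x * w y * K x y)
        pair x y = begin
          ∑ M (λ z → w x * K x z * (w y * K y z))   ≡⟨ ∑-cong M (λ z → medial (w x) (K x z) (w y) (K y z)) ⟩
          ∑ M (λ z → w x * w y * (K x z * K y z))   ≡⟨ ∑-*ˡ M (w x * w y) (λ z → K x z * K y z) ⟩
          w x * w y * ∑ M (λ z → K x z * K y z)     ≡⟨ cong (w x * w y *_) (reproduce x y) ⟩
          w x * w y * (n₀ * K x y)                  ≡⟨ pull (w x * w y) n₀ (K x y) ⟩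
          n₀ * (w x * w y * K x y)                  ∎
      VK : ∑ M (λ z → V z * K z 0) ≡ n₀ * S
      VK = begin
        ∑ M (λ z → V z * K z 0)                        ≡⟨ ∑-cong M (λ z → trans (ℚ.*-comm (V z) (K z 0)) (sym (∑-*ˡ M (K z 0) (λ x → w x * K x z)))) ⟩
        ∑ M (λ z → ∑ M (λ x → K z 0 * (w x * K x z)))  ≡⟨ ∑-swap M M (λ z x → K z 0 * (w x * K x z)) ⟩
        ∑ M (λ x → ∑ M (λ z → K z 0 * (w x * K x z)))  ≡⟨ ∑-cong M (λ x → single x) ⟩
        ∑ M (λ x → n₀ * (w x * K x 0))                 ≡⟨ ∑-*ˡ M n₀ (λ x → w x * K x 0) ⟩
        n₀ * S                                         ∎
        where
        pull : ∀ a b c → a * (b * c) ≡ b * (c * a)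
        pull = solve-∀ ℚ-ring
        pull′ : ∀ a n k → a * (n * k) ≡ n * (a * k)
        pull′ = solve-∀ ℚ-ring
        single : ∀ x → ∑ M (λ z → K z 0 * (w x * K x z)) ≡ n₀ * (w x * K x 0)
        single x = begin
          ∑ M (λ z → K z 0 * (w x * K x z))   ≡⟨ ∑-cong M (λ z → trans (pull (K z 0) (w x) (K x z)) (cong (λ k → w x * (K x z * k)) (κs-sym (p ∷ ps) z 0))) ⟩
          ∑ M (λ z → w x * (K x z * K 0 z))   ≡⟨ ∑-*ˡ M (w x) (λ z → K x z * K 0 z) ⟩
          w x * ∑ M (λ z → K x z * K 0 z)     ≡⟨ cong (w x *_) (reproduce x 0) ⟩
          w x * (n₀ * K x 0)                  ≡⟨ pull′ (w x) n₀ (K x 0) ⟩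
          n₀ * (w x * K x 0)                  ∎
      KK : ∑ M (λ z → K z 0 * K z 0) ≡ n₀
      KK = trans (∑-cong M (λ z → cong₂ _*_ (κs-sym (p ∷ ps) z 0) (κs-sym (p ∷ ps) z 0)))
        (trans (reproduce 0 0) (trans (cong (n₀ *_) K00) (ℚ.*-identityʳ n₀)))
      expand : ∑ M (λ z → (V z - S * K z 0) * (V z - S * K z 0)) ≡ n₀ * (D′ - S * S)
      expand = begin
        ∑ M (λ z → (V z - S * K z 0) * (V z - S * K z 0))
          ≡⟨ ∑-cong M (λ z → square (V z) S (K z 0)) ⟩
        ∑ M (λ z → V z * V z + - (S + S) * (V z * K z 0) + S * S * (K z 0 * K z 0))
          ≡⟨ trans (∑-+ M (λ z → V z * V z + - (S + S) * (V z * K z 0)) (λ z → S * S * (K z 0 * K z 0)))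
               (cong₂ _+_ (∑-+ M (λ z → V z * V z) (λ z → - (S + S) * (V z * K z 0))) (∑-*ˡ M (S * S) (λ z → K z 0 * K z 0))) ⟩
        ∑ M (λ z → V z * V z) + ∑ M (λ z → - (S + S) * (V z * K z 0)) + S * S * ∑ M (λ z → K z 0 * K z 0)
          ≡⟨ cong₂ _+_ (cong₂ _+_ VV (trans (∑-*ˡ M (- (S + S)) (λ z → V z * K z 0)) (cong (- (S + S) *_) VK))) (cong (S * S *_) KK) ⟩
        n₀ * D′ + - (S + S) * (n₀ * S) + S * S * n₀
          ≡⟨ collect n₀ D′ S ⟩
        n₀ * (D′ - S * S) ∎
        where
        square : ∀ v s k → (v - s * k) * (v - s * k) ≡ v * v + - (s + s) * (v * k) + s * s * (k * k)
        square = solve-∀ ℚ-ring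
        collect : ∀ n d s → n * d + - (s + s) * (n * s) + s * s * n ≡ n * (d - s * s)
        collect = solve-∀ ℚ-ring

    -- E ps i is a positive multiple of the indicator that no p in ps divides i.
    E : List ℕ → ℕ → ℚ
    E []       i = 1ℚ
    E (p ∷ ps) i = (1ℚ - κ p i 0) * E ps i

    -- Multiplying out `E ps` gives a signed sum over subsets A of `ps`, whose terms are the
    -- character sums of w for A together with `rs`; `rs` collects the primes already chosen.
    T : List ℕ → List ℕ → ℚ
    T ps rs = ∑ M (λ i → w i * E ps i * κs rs i 0)

    T-∷ : ∀ p ps rs → T (p ∷ ps) rs ≡ T ps rs - T ps (p ∷ rs)
    T-∷ p ps rs = trans (∑-cong M (λ i → lem (w i) (κ p i 0) (E ps i) (κs rs i 0))) (∑-- M (λ i → w i * E ps i * κs rs i 0) (λ i → w i * E ps i * κs (p ∷ rs) i 0))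
      where
      lem : ∀ w k e l → w * ((1ℚ - k) * e) * l ≡ w * e * l - w * e * (k * l)
      lem = solve-∀ ℚ-ring

    pow₂ : List ℕ → ℚ
    pow₂ []       = 1ℚ
    pow₂ (_ ∷ ps) = pow₂ ps + pow₂ ps

    drop-head : ∀ {p ps} → Divisors (p ∷ ps) → Divisors ps
    drop-head (divisors (_ ∷ prs) (_ ∷ u) (_ ∷ d)) = divisors prs u d

    cons : ∀ {p ps rs} → Divisors (p ∷ ps) → Divisors rs → All (p ≢_) rs → Divisors (p ∷ rs)
    cons (divisors (p-pr ∷ _) _ (p∣Q ∷ _)) (divisors prs u d) p≢ = divisors (p-pr ∷ prs) (p≢ ∷ u) (p∣Q ∷ d)

    disjoint-∷ : ∀ {p : ℕ} {ps rs} → All (p ≢_) ps → All (λ s → All (s ≢_) rs) ps → All (λ s → All (s ≢_) (p ∷ rs)) ps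
    disjoint-∷ []        []        = []
    disjoint-∷ (p≢ ∷ p≢s) (d ∷ ds) = ((p≢ ∘ sym) ∷ d) ∷ disjoint-∷ p≢s ds

    all-≢[] : ∀ (ps : List ℕ) → All (λ s → All (s ≢_) []) ps
    all-≢[] []       = []
    all-≢[] (_ ∷ ps) = [] ∷ all-≢[] ps

    count : List ℕ → ℕ → ℚ
    count []       i = 0ℚ
    count (p ∷ ps) i = I p i 0 + count ps i

    -- The indicator of the multiples of p is the mean of all p characters: the trivial one
    -- contributes 1/p, the p - 1 others together (p - 1)/p times `κ`.
    I≡ : ∀ {p} → Prime p → ∀ x → I p x 0 ≡ recip p + (1ℚ - recip p) * κ p x 0
    I≡ {zero}  p-pr x = ⊥-elim (¬prime[0] p-pr)
    I≡ {p@(suc m)} p-pr x = sym (begin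
      c + (1ℚ - c) * (recip-pred p * (ι p * i - 1ℚ))                                   ≡⟨ cong (λ a → c + (a - c) * (recip-pred p * (ι p * i - 1ℚ))) (sym (ι*recip m)) ⟩
      c + (ι p * c - c) * (recip-pred p * (ι p * i - 1ℚ))                              ≡⟨ lem c (ι p) (recip-pred p) i ⟩
      c + c * (ι p * i - 1ℚ) * (recip-pred p * (ι p - 1ℚ))                             ≡⟨ cong (λ a → c + c * (ι p * i - 1ℚ) * a) (recip-pred-inverse p-pr) ⟩
      c + c * (ι p * i - 1ℚ) * 1ℚ                                             ≡⟨ lem′ c (ι p) i ⟩
      ι p * c * i                                                             ≡⟨ cong (_* i) (ι*recip m) ⟩
      1ℚ * i                                                                  ≡⟨ ℚ.*-identityˡ i ⟩
      i                                                                       ∎)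
      where
      open ≡-Reasoning
      c = recip p
      i = I p x 0
      lem : ∀ c p r i → c + (p * c - c) * (r * (p * i - 1ℚ)) ≡ c + c * (p * i - 1ℚ) * (r * (p - 1ℚ))
      lem = solve-∀ ℚ-ring
      lem′ : ∀ c p i → c + c * (p * i - 1ℚ) * 1ℚ ≡ p * c * i
      lem′ = solve-∀ ℚ-ring

    recip≤1 : ∀ {p} → Prime p → recip p ≤ 1ℚ
    recip≤1 {zero}  p-pr = ⊥-elim (¬prime[0] p-pr)
    recip≤1 {suc p} p-pr = ℚ.≤-trans (ℚ.≤-reflexive (sym (ℚ.*-identityˡ (recip (suc p)))))
      (ℚ.≤-trans (ℚ.*-monoʳ-≤-nonNeg (recip (suc p)) {{ℚ.normalize-nonNeg 1 (suc p)}} (ι-mono-≤ {1} {suc p} (ℕ.s≤s ℕ.z≤n))) (ℚ.≤-reflexive (ι*recip p)))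

    -- Each factor 1 - κ is 0 at multiples of its prime and 1 + 1/(p - 1) elsewhere.
    E-cases : ∀ ks → All Prime ks → ∀ i → 0ℚ ≤ E ks i × (E ks i ≡ 0ℚ ⊎ All (λ p → ¬ p ∣ i) ks)
    E-cases []       _            i = ℚ.nonNegative⁻¹ 1ℚ , inj₂ []
    E-cases (p ∷ ks) (p-pr ∷ prs) i with E-cases ks prs i | p ∣? i
    ... | 0≤E , _ | yes p∣i = ℚ.≤-reflexive (sym E≡0) , inj₁ E≡0
      where
      E≡0 : (1ℚ - κ p i 0) * E ks i ≡ 0ℚ
      E≡0 = trans (cong (λ a → (1ℚ - a) * E ks i) (κ-diag p-pr (∣⇒res≡0 p p∣i))) (ℚ.*-zeroˡ (E ks i))
    ... | 0≤E , cases | no p∤i = *-nonNeg 0≤1-κ 0≤E , tail cases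
      where
      lem : ∀ r p → 1ℚ - r * (p * 0ℚ - 1ℚ) ≡ 1ℚ + r
      lem = solve-∀ ℚ-ring
      0≤1-κ : 0ℚ ≤ 1ℚ - κ p i 0
      0≤1-κ = subst (0ℚ ≤_) (sym (trans (cong (λ a → 1ℚ - recip-pred p * (ι p * a - 1ℚ)) (𝟙-no (res p i ℕ.≟ res p 0) (p∤i ∘ res≡0⇒∣ p))) (lem (recip-pred p) (ι p))))
        (ℚ.+-mono-≤ {0ℚ} {1ℚ} (ℚ.nonNegative⁻¹ 1ℚ) (ℚ.<⇒≤ (recip-pred-pos p-pr)))
      tail : E ks i ≡ 0ℚ ⊎ All (λ p → ¬ p ∣ i) ks → (1ℚ - κ p i 0) * E ks i ≡ 0ℚ ⊎ All (λ p → ¬ p ∣ i) (p ∷ ks)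
      tail (inj₁ E≡0) = inj₁ (trans (cong ((1ℚ - κ p i 0) *_) E≡0) (ℚ.*-zeroʳ (1ℚ - κ p i 0)))
      tail (inj₂ all) = inj₂ (p∤i ∷ all)

    count-cases : ∀ ps i → 0ℚ ≤ count ps i × (1ℚ ≤ count ps i ⊎ All (λ p → ¬ p ∣ i) ps)
    count-cases []       i = ℚ.≤-refl , inj₂ []
    count-cases (p ∷ ps) i with count-cases ps i | res p i ℕ.≟ res p 0
    ... | 0≤c , _          | yes eq = ℚ.+-mono-≤ {0ℚ} {1ℚ} (ℚ.nonNegative⁻¹ 1ℚ) 0≤c , inj₁ (subst (_≤ 1ℚ + count ps i) (ℚ.+-identityʳ 1ℚ) (ℚ.+-monoʳ-≤ 1ℚ 0≤c))
    ... | 0≤c , inj₁ 1≤c   | no ≢   = ℚ.+-mono-≤ {0ℚ} {0ℚ} ℚ.≤-refl 0≤c , inj₁ (subst (1ℚ ≤_) (sym (ℚ.+-identityˡ (count ps i))) 1≤c)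
    ... | 0≤c , inj₂ all   | no ≢   = ℚ.+-mono-≤ {0ℚ} {0ℚ} ℚ.≤-refl 0≤c , inj₂ ((≢ ∘ ∣⇒res≡0 p) ∷ all)

    -- `b` stands in for the square root of `D′`, which need not be rational.
    module _ (b : ℚ) (0≤b : 0ℚ ≤ b) (D′≤b² : D′ ≤ b * b) where

      -- Each prime of `ps` doubles the number of terms by `T-∷`. Every final term belongs to a
      -- nonempty list, hence to a nontrivial kernel, and is at most `b` by `∑-wκs-square`.
      -- Disjointness keeps the lists free of repetitions as primes move across.
      T-bound : ∀ ps r rs → Divisors ps → Divisors (r ∷ rs) → All (λ s → All (s ≢_) (r ∷ rs)) ps →
                ∣ T ps (r ∷ rs) ∣ ≤ pow₂ ps * b
      T-bound []       r rs _ div [] = subst₂ (λ s c → ∣ s ∣ ≤ c)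
        (∑-cong M (λ i → cong (_* κs (r ∷ rs) i 0) (sym (ℚ.*-identityʳ (w i))))) (sym (ℚ.*-identityˡ b))
        (square-≤⇒∣∣≤ 0≤b (ℚ.≤-trans (∑-wκs-square div) D′≤b²))
      T-bound (p ∷ ps) r rs div@(divisors _ (p≢ps ∷ _) _) divr (p≢ ∷ disj) =
        subst₂ (λ s c → ∣ s ∣ ≤ c) (sym (T-∷ p ps (r ∷ rs))) (sym (ℚ.*-distribʳ-+ b (pow₂ ps) (pow₂ ps)))
          (ℚ.≤-trans (ℚ.∣p-q∣≤∣p∣+∣q∣ (T ps (r ∷ rs)) (T ps (p ∷ r ∷ rs)))
            (ℚ.+-mono-≤ (T-bound ps r rs (drop-head div) divr disj)
                        (T-bound ps p (r ∷ rs) (drop-head div) (cons div divr p≢) (disjoint-∷ p≢ps disj))))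

      -- The empty subset contributes the total weight and each of the other 2^|ps| - 1 subsets at
      -- most `b`. The single `b` saved here makes the final inequality strict.
      T-main : ∀ ps → Divisors ps → ∑ M w - (pow₂ ps - 1ℚ) * b ≤ T ps []
      T-main []       _ = ℚ.≤-reflexive (trans (lem (∑ M w) b) (∑-cong M (λ i → lem′ (w i))))
        where
        lem : ∀ a b → a - (1ℚ - 1ℚ) * b ≡ a
        lem = solve-∀ ℚ-ring
        lem′ : ∀ a → a ≡ a * 1ℚ * 1ℚ
        lem′ = solve-∀ ℚ-ring
      T-main (p ∷ ps) div@(divisors _ (p≢ps ∷ _) _) = subst₂ _≤_ (lem (∑ M w) (pow₂ ps) b) (sym (T-∷ p ps []))
        (ℚ.+-mono-≤ (T-main ps (drop-head div)) (ℚ.neg-antimono-≤ (ℚ.≤-trans (p≤∣p∣ (T ps (p ∷ [])))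
          (T-bound ps p [] (drop-head div) (cons div (divisors [] [] []) []) (disjoint-∷ p≢ps (all-≢[] ps))))))
        where
        lem : ∀ a c b → a - (c - 1ℚ) * b + - (c * b) ≡ a - (c + c - 1ℚ) * b
        lem = solve-∀ ℚ-ring

      -- Each `p` in `ps` subtracts the weight on its multiples, which by `I≡` is 1/p of the main
      -- sum plus (1 - 1/p) times a sum bounded by `T-bound`. Over all of `ps` the main sum retains
      -- 1 - ∑ 1/p, and the errors have total coefficient ∑ (1 - 1/p).
      sieve-sum : ∀ ks ps → Divisors ks → Divisors ps → All (λ s → All (_≢ s) ks) ps →
        (1ℚ - sumRecip ps) * T ks [] - (ι (length ps) - sumRecip ps) * (pow₂ ks * b)
          ≤ ∑ M (λ i → w i * E ks i * (1ℚ - count ps i))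
      sieve-sum ks [] _ _ _ = ℚ.≤-reflexive (trans (lem (T ks []) (pow₂ ks * b)) (∑-cong M (λ i → cong (w i * E ks i *_) refl)))
        where
        lem : ∀ t c → (1ℚ - 0ℚ) * t - (0ℚ - 0ℚ) * c ≡ t
        lem = solve-∀ ℚ-ring
      sieve-sum ks (p ∷ ps) divk div@(divisors (p-pr ∷ _) _ _) (p∉ks ∷ disj) = begin
        (1ℚ - (c + R)) * t - (ι (suc (length ps)) - (c + R)) * u
          ≡⟨ cong (λ a → (1ℚ - (c + R)) * t - (a - (c + R)) * u) (ι-+ 1 (length ps)) ⟩
        (1ℚ - (c + R)) * t - (1ℚ + ι (length ps) - (c + R)) * u
          ≡⟨ lem c R t (ι (length ps)) u ⟩
        ((1ℚ - R) * t - (ι (length ps) - R) * u) + - (c * t + (1ℚ - c) * u)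
          ≤⟨ ℚ.+-mono-≤ (sieve-sum ks ps divk (drop-head div) disj) (ℚ.neg-antimono-≤ (ℚ.+-monoʳ-≤ (c * t) (*-monoˡ-≤ (≤⇒0≤- (recip≤1 p-pr)) Tp≤u))) ⟩
        ∑ M (λ i → w i * E ks i * (1ℚ - count ps i)) + - (c * t + (1ℚ - c) * T ks (p ∷ []))
          ≡⟨ cong (λ a → ∑ M (λ i → w i * E ks i * (1ℚ - count ps i)) + - a) (sym sumI) ⟩
        ∑ M (λ i → w i * E ks i * (1ℚ - count ps i)) - ∑ M (λ i → w i * E ks i * I p i 0)
          ≡⟨ ∑-- M (λ i → w i * E ks i * (1ℚ - count ps i)) (λ i → w i * E ks i * I p i 0) ⟨
        ∑ M (λ i → w i * E ks i * (1ℚ - count ps i) - w i * E ks i * I p i 0)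
          ≡⟨ ∑-cong M (λ i → lem′ (w i * E ks i) (count ps i) (I p i 0)) ⟩
        ∑ M (λ i → w i * E ks i * (1ℚ - (I p i 0 + count ps i))) ∎
        where
        open ℚ.≤-Reasoning
        c = recip p
        R = sumRecip ps
        t = T ks []
        u = pow₂ ks * b
        lem : ∀ c R t s u → (1ℚ - (c + R)) * t - (1ℚ + s - (c + R)) * u ≡ ((1ℚ - R) * t - (s - R) * u) + - (c * t + (1ℚ - c) * u)
        lem = solve-∀ ℚ-ring
        lem′ : ∀ e a i → e * (1ℚ - a) - e * i ≡ e * (1ℚ - (i + a))
        lem′ = solve-∀ ℚ-ring
        lem″ : ∀ e c k → e * (c + (1ℚ - c) * k) ≡ c * (e * 1ℚ) + (1ℚ - c) * (e * (k * 1ℚ))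
        lem″ = solve-∀ ℚ-ring
        Tp≤u : T ks (p ∷ []) ≤ u
        Tp≤u = ℚ.≤-trans (p≤∣p∣ (T ks (p ∷ []))) (T-bound ks p [] divk (cons div (divisors [] [] []) []) (All.map (λ s≢p → s≢p ∷ []) p∉ks))
        sumI : ∑ M (λ i → w i * E ks i * I p i 0) ≡ c * t + (1ℚ - c) * T ks (p ∷ [])
        sumI = trans (∑-cong M (λ i → trans (cong (w i * E ks i *_) (I≡ p-pr i)) (lem″ (w i * E ks i) c (κ p i 0))))
          (trans (∑-+ M (λ i → c * (w i * E ks i * 1ℚ)) (λ i → (1ℚ - c) * (w i * E ks i * (κ p i 0 * 1ℚ))))
            (cong₂ _+_ (∑-*ˡ M c (λ i → w i * E ks i * 1ℚ)) (∑-*ˡ M (1ℚ - c) (λ i → w i * E ks i * (κ p i 0 * 1ℚ)))))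

      -- The factor 1 - count is at most 0 once a prime of `ps` divides i, and `E` vanishes once a
      -- prime of `ks` does. With nonnegative weights a positive total therefore needs an index that
      -- avoids all of them.
      sieve : ∀ ks ps → Divisors ks → Divisors ps → All (λ s → All (_≢ s) ks) ps → (∀ i → 0ℚ ≤ w i) →
        0ℚ < (1ℚ - sumRecip ps) * T ks [] - (ι (length ps) - sumRecip ps) * (pow₂ ks * b) →
        ∃ λ i → w i ≢ 0ℚ × All (λ p → ¬ p ∣ i) ks × All (λ p → ¬ p ∣ i) ps
      sieve ks ps divk divp disj 0≤w 0<main
        with ℕ.anyUpTo? (λ i → ¬? (w i ℚ.≟ 0ℚ) ×-dec (All.all? (λ p → ¬? (p ∣? i)) ks ×-dec All.all? (λ p → ¬? (p ∣? i)) ps)) M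
      ... | yes (i , _ , found) = i , found
      ... | no  none = ⊥-elim (ℚ.<-irrefl refl (ℚ.<-≤-trans 0<main (ℚ.≤-trans (sieve-sum ks ps divk divp disj)
              (ℚ.≤-trans (∑-mono-≤ M nonPos) (ℚ.≤-reflexive (trans (∑-const M 0ℚ) (ℚ.*-zeroʳ (ι M))))))))
        where
        flip : ∀ e c → e * (1ℚ - c) ≡ - (e * (c - 1ℚ))
        flip = solve-∀ ℚ-ring
        nonPos : ∀ i → i ℕ.< M → w i * E ks i * (1ℚ - count ps i) ≤ 0ℚ
        nonPos i i<M with w i ℚ.≟ 0ℚ | E-cases ks (primes divk) i | count-cases ps i
        ... | yes w≡0 | _ | _ = ℚ.≤-reflexive (trans (cong (λ a → a * E ks i * (1ℚ - count ps i)) w≡0) (trans (cong (_* (1ℚ - count ps i)) (ℚ.*-zeroˡ (E ks i))) (ℚ.*-zeroˡ (1ℚ - count ps i))))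
        ... | no  w≢0 | _ , inj₁ E≡0 | _ = ℚ.≤-reflexive (trans (cong (λ a → w i * a * (1ℚ - count ps i)) E≡0) (trans (cong (_* (1ℚ - count ps i)) (ℚ.*-zeroʳ (w i))) (ℚ.*-zeroˡ (1ℚ - count ps i))))
        ... | no  w≢0 | 0≤E , inj₂ _ | _ , inj₁ 1≤c = subst (_≤ 0ℚ) (sym (flip (w i * E ks i) (count ps i)))
                (ℚ.neg-antimono-≤ (*-nonNeg (*-nonNeg (0≤w i) 0≤E) (≤⇒0≤- 1≤c)))
        ... | no  w≢0 | _ , inj₂ ∤ks | _ , inj₂ ∤ps = ⊥-elim (none (i , i<M , w≢0 , ∤ks , ∤ps))

-- The trace as a linear functional and the correlations of its kernel.

module TraceForm where
  open RationalSums
  open FiniteFields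
  open FrobeniusMap
  open import Data.Nat as ℕ using (ℕ; zero; suc; s≤s; z≤n)
  import Data.Nat.Properties as ℕ
  open import Data.Nat.Divisibility using (_∣_; _∣?_; divides; n∣m*n; ∣⇒≤; *-cancelʳ-∣; ∣m+n∣m⇒∣n; ∣m∣n⇒∣m+n; ∣-refl)
  open import Data.Nat.Primality using (Prime)
  open import Data.Rational as ℚ using (ℚ; 0ℚ; 1ℚ)
  import Data.Rational.Properties as ℚ
  open import Data.Fin as Fin using (Fin; zero; suc; toℕ)
  import Data.Fin.Properties as Fin
  open import Data.Product using (∃; _×_; proj₁; proj₂; _,_)
  open import Data.Empty using (⊥-elim)
  open import Function using (_∘_)
  open import Relation.Nullary
  open import Relation.Nullary.Decidable using (decidable-stable)
  open import Relation.Binary.PropositionalEquality as ≡ using (_≡_; _≢_)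
  open import Algebra.Bundles using (CommutativeRing)
  open import Tactic.RingSolver using (solve-∀)
  open import Algebra.Properties.Semiring.Sum (CommutativeRing.semiring ℚ.+-*-commutativeRing)
    using (sum; sum-cong-≗; ∑-comm; *-distribˡ-sum)

  ∑-split : ∀ m n f → ∑ (m ℕ.+ n) f ≡ ∑ m f ℚ.+ ∑ n (λ i → f (m ℕ.+ i))
  ∑-split zero    n f = ≡.sym (ℚ.+-identityˡ (∑ n f))
  ∑-split (suc m) n f = ≡.trans (≡.cong (f 0 ℚ.+_) (∑-split m n (f ∘ suc))) (≡.sym (ℚ.+-assoc (f 0) (∑ m (f ∘ suc)) (∑ n (λ i → f (suc m ℕ.+ i)))))

  ∑-multiples : ∀ {Q} → Q ≢ 0 → ∀ a → ∑ (a ℕ.* Q) (λ t → 𝟙 (Q ∣? t)) ≡ ι a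
  ∑-multiples Q≢0 zero = ≡.refl
  ∑-multiples {zero}  Q≢0 (suc a) = ⊥-elim (Q≢0 ≡.refl)
  ∑-multiples {Q@(suc _)} Q≢0 (suc a) = ≡.trans (∑-split Q (a ℕ.* Q) (λ t → 𝟙 (Q ∣? t)))
    (≡.trans (≡.cong₂ ℚ._+_
        (sum-𝟙-unique {Q} (λ i → Q ∣? toℕ i) zero (divides 0 ≡.refl) only-zero)
        (≡.trans (∑-cong (a ℕ.* Q) (λ i → 𝟙-⇔ (Q ∣? (Q ℕ.+ i)) (Q ∣? i) (λ d → ∣m+n∣m⇒∣n d ∣-refl) (∣m∣n⇒∣m+n ∣-refl))) (∑-multiples Q≢0 a)))
      (≡.sym (ι-+ 1 a)))
    where
    only-zero : ∀ (i : Fin Q) → Q ∣ toℕ i → i ≡ zero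
    only-zero zero    _ = ≡.refl
    only-zero (suc i) d = ⊥-elim (ℕ.<⇒≱ (Fin.toℕ<n (suc i)) (∣⇒≤ d))

  module TraceTheory {N : ℕ} (F : FiniteField N) where
    open FieldTheory F
    open Reindexing F
    open import Relation.Binary.Reasoning.Setoid setoid
    open import Algebra.Properties.CommutativeSemiring.Exp commutativeSemiring as Exp using ()
    open import Algebra.Properties.CommutativeSemigroup +-commutativeSemigroup using (interchange)

    ∑F : (Carrier → ℚ) → ℚ
    ∑F φ = sum (λ i → φ (enum i))

    ∑F-translate : ∀ a (φ : Carrier → ℚ) → (∀ {x y} → x ≈ y → φ x ≡ φ y) → ∑F (λ x → φ (x + a)) ≡ ∑F φ
    ∑F-translate a φ φ-cong = ≡.sym (sum-reindex ℚ.+-0-commutativeMonoid φ φ-cong ≡.refl (λ i → enum i + a)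
      (λ i j eq → enum-injective i j (+-cancelʳ a _ _ eq)))

    module Linear (p e q n₂ : ℕ) (p-pr : Prime p) (q≡pᵉ : q ≡ p ℕ.^ e) (1<q : 1 ℕ.< q) (N≡qⁿ : N ≡ q ℕ.^ suc (suc n₂)) where

      N≡pᵏ : N ≡ p ℕ.^ (e ℕ.* suc (suc n₂))
      N≡pᵏ = ≡.trans N≡qⁿ (≡.trans (≡.cong (ℕ._^ suc (suc n₂)) q≡pᵉ) (ℕ.^-*-assoc p e (suc (suc n₂))))

      open Frobenius {k = e ℕ.* suc (suc n₂)} F p-pr N≡pᵏ using (frobenius-^)

      q^i≡ : ∀ i → q ℕ.^ i ≡ p ℕ.^ (e ℕ.* i)
      q^i≡ i = ≡.trans (≡.cong (ℕ._^ i) q≡pᵉ) (ℕ.^-*-assoc p e i)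

      ^q^i-+ : ∀ i x y → (x + y) ^ (q ℕ.^ i) ≈ x ^ (q ℕ.^ i) + y ^ (q ℕ.^ i)
      ^q^i-+ i x y = ≡.subst (λ m → (x + y) ^ m ≈ x ^ m + y ^ m) (≡.sym (q^i≡ i)) (frobenius-^ (e ℕ.* i) x y)

      ^q-+ : ∀ x y → (x + y) ^ q ≈ x ^ q + y ^ q
      ^q-+ x y = ≡.subst (λ m → (x + y) ^ m ≈ x ^ m + y ^ m) (ℕ.*-identityʳ q) (^q^i-+ 1 x y)

      -- The subfield 𝔽_q, given as the roots of c^q = c and not as a field of its own.
      Fixed : Carrier → Set
      Fixed c = c ^ q ≈ c

      Fixed-^ : ∀ {c} i → Fixed c → c ^ (q ℕ.^ i) ≈ c
      Fixed-^ {c} zero    fix = *-identityʳ c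
      Fixed-^ {c} (suc i) fix = trans (sym (Exp.^-assocʳ c q (q ℕ.^ i))) (trans (Exp.^-congˡ (q ℕ.^ i) fix) (Fixed-^ i fix))

      Fixed-inverse : ∀ {c d} → Fixed c → c * d ≈ 1# → Fixed d
      Fixed-inverse {c} {d} fix cd≈1 = begin
        d ^ q                  ≈⟨ *-identityʳ _ ⟨
        d ^ q * 1#             ≈⟨ *-congˡ cd≈1 ⟨
        d ^ q * (c * d)        ≈⟨ *-congˡ (*-congʳ fix) ⟨
        d ^ q * (c ^ q * d)    ≈⟨ *-assoc _ _ _ ⟨
        d ^ q * c ^ q * d      ≈⟨ *-congʳ (Exp.^-distrib-* d c q) ⟨
        (d * c) ^ q * d        ≈⟨ *-congʳ (Exp.^-congˡ q (trans (*-comm d c) cd≈1)) ⟩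
        1# ^ q * d             ≈⟨ *-congʳ (1^n≈1 q) ⟩
        1# * d                 ≈⟨ *-identityˡ d ⟩
        d                      ∎

      n : ℕ
      n = suc (suc n₂)

      tr : ℕ → Carrier → Carrier
      tr zero    x = 0#
      tr (suc i) x = x ^ (q ℕ.^ i) + tr i x

      Tr≡tr : ∀ i x → Tr F q i x ≡ tr i x
      Tr≡tr zero    x = ≡.refl
      Tr≡tr (suc i) x = ≡.cong₂ _+_ (pow≡^ x (q ℕ.^ i)) (Tr≡tr i x)

      tr-cong : ∀ i {x y} → x ≈ y → tr i x ≈ tr i y
      tr-cong zero    x≈y = refl
      tr-cong (suc i) x≈y = +-cong (Exp.^-congˡ (q ℕ.^ i) x≈y) (tr-cong i x≈y)

      tr-+ : ∀ i x y → tr i (x + y) ≈ tr i x + tr i y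
      tr-+ zero    x y = sym (+-identityˡ 0#)
      tr-+ (suc i) x y = trans (+-cong (^q^i-+ i x y) (tr-+ i x y)) (interchange _ _ _ _)

      tr-*-Fixed : ∀ i c x → Fixed c → tr i (c * x) ≈ c * tr i x
      tr-*-Fixed zero    c x fix = sym (zeroʳ c)
      tr-*-Fixed (suc i) c x fix = trans
        (+-cong (trans (Exp.^-distrib-* c x (q ℕ.^ i)) (*-congʳ (Fixed-^ i fix))) (tr-*-Fixed i c x fix)) (sym (distribˡ c _ _))

      0^q≈0 : 0# ^ q ≈ 0#
      0^q≈0 = 0^suc q (ℕ.<-trans (s≤s z≤n) 1<q)
        where
        0^suc : ∀ m → 0 ℕ.< m → 0# ^ m ≈ 0#
        0^suc (suc m) _ = zeroˡ _

      -- The telescoping identity tr^q - tr = x^(q^i) - x, written without subtraction. At i = n its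
      -- right side is 0, so the trace lies in 𝔽_q.
      tr-^q : ∀ i x → tr i x ^ q + x ≈ x ^ (q ℕ.^ i) + tr i x
      tr-^q zero    x = trans (+-congʳ 0^q≈0) (trans (+-comm 0# x) (+-congʳ (sym (*-identityʳ x))))
      tr-^q (suc i) x = begin
        (x ^ (q ℕ.^ i) + tr i x) ^ q + x                ≈⟨ +-congʳ (^q-+ _ _) ⟩
        (x ^ (q ℕ.^ i)) ^ q + tr i x ^ q + x            ≈⟨ +-assoc _ _ _ ⟩
        (x ^ (q ℕ.^ i)) ^ q + (tr i x ^ q + x)          ≈⟨ +-cong (Exp.^-assocʳ x (q ℕ.^ i) q) (tr-^q i x) ⟩
        x ^ (q ℕ.^ i ℕ.* q) + (x ^ (q ℕ.^ i) + tr i x)  ≡⟨ ≡.cong (λ m → x ^ m + (x ^ (q ℕ.^ i) + tr i x)) (ℕ.*-comm (q ℕ.^ i) q) ⟩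
        x ^ (q ℕ.* q ℕ.^ i) + (x ^ (q ℕ.^ i) + tr i x)  ∎

      q^i<q^suc : ∀ i → q ℕ.^ i ℕ.< q ℕ.^ suc i
      q^i<q^suc i = ℕ.^-monoʳ-< q 1<q (ℕ.n<1+n i)

      -- The term x^(q^i) dominates the shorter sum. With n terms the degree is q^(n-1), below the
      -- size of the field, so the trace is not identically zero.
      Deg-tr : ∀ i → Deg (q ℕ.^ i) 1# (tr (suc i))
      Deg-tr i = Deg-cong (q ℕ.^ i) (+-identityʳ 1#) (Deg-+ (q ℕ.^ i) (Deg-^ (q ℕ.^ i)) (lower i))
        where
        lower : ∀ i → Deg (q ℕ.^ i) 0# (tr i)
        lower zero    = Deg-suc 0 {0#} (λ _ → refl)
        lower (suc i) = Deg-≤ {q ℕ.^ i} {c = 1#} (Deg-tr i) (q^i<q^suc i)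

      -- Translating by κ x₁ matches the fibre of ℓ over κ with the kernel, so all fibres carry the same weight.
      ∑F-fibre : (q₁ : ℕ) (κ : Fin (suc q₁) → Carrier) → (∀ i j → κ i ≈ κ j → i ≡ j) → (∀ i → Fixed (κ i)) → (∀ y → Fixed y → ∃ λ i → κ i ≈ y) →
                 (v : Carrier → ℚ) → (∀ {x y} → x ≈ y → v x ≡ v y) →
                 (ℓ : Carrier → Carrier) → (∀ {x y} → x ≈ y → ℓ x ≈ ℓ y) → (∀ x → Fixed (ℓ x)) →
                 (x₁ : Carrier) → (∀ c x → Fixed c → ℓ (x + c * x₁) ≈ ℓ x + c) → (∀ c x → Fixed c → v (x + c * x₁) ≡ v x) →
                 ∑F v ≡ ι (suc q₁) ℚ.* ∑F (λ x → v x ℚ.* 𝟙 (ℓ x ≟ 0#))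
      ∑F-fibre q₁ κ κ-inj κ-fixed κ-surj v v-cong ℓ ℓ-cong ℓ-fixed x₁ ℓ-x₁ v-x₁ = R.begin
        ∑F v                                                                     R.≡⟨ sum-cong-≗ (λ i → split (enum i)) ⟩
        ∑F (λ x → sum (λ j → v x ℚ.* 𝟙 (ℓ x ≟ κ j)))                             R.≡⟨ ∑-comm (λ i j → v (enum i) ℚ.* 𝟙 (ℓ (enum i) ≟ κ j)) ⟩
        sum (λ j → ∑F (λ x → v x ℚ.* 𝟙 (ℓ x ≟ κ j)))                             R.≡⟨ sum-cong-≗ (λ j → ≡.sym (∑F-translate (κ j * x₁) (λ x → v x ℚ.* 𝟙 (ℓ x ≟ κ j)) (resp j))) ⟩
        sum (λ j → ∑F (λ x → v (x + κ j * x₁) ℚ.* 𝟙 (ℓ (x + κ j * x₁) ≟ κ j)))   R.≡⟨ sum-cong-≗ (λ j → sum-cong-≗ (λ i → ≡.cong₂ ℚ._*_ (v-x₁ (κ j) (enum i) (κ-fixed j)) (recentre j (enum i)))) ⟩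
        sum {suc q₁} (λ _ → ∑F (λ x → v x ℚ.* 𝟙 (ℓ x ≟ 0#)))                     R.≡⟨ sum-const (suc q₁) _ ⟩
        ι (suc q₁) ℚ.* ∑F (λ x → v x ℚ.* 𝟙 (ℓ x ≟ 0#))                           R.∎
        where
        module R = ≡.≡-Reasoning
        split : ∀ x → v x ≡ sum (λ j → v x ℚ.* 𝟙 (ℓ x ≟ κ j))
        split x = ≡.trans (≡.sym (ℚ.*-identityʳ (v x))) (≡.trans (≡.cong (v x ℚ.*_) (≡.sym one)) (*-distribˡ-sum (v x) (λ j → 𝟙 (ℓ x ≟ κ j))))
          where
          j₀ = κ-surj (ℓ x) (ℓ-fixed x)
          one : sum (λ j → 𝟙 (ℓ x ≟ κ j)) ≡ 1ℚ
          one = sum-𝟙-unique (λ j → ℓ x ≟ κ j) (proj₁ j₀) (sym (proj₂ j₀)) (λ j eq → κ-inj j (proj₁ j₀) (trans (sym eq) (sym (proj₂ j₀))))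
        resp : ∀ j {x y} → x ≈ y → v x ℚ.* 𝟙 (ℓ x ≟ κ j) ≡ v y ℚ.* 𝟙 (ℓ y ≟ κ j)
        resp j {x} {y} x≈y = ≡.cong₂ ℚ._*_ (v-cong x≈y) (𝟙-⇔ (ℓ x ≟ κ j) (ℓ y ≟ κ j) (trans (ℓ-cong (sym x≈y))) (trans (ℓ-cong x≈y)))
        recentre : ∀ j x → 𝟙 (ℓ (x + κ j * x₁) ≟ κ j) ≡ 𝟙 (ℓ x ≟ 0#)
        recentre j x = 𝟙-⇔ (ℓ (x + κ j * x₁) ≟ κ j) (ℓ x ≟ 0#)
          (λ eq → begin
            ℓ x                     ≈⟨ +-identityʳ _ ⟨
            ℓ x + 0#                ≈⟨ +-congˡ (-‿inverseʳ (κ j)) ⟨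
            ℓ x + (κ j - κ j)       ≈⟨ +-assoc _ _ _ ⟨
            ℓ x + κ j - κ j         ≈⟨ +-congʳ (trans (sym (ℓ-x₁ (κ j) x (κ-fixed j))) eq) ⟩
            κ j - κ j               ≈⟨ -‿inverseʳ (κ j) ⟩
            0#                      ∎)
          (λ eq → trans (ℓ-x₁ (κ j) x (κ-fixed j)) (trans (+-congʳ eq) (+-identityˡ (κ j))))

      module Rooted (g : Carrier) (M Q q₁ : ℕ) (ord : IsOrder g M) (1+M≡N : suc M ≡ N) (1+q₁≡q : suc q₁ ≡ q) (M≡Qq₁ : M ≡ Q ℕ.* q₁) where

        q₁≢0 : q₁ ≢ 0
        q₁≢0 ≡.refl = n≢0 ord (≡.trans M≡Qq₁ (ℕ.*-zeroʳ Q))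

        Q≢0 : Q ≢ 0
        Q≢0 ≡.refl = n≢0 ord M≡Qq₁

        powers : ∀ y → ¬ y ≈ 0# → ∃ λ i → i ℕ.< M × g ^ i ≈ y
        powers y y≉0 with enumeration-surjective 1+M≡N (zero∷powers g) (zero∷powers-injective ord) y
        ... | zero  , 0≈y  = ⊥-elim (y≉0 (sym 0≈y))
        ... | suc i , gⁱ≈y = toℕ i , Fin.toℕ<n i , gⁱ≈y

        x^N≈x : ∀ x → x ^ N ≈ x
        x^N≈x x = ≡.subst (λ m → x ^ m ≈ x) 1+M≡N (fermat (x ≟ 0#))
          where
          fermat : Dec (x ≈ 0#) → x ^ suc M ≈ x
          fermat (yes x≈0) = trans (*-congʳ x≈0) (trans (zeroˡ _) (sym x≈0))
          fermat (no  x≉0) with powers x x≉0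
          ... | i , _ , gⁱ≈x = begin
            x * x ^ M               ≈⟨ *-congˡ (Exp.^-congˡ M (sym gⁱ≈x)) ⟩
            x * (g ^ i) ^ M         ≈⟨ *-congˡ (Exp.^-assocʳ g i M) ⟩
            x * g ^ (i ℕ.* M)       ≈⟨ *-congˡ (^-∣ g M (x^n≈1 ord) (n∣m*n i)) ⟩
            x * 1#                  ≈⟨ *-identityʳ x ⟩
            x                       ∎

        tr-fixed : ∀ x → Fixed (tr n x)
        tr-fixed x = begin
          tr n x ^ q            ≈⟨ x+y-y≈x _ x ⟨
          tr n x ^ q + x - x    ≈⟨ +-congʳ (trans (tr-^q n x) (trans (+-congʳ (≡.subst (λ m → x ^ m ≈ x) N≡qⁿ (x^N≈x x))) (+-comm x (tr n x)))) ⟩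
          tr n x + x - x        ≈⟨ x+y-y≈x _ x ⟩
          tr n x                ∎

        -- A generator of the multiplicative group of 𝔽_q: 0 and its q - 1 powers enumerate the
        -- subfield.
        γ : Carrier
        γ = g ^ Q

        γ-order : IsOrder γ q₁
        γ-order = IsOrder-^ Q (≡.subst (IsOrder g) M≡Qq₁ ord)

        Fixed-* : ∀ {c d} → Fixed c → Fixed d → Fixed (c * d)
        Fixed-* {c} {d} fc fd = trans (Exp.^-distrib-* c d q) (*-cong fc fd)

        γ-fixed : Fixed γ
        γ-fixed = ≡.subst (λ m → γ ^ m ≈ γ) 1+q₁≡q (trans (*-congˡ (x^n≈1 γ-order)) (*-identityʳ γ))

        1-fixed : Fixed 1#
        1-fixed = 1^n≈1 q

        ^-fixed : ∀ {c} j → Fixed c → Fixed (c ^ j)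
        ^-fixed zero    fc = 1-fixed
        ^-fixed (suc j) fc = Fixed-* fc (^-fixed j fc)

        -- Being fixed means that M = Q q₁ divides i (q - 1) = i q₁.
        fixed-power⇒Q∣ : ∀ i → Fixed (g ^ i) → Q ∣ i
        fixed-power⇒Q∣ i fix = *-cancelʳ-∣ q₁ {{ℕ.≢-nonZero q₁≢0}} (≡.subst (_∣ i ℕ.* q₁) M≡Qq₁
          (^-≈⇒∣ ord i (i ℕ.* q₁) (begin
            g ^ i                    ≈⟨ fix ⟨
            (g ^ i) ^ q              ≈⟨ Exp.^-assocʳ g i q ⟩
            g ^ (i ℕ.* q)            ≡⟨ ≡.cong (g ^_) (≡.trans (≡.cong (i ℕ.*_) (≡.sym 1+q₁≡q)) (ℕ.*-suc i q₁)) ⟩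
            g ^ (i ℕ.+ i ℕ.* q₁)     ∎)))

        Q∣⇒fixed : ∀ {i} → Q ∣ i → Fixed (g ^ i)
        Q∣⇒fixed (divides j ≡.refl) = ≡.subst (λ m → Fixed (g ^ m)) (ℕ.*-comm Q j)
          (trans (Exp.^-congˡ q (sym (Exp.^-assocʳ g Q j))) (trans (^-fixed j γ-fixed) (Exp.^-assocʳ g Q j)))

        κF : Fin (suc q₁) → Carrier
        κF = zero∷powers γ

        κF-fixed : ∀ i → Fixed (κF i)
        κF-fixed zero    = 0^q≈0
        κF-fixed (suc i) = ^-fixed (toℕ i) γ-fixed

        κF-surjective : ∀ y → Fixed y → ∃ λ i → κF i ≈ y
        κF-surjective y fix with y ≟ 0#
        ... | yes y≈0 = zero , sym y≈0
        ... | no  y≉0 with powers y y≉0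
        ...   | i , i<M , gⁱ≈y with fixed-power⇒Q∣ i (trans (Exp.^-congˡ q gⁱ≈y) (trans fix (sym gⁱ≈y)))
        ...     | divides j ≡.refl = suc (Fin.fromℕ< j<q₁) , (begin
          γ ^ toℕ (Fin.fromℕ< j<q₁)   ≡⟨ ≡.cong (γ ^_) (Fin.toℕ-fromℕ< j<q₁) ⟩
          γ ^ j                       ≈⟨ Exp.^-assocʳ g Q j ⟩
          g ^ (Q ℕ.* j)               ≡⟨ ≡.cong (g ^_) (ℕ.*-comm Q j) ⟩
          g ^ (j ℕ.* Q)               ≈⟨ gⁱ≈y ⟩
          y                           ∎)
          where
          j<q₁ : j ℕ.< q₁
          j<q₁ = ℕ.*-cancelʳ-< Q j q₁ (≡.subst (j ℕ.* Q ℕ.<_) (≡.trans M≡Qq₁ (ℕ.*-comm Q q₁)) i<M)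

        fibre : (v : Carrier → ℚ) → (∀ {x y} → x ≈ y → v x ≡ v y) →
                (ℓ : Carrier → Carrier) → (∀ {x y} → x ≈ y → ℓ x ≈ ℓ y) → (∀ x → Fixed (ℓ x)) →
                (x₁ : Carrier) → (∀ c x → Fixed c → ℓ (x + c * x₁) ≈ ℓ x + c) → (∀ c x → Fixed c → v (x + c * x₁) ≡ v x) →
                ∑F v ≡ ι q ℚ.* ∑F (λ x → v x ℚ.* 𝟙 (ℓ x ≟ 0#))
        fibre v v-cong ℓ ℓ-cong ℓ-fixed x₁ h₁ h₂ = ≡.subst (λ m → ∑F v ≡ ι m ℚ.* ∑F (λ x → v x ℚ.* 𝟙 (ℓ x ≟ 0#))) 1+q₁≡q
          (∑F-fibre q₁ κF (zero∷powers-injective γ-order) κF-fixed κF-surjective v v-cong ℓ ℓ-cong ℓ-fixed x₁ h₁ h₂)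

        q≢0 : q ≢ 0
        q≢0 q≡0 = ℕ.1+n≢0 (≡.trans 1+q₁≡q q≡0)

        tr≢0 : ¬ (∀ x → tr n x ≈ 0#)
        tr≢0 = Deg-nonvanishing (Deg-tr (suc n₂)) (λ 1≈0 → 0≉1 (sym 1≈0)) (≡.subst (q ℕ.^ suc n₂ ℕ.<_) (≡.sym N≡qⁿ) (q^i<q^suc (suc n₂)))

        -- `b` is the inverse of Tr(αx), an element of 𝔽_q, so it passes through the trace. That it
        -- is fixed is returned too, because `separating` needs the scaled element to stay in the
        -- kernel of Tr.
        normalise : ∀ {α x} → ¬ tr n (α * x) ≈ 0# → ∃ λ b → Fixed b × tr n (α * (b * x)) ≈ 1#
        normalise {α} {x} a≉0 with inverse (tr n (α * x)) a≉0
        ... | b , ab≈1 = b , fixed-b , (begin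
          tr n (α * (b * x))     ≈⟨ tr-cong n (trans (sym (*-assoc α b x)) (trans (*-congʳ (*-comm α b)) (*-assoc b α x))) ⟩
          tr n (b * (α * x))     ≈⟨ tr-*-Fixed n b (α * x) fixed-b ⟩
          b * tr n (α * x)       ≈⟨ *-comm _ _ ⟩
          tr n (α * x) * b       ≈⟨ ab≈1 ⟩
          1#                     ∎)
          where
          fixed-b = Fixed-inverse (tr-fixed (α * x)) ab≈1

        unit-trace : ∃ λ x₀ → tr n x₀ ≈ 1#
        unit-trace with any-element? {λ x → ¬ tr n x ≈ 0#} (λ x≈y ¬0 eq → ¬0 (trans (tr-cong n x≈y) eq)) (λ x → ¬? (tr n x ≟ 0#))
        ... | no  none       = ⊥-elim (tr≢0 (λ x → decidable-stable (tr n x ≟ 0#) (λ ≉0 → none (x , ≉0))))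
        ... | yes (x , ≉0) with normalise {1#} {x} (λ eq → ≉0 (trans (tr-cong n (sym (*-identityˡ x))) eq))
        ...   | b , _ , eq = b * x , trans (tr-cong n (sym (*-identityˡ (b * x)))) eq

        ℓ-translate : ∀ α {x₁} → tr n (α * x₁) ≈ 1# → ∀ c x → Fixed c → tr n (α * (x + c * x₁)) ≈ tr n (α * x) + c
        ℓ-translate α {x₁} eq c x fc = begin
          tr n (α * (x + c * x₁))               ≈⟨ tr-cong n (distribˡ α x (c * x₁)) ⟩
          tr n (α * x + α * (c * x₁))           ≈⟨ tr-+ n _ _ ⟩
          tr n (α * x) + tr n (α * (c * x₁))    ≈⟨ +-congˡ (tr-cong n (trans (sym (*-assoc α c x₁)) (trans (*-congʳ (*-comm α c)) (*-assoc c α x₁)))) ⟩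
          tr n (α * x) + tr n (c * (α * x₁))    ≈⟨ +-congˡ (tr-*-Fixed n c (α * x₁) fc) ⟩
          tr n (α * x) + c * tr n (α * x₁)      ≈⟨ +-congˡ (trans (*-congˡ eq) (*-identityʳ c)) ⟩
          tr n (α * x) + c                      ∎

        u : Carrier → ℚ
        u x = 𝟙 (tr n x ≟ 0#)

        u-cong : ∀ {x y} → x ≈ y → u x ≡ u y
        u-cong {x} {y} x≈y = 𝟙-⇔ (tr n x ≟ 0#) (tr n y ≟ 0#) (trans (tr-cong n (sym x≈y))) (trans (tr-cong n x≈y))

        u-translate : ∀ {x₁} → tr n x₁ ≈ 0# → ∀ c x → Fixed c → u (x + c * x₁) ≡ u x
        u-translate {x₁} eq c x fc = 𝟙-⇔ (tr n (x + c * x₁) ≟ 0#) (tr n x ≟ 0#) (trans (sym same)) (trans same)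
          where
          same : tr n (x + c * x₁) ≈ tr n x
          same = begin
            tr n (x + c * x₁)          ≈⟨ tr-+ n _ _ ⟩
            tr n x + tr n (c * x₁)     ≈⟨ +-congˡ (trans (tr-*-Fixed n c x₁ fc) (trans (*-congˡ eq) (zeroʳ c))) ⟩
            tr n x + 0#                ≈⟨ +-identityʳ _ ⟩
            tr n x                     ∎

        u-scale : ∀ {c} → ¬ c ≈ 0# → Fixed c → ∀ x → u (c * x) ≡ u x
        u-scale {c} c≉0 fc x = 𝟙-⇔ (tr n (c * x) ≟ 0#) (tr n x ≟ 0#)
          (λ eq → x*y≈0⇒y≈0 c≉0 (trans (sym (tr-*-Fixed n c x fc)) eq))
          (λ eq → trans (tr-*-Fixed n c x fc) (trans (*-congˡ eq) (zeroʳ c)))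

        -- The q fibres of the trace have equal size, so its kernel has q^n / q elements.
        ∑F-u : ∑F u ≡ ι (q ℕ.^ suc n₂)
        ∑F-u = ι-cancelˡ q≢0 (R.begin
          ι q ℚ.* ∑F u                          R.≡⟨ ≡.cong (ι q ℚ.*_) (sum-cong-≗ (λ i → ≡.sym (≡.trans (ℚ.*-identityˡ _) (u-cong (*-identityˡ (enum i)))))) ⟩
          ι q ℚ.* ∑F (λ x → 1ℚ ℚ.* u (1# * x))  R.≡⟨ fibre (λ _ → 1ℚ) (λ _ → ≡.refl) (λ x → tr n (1# * x)) (λ eq → tr-cong n (*-congˡ eq)) (λ x → tr-fixed (1# * x)) (proj₁ unit-trace)
                                                     (ℓ-translate 1# (trans (tr-cong n (*-identityˡ _)) (proj₂ unit-trace))) (λ _ _ _ → ≡.refl) ⟨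
          ∑F (λ _ → 1ℚ)                         R.≡⟨ ≡.trans (sum-const N 1ℚ) (ℚ.*-identityʳ (ι N)) ⟩
          ι N                                   R.≡⟨ ≡.trans (≡.cong ι N≡qⁿ) (ι-* q (q ℕ.^ suc n₂)) ⟩
          ι q ℚ.* ι (q ℕ.^ suc n₂)              R.∎)
          where module R = ≡.≡-Reasoning

        -- If Tr(αx) vanished on the kernel of Tr it would equal c Tr(x) with c = Tr(αx₀), so Tr((α - c)x) = 0 for all x.
        separating : ∀ {α} → ¬ Fixed α → ∃ λ x₁ → tr n x₁ ≈ 0# × tr n (α * x₁) ≈ 1#
        separating {α} α∉ with any-element? {λ x → tr n x ≈ 0# × ¬ tr n (α * x) ≈ 0#}
            (λ x≈y (p , ¬p) → trans (tr-cong n (sym x≈y)) p , λ eq → ¬p (trans (tr-cong n (*-congˡ x≈y)) eq))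
            (λ x → (tr n x ≟ 0#) ×-dec ¬? (tr n (α * x) ≟ 0#))
        ... | yes (x , trx≈0 , ≉0) with normalise {α} {x} ≉0
        ...   | b , fb , eq = b * x , trans (tr-*-Fixed n b x fb) (trans (*-congˡ trx≈0) (zeroʳ b)) , eq
        separating {α} α∉ | no none = ⊥-elim (tr≢0 vanish)
          where
          x₀ = proj₁ unit-trace
          c = tr n (α * x₀)
          c-fixed = tr-fixed (α * x₀)
          β≉0 : ¬ α - c ≈ 0#
          β≉0 eq = α∉ (trans (Exp.^-congˡ q (x-y≈0⇒x≈y α c eq)) (trans c-fixed (sym (x-y≈0⇒x≈y α c eq))))
          -- With t = Tr(x), x splits into x - t x₀, which lies in the kernel as Tr(x₀) = 1, and t
          -- x₀, on which Tr(α ·) takes the value t c.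
          trα≈ctr : ∀ x → tr n (α * x) ≈ c * tr n x
          trα≈ctr x = begin
            tr n (α * x)                              ≈⟨ tr-cong n (*-congˡ (x-y+y≈x x (t * x₀))) ⟨
            tr n (α * ((x - t * x₀) + t * x₀))        ≈⟨ tr-cong n (distribˡ α _ _) ⟩
            tr n (α * (x - t * x₀) + α * (t * x₀))    ≈⟨ tr-+ n _ _ ⟩
            tr n (α * (x - t * x₀)) + tr n (α * (t * x₀)) ≈⟨ +-cong kernel (tr-cong n (trans (sym (*-assoc α t x₀)) (trans (*-congʳ (*-comm α t)) (*-assoc t α x₀)))) ⟩
            0# + tr n (t * (α * x₀))                  ≈⟨ +-identityˡ _ ⟩
            tr n (t * (α * x₀))                       ≈⟨ tr-*-Fixed n t (α * x₀) (tr-fixed x) ⟩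
            t * c                                     ≈⟨ *-comm t c ⟩
            c * t                                     ∎
            where
            t = tr n x
            in-kernel : tr n (x - t * x₀) ≈ 0#
            in-kernel = begin
              tr n (x - t * x₀)                       ≈⟨ +-identityʳ _ ⟨
              tr n (x - t * x₀) + 0#                  ≈⟨ +-congˡ (-‿inverseʳ t) ⟨
              tr n (x - t * x₀) + (t - t)             ≈⟨ +-assoc _ _ _ ⟨
              tr n (x - t * x₀) + t - t               ≈⟨ +-congʳ (+-congˡ (trans (sym (*-identityʳ t)) (trans (*-congˡ (sym (proj₂ unit-trace))) (sym (tr-*-Fixed n t x₀ (tr-fixed x)))))) ⟩
              tr n (x - t * x₀) + tr n (t * x₀) - t   ≈⟨ +-congʳ (tr-+ n _ _) ⟨
              tr n ((x - t * x₀) + t * x₀) - t        ≈⟨ +-congʳ (tr-cong n (x-y+y≈x x (t * x₀))) ⟩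
              t - t                                   ≈⟨ -‿inverseʳ t ⟩
              0#                                      ∎
            kernel : tr n (α * (x - t * x₀)) ≈ 0#
            kernel = decidable-stable (tr n (α * (x - t * x₀)) ≟ 0#) (λ ≉0 → none (x - t * x₀ , in-kernel , ≉0))
          tr-β : ∀ x → tr n ((α - c) * x) ≈ 0#
          tr-β x = begin
            tr n ((α - c) * x)                                  ≈⟨ +-identityʳ _ ⟨
            tr n ((α - c) * x) + 0#                             ≈⟨ +-congˡ (-‿inverseʳ (c * tr n x)) ⟨
            tr n ((α - c) * x) + (c * tr n x - c * tr n x)      ≈⟨ +-assoc _ _ _ ⟨
            tr n ((α - c) * x) + c * tr n x - c * tr n x        ≈⟨ +-congʳ (+-congˡ (sym (tr-*-Fixed n c x c-fixed))) ⟩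
            tr n ((α - c) * x) + tr n (c * x) - c * tr n x      ≈⟨ +-congʳ (tr-+ n _ _) ⟨
            tr n ((α - c) * x + c * x) - c * tr n x             ≈⟨ +-congʳ (tr-cong n (trans (sym (distribʳ x _ _)) (*-congʳ (x-y+y≈x α c)))) ⟩
            tr n (α * x) - c * tr n x                           ≈⟨ +-congʳ (trα≈ctr x) ⟩
            c * tr n x - c * tr n x                             ≈⟨ -‿inverseʳ _ ⟩
            0#                                                  ∎
          vanish : ∀ x → tr n x ≈ 0#
          vanish x with inverse (α - c) β≉0
          ... | d , βd≈1 = trans (tr-cong n (sym (trans (sym (*-assoc (α - c) d x)) (trans (*-congʳ βd≈1) (*-identityˡ x))))) (tr-β (d * x))

        -- Shifting by multiples of the element from `separating` stays inside the kernel of Tr and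
        -- permutes the fibres of Tr(αx) there, so one fibre holds q^(n-1) / q elements.
        ∑F-uu : ∀ {α} → ¬ Fixed α → ∑F (λ x → u x ℚ.* u (α * x)) ≡ ι (q ℕ.^ n₂)
        ∑F-uu {α} α∉ with separating α∉
        ... | x₁ , trx₁≈0 , trαx₁≈1 = ι-cancelˡ q≢0 (≡.trans
          (≡.sym (fibre u u-cong (λ x → tr n (α * x)) (λ eq → tr-cong n (*-congˡ eq)) (λ x → tr-fixed (α * x)) x₁ (ℓ-translate α trαx₁≈1) (u-translate trx₁≈0)))
          (≡.trans ∑F-u (ι-* q (q ℕ.^ n₂))))

        w : ℕ → ℚ
        w i = u (g ^ i)

        w-periodic : Periodic M w
        w-periodic i = u-cong (trans (^-+ g i M) (trans (*-congˡ (x^n≈1 ord)) (*-identityʳ _)))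

        ∑F-powers : ∀ (φ : Carrier → ℚ) → (∀ {x y} → x ≈ y → φ x ≡ φ y) → ∑F φ ≡ φ 0# ℚ.+ ∑ M (λ i → φ (g ^ i))
        ∑F-powers φ φ-cong = sum-reindex ℚ.+-0-commutativeMonoid φ φ-cong 1+M≡N (zero∷powers g) (zero∷powers-injective ord)

        u0≡1 : ∀ {x} → x ≈ 0# → u x ≡ 1ℚ
        u0≡1 {x} x≈0 = 𝟙-yes (tr n x ≟ 0#) (trans (tr-cong n (trans x≈0 (sym (zeroˡ 0#)))) (trans (tr-*-Fixed n 0# 0# 0^q≈0) (zeroˡ _)))

        ∑-w : ∑ M w ≡ ι (q ℕ.^ suc n₂) ℚ.- 1ℚ
        ∑-w = ≡.trans (lem (∑ M w)) (≡.cong (ℚ._- 1ℚ) (≡.trans (≡.cong (ℚ._+ ∑ M w) (≡.sym (u0≡1 refl))) (≡.trans (≡.sym (∑F-powers u u-cong)) ∑F-u)))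
          where
          lem : ∀ a → a ≡ 1ℚ ℚ.+ a ℚ.- 1ℚ
          lem = solve-∀ ℚ-ring

        -- The parameters λ and k - λ of the Singer difference set, times q - 1 because exponents
        -- run over ℤ/M, which covers ℤ/Q with fibres of that size.
        lam D : ℚ
        lam = ι (q ℕ.^ n₂) ℚ.- 1ℚ
        D = ι (q ℕ.^ suc n₂) ℚ.- ι (q ℕ.^ n₂)

        -- With α = g^t the sum counts the x ≠ 0 with Tr(x) = Tr(αx) = 0. If Q ∣ t then α lies in
        -- 𝔽_q and the two conditions coincide; otherwise they are independent. The subtracted 1 is
        -- the term at x = 0.
        correlation : ∀ t → ∑ M (λ y → w y ℚ.* w (y ℕ.+ t)) ≡ lam ℚ.+ D ℚ.* 𝟙 (Q ∣? t)
        correlation t = R.begin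
          ∑ M (λ y → w y ℚ.* w (y ℕ.+ t))               R.≡⟨ ∑-cong M (λ y → ≡.cong (w y ℚ.*_) (u-cong (trans (^-+ g y t) (*-comm _ _)))) ⟩
          ∑ M (λ y → φ (g ^ y))                         R.≡⟨ lem (∑ M (λ y → φ (g ^ y))) ⟩
          1ℚ ℚ.* 1ℚ ℚ.+ ∑ M (λ y → φ (g ^ y)) ℚ.- 1ℚ    R.≡⟨ ≡.cong (ℚ._- 1ℚ) (≡.trans (≡.cong (ℚ._+ ∑ M (λ y → φ (g ^ y))) (≡.sym (≡.cong₂ ℚ._*_ (u0≡1 refl) (u0≡1 (zeroʳ α))))) (≡.sym (∑F-powers φ φ-cong))) ⟩
          ∑F φ ℚ.- 1ℚ                                   R.≡⟨ value (Q ∣? t) ⟩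
          lam ℚ.+ D ℚ.* 𝟙 (Q ∣? t)                      R.∎
          where
          module R = ≡.≡-Reasoning
          α = g ^ t
          φ : Carrier → ℚ
          φ x = u x ℚ.* u (α * x)
          φ-cong : ∀ {x y} → x ≈ y → φ x ≡ φ y
          φ-cong x≈y = ≡.cong₂ ℚ._*_ (u-cong x≈y) (u-cong (*-congˡ x≈y))
          lem : ∀ a → a ≡ 1ℚ ℚ.* 1ℚ ℚ.+ a ℚ.- 1ℚ
          lem = solve-∀ ℚ-ring
          lem₁ : ∀ a b → a ℚ.- 1ℚ ≡ b ℚ.- 1ℚ ℚ.+ (a ℚ.- b) ℚ.* 1ℚ
          lem₁ = solve-∀ ℚ-ring
          lem₀ : ∀ a b → b ℚ.- 1ℚ ≡ b ℚ.- 1ℚ ℚ.+ (a ℚ.- b) ℚ.* 0ℚ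
          lem₀ = solve-∀ ℚ-ring
          idem : ∀ {P : Set} (d : Dec P) → 𝟙 d ℚ.* 𝟙 d ≡ 𝟙 d
          idem (yes _) = ≡.refl
          idem (no _)  = ≡.refl
          value : (d : Dec (Q ∣ t)) → ∑F φ ℚ.- 1ℚ ≡ lam ℚ.+ D ℚ.* 𝟙 d
          value (yes Q∣t) = ≡.trans (≡.cong (ℚ._- 1ℚ) (≡.trans (sum-cong-≗ (λ i → ≡.trans (≡.cong (u (enum i) ℚ.*_) (u-scale (^-≉0 t (IsOrder-≉0 ord)) (Q∣⇒fixed Q∣t) (enum i))) (idem (tr n (enum i) ≟ 0#)))) ∑F-u)) (lem₁ (ι (q ℕ.^ suc n₂)) (ι (q ℕ.^ n₂)))
          value (no  Q∤t) = ≡.trans (≡.cong (ℚ._- 1ℚ) (∑F-uu (λ fix → Q∤t (fixed-power⇒Q∣ t fix)))) (lem₀ (ι (q ℕ.^ suc n₂)) (ι (q ℕ.^ n₂)))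

-- Counting squarefree divisors, lifting residues, and the parity of Q.

module SquarefreeDivisors where
  open NumberTheory
  open ResidueKernels using (prime∤product)
  open import Data.Nat as ℕ using (ℕ; zero; suc; _+_; _*_; _∸_; _^_; _≤_; s≤s; z≤n)
  import Data.Nat.Properties as ℕ
  open import Data.Nat.Divisibility
  open import Data.Nat.DivMod using (_%_; _/_; m≡m%n+[m/n]*n)
  open import Data.Nat.Primality using (Prime; euclidsLemma; prime⇒nonZero; ¬prime[1])
  open import Data.Nat.Primality.Factorisation using (factorise; PrimeFactorisation; factorisationHasAllPrimeFactors)
  open import Data.Nat.Coprimality using (Coprime; coprime-divisor)
  open import Data.Nat.ListAction using (product)
  open import Data.Nat.ListAction.Properties using (∈⇒∣product)
  open import Data.Nat.Tactic.RingSolver using (solve-∀)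
  open import Data.Fin using (toℕ)
  open import Data.List using (List; []; _∷_; length; filter; map; upTo; _++_; deduplicate)
  open import Data.List.Properties using (length-++; length-map)
  open import Data.List.Membership.Propositional using (_∈_)
  open import Data.List.Membership.Propositional.Properties
    using (∈-filter⁺; ∈-filter⁻; ∈-map⁺; ∈-map⁻; ∈-++⁻; ∈-++⁺ˡ; ∈-++⁺ʳ; ∈-∃++; ∈-upTo⁺; ∈-deduplicate⁺; ∈-deduplicate⁻)
  open import Data.List.Relation.Unary.Any using (here; there)
  open import Data.List.Relation.Unary.All as All using (All; []; _∷_)
  open import Data.List.Relation.Unary.AllPairs using ([]; _∷_)
  open import Data.List.Relation.Unary.Unique.Propositional using (Unique)
  import Data.List.Relation.Unary.Unique.Propositional.Properties as Unique
  open import Data.List.Relation.Unary.Unique.DecPropositional.Properties ℕ._≟_ using (deduplicate-!)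
  open import Data.Product using (∃; _×_; _,_; proj₁; proj₂)
  open import Data.Sum using (_⊎_; inj₁; inj₂)
  open import Data.Empty using (⊥; ⊥-elim)
  open import Relation.Nullary
  open import Relation.Nullary.Decidable using (_×-dec_)
  open import Relation.Binary.PropositionalEquality

  unique-⊆⇒length≤ : ∀ {A : Set} {xs ys : List A} → Unique xs → (∀ {x} → x ∈ xs → x ∈ ys) → length xs ≤ length ys
  unique-⊆⇒length≤ {xs = []}     _            sub = z≤n
  unique-⊆⇒length≤ {xs = x ∷ xs} (x≢ ∷ uniq) sub with ∈-∃++ (sub (here refl))
  ... | as , bs , refl = subst (suc (length xs) ≤_) (sym (trans (length-++ as) (trans (ℕ.+-suc (length as) (length bs)) (cong suc (sym (length-++ as))))))
    (s≤s (unique-⊆⇒length≤ uniq λ y∈ → avoid (All.lookup x≢ y∈) (∈-++⁻ as (sub (there y∈)))))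
    where
    avoid : ∀ {y} → x ≢ y → y ∈ as ⊎ y ∈ x ∷ bs → y ∈ as ++ bs
    avoid x≢y (inj₁ y∈as)         = ∈-++⁺ˡ y∈as
    avoid x≢y (inj₂ (here y≡x))   = ⊥-elim (x≢y (sym y≡x))
    avoid x≢y (inj₂ (there y∈bs)) = ∈-++⁺ʳ as y∈bs

  subproducts : List ℕ → List ℕ
  subproducts []       = 1 ∷ []
  subproducts (p ∷ ps) = subproducts ps ++ map (p *_) (subproducts ps)

  length-subproducts : ∀ ps → length (subproducts ps) ≡ 2 ^ length ps
  length-subproducts []       = refl
  length-subproducts (p ∷ ps) = trans (length-++ (subproducts ps))
    (cong₂ _+_ (length-subproducts ps) (trans (length-map (p *_) (subproducts ps)) (trans (length-subproducts ps) (sym (ℕ.+-identityʳ _)))))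

  subproduct∣product : ∀ ps {d} → d ∈ subproducts ps → d ∣ product ps
  subproduct∣product []       (here refl) = ∣-refl
  subproduct∣product (p ∷ ps) d∈ with ∈-++⁻ (subproducts ps) d∈
  ... | inj₁ d∈ps = ∣n⇒∣m*n p (subproduct∣product ps d∈ps)
  ... | inj₂ d∈pps with ∈-map⁻ (p *_) d∈pps
  ...   | d′ , d′∈ , refl = *-monoʳ-∣ p (subproduct∣product ps d′∈)

  -- Products with and without the head prime are told apart by divisibility by it.
  subproducts-unique : ∀ {ps} → All Prime ps → Unique ps → Unique (subproducts ps)
  subproducts-unique [] [] = [] ∷ []
  subproducts-unique {p ∷ ps} (p-pr ∷ prs) (p≢ ∷ uniq) = Unique.++⁺ (subproducts-unique prs uniq)
    (Unique.map⁺ (λ {x} {y} → ℕ.*-cancelˡ-≡ x y p {{prime⇒nonZero p-pr}}) (subproducts-unique prs uniq)) disjoint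
    where
    disjoint : ∀ {d} → d ∈ subproducts ps × d ∈ map (p *_) (subproducts ps) → ⊥
    disjoint (d∈ , d∈′) with ∈-map⁻ (p *_) d∈′
    ... | d′ , _ , refl = prime∤product p-pr prs p≢ (∣-trans (m∣m*n d′) (subproduct∣product ps d∈))

  prime²∤product : ∀ {r ps} → Prime r → All Prime ps → Unique ps → ¬ r * r ∣ product ps
  prime²∤product {r} r-pr [] [] r²∣1 = ¬prime[1] (subst Prime (∣1⇒≡1 (∣-trans (m∣m*n r) r²∣1)) r-pr)
  prime²∤product {r} {p ∷ ps} r-pr (p-pr ∷ prs) (p≢ ∷ uniq) r²∣ with r ℕ.≟ p
  ... | yes refl = prime∤product p-pr prs p≢ (*-cancelˡ-∣ p {{prime⇒nonZero p-pr}} r²∣)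
  ... | no  r≢p  = prime²∤product r-pr prs uniq (coprime-divisor r²⊥p r²∣)
    where
    r²⊥p : Coprime (r * r) p
    r²⊥p = coprime-by-primes (λ r²≡0 → ≢-zero (ℕ.m*n≡0⇒m≡0∨n≡0 r r²≡0))
      λ s s-pr s∣r² s∣p → r≢p (trans (sym (square s-pr s∣r²)) (prime∣prime s-pr p-pr s∣p))
      where
      ≢-zero : r ≡ 0 ⊎ r ≡ 0 → ⊥
      ≢-zero (inj₁ e) = ℕ.≢-nonZero⁻¹ r {{prime⇒nonZero r-pr}} e
      ≢-zero (inj₂ e) = ℕ.≢-nonZero⁻¹ r {{prime⇒nonZero r-pr}} e
      square : ∀ {s} → Prime s → s ∣ r * r → s ≡ r
      square s-pr s∣r² with euclidsLemma r r s-pr s∣r²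
      ... | inj₁ s∣r = prime∣prime s-pr r-pr s∣r
      ... | inj₂ s∣r = prime∣prime s-pr r-pr s∣r

  product-of-primes∣ : ∀ {ps m} → All Prime ps → Unique ps → All (_∣ m) ps → product ps ∣ m
  product-of-primes∣ [] [] [] = 1∣ _
  product-of-primes∣ {p ∷ ps} (p-pr ∷ prs) (p≢ ∷ uniq) (p∣m ∷ ps∣m) = coprime-*-∣
    (subst (λ a → Coprime a (product ps)) (ℕ.*-identityʳ p) (^-coprime 1 p-pr (prime∤product p-pr prs p≢)))
    p∣m (product-of-primes∣ prs uniq ps∣m)

  -- All subproducts are distinct squarefree divisors of `k`, so the number of terms in the sieve
  -- expansion is at most `W k`.
  2^length≤W : ∀ {ps k} → k ≢ 0 → All Prime ps → Unique ps → All (_∣ k) ps → 2 ^ length ps ≤ W k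
  2^length≤W {ps} {k} k≢0 prs uniq ps∣k = subst (_≤ W k) (length-subproducts ps)
    (unique-⊆⇒length≤ (subproducts-unique prs uniq) λ d∈ →
      ∈-filter⁺ (λ d → (d ∣? k) ×-dec squareFree? d) (in-range d∈) (d∣k d∈ , squarefree d∈))
    where
    instance k≠0 = ℕ.≢-nonZero k≢0
    d∣k : ∀ {d} → d ∈ subproducts ps → d ∣ k
    d∣k d∈ = ∣-trans (subproduct∣product ps d∈) (product-of-primes∣ prs uniq ps∣k)
    in-range : ∀ {d} → d ∈ subproducts ps → d ∈ map suc (upTo k)
    in-range {zero}  d∈ = ⊥-elim (k≢0 (0∣⇒≡0 (d∣k d∈)))
    in-range {suc d} d∈ = ∈-map⁺ suc (∈-upTo⁺ (∣⇒≤ (d∣k d∈)))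
    squarefree : ∀ {d} → d ∈ subproducts ps → SquareFree d
    -- A square divisor i² with i ≥ 2 contains the square of a prime, which cannot divide a product
    -- of distinct primes.
    squarefree d∈ i 2≤i i²∣d with prime-divisor (toℕ i) (λ i≡0 → ℕ.<⇒≱ 2≤i (subst (_≤ 1) (sym i≡0) z≤n)) (λ i≡1 → ℕ.<⇒≱ 2≤i (ℕ.≤-reflexive i≡1))
    ... | r , r-pr , r∣i = prime²∤product r-pr prs uniq (∣-trans (*-pres-∣ r∣i r∣i) (∣-trans i²∣d (subproduct∣product ps d∈)))

  distinct-prime-factors : ∀ k → k ≢ 0 → ∃ λ ps → All Prime ps × Unique ps × All (_∣ k) ps × (∀ p → Prime p → p ∣ k → p ∈ ps)
  distinct-prime-factors k k≢0 = deduplicate ℕ._≟_ fs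
    , All.tabulate (λ p∈ → All.lookup prs (∈-deduplicate⁻ ℕ._≟_ fs p∈)) , deduplicate-! fs
    , All.tabulate (λ p∈ → subst (_ ∣_) (sym k≡) (∈⇒∣product (∈-deduplicate⁻ ℕ._≟_ fs p∈)))
    , λ p p-pr p∣k → ∈-deduplicate⁺ ℕ._≟_ (factorisationHasAllPrimeFactors p-pr (subst (p ∣_) k≡ p∣k) prs)
    where
    instance k≠0 = ℕ.≢-nonZero k≢0
    f = factorise k
    fs = PrimeFactorisation.factors f
    k≡ = PrimeFactorisation.isFactorisation f
    prs = PrimeFactorisation.factorsPrime f

  -- The multiplier is the product of the primes dividing M but neither Q nor a₀.
  coprime-lift : ∀ M Q a₀ → M ≢ 0 → (∀ p → Prime p → p ∣ Q → ¬ p ∣ a₀) →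
                 ∃ λ j → ∀ p → Prime p → p ∣ M → ¬ p ∣ a₀ + j * Q
  coprime-lift M Q a₀ M≢0 a₀⊥Q with distinct-prime-factors M M≢0
  ... | fs , prs , _ , _ , complete = j , no-prime
    where
    P? = λ p → ¬? (p ∣? Q) ×-dec ¬? (p ∣? a₀)
    j = product (filter P? fs)
    prs′ : All Prime (filter P? fs)
    prs′ = All.tabulate (λ p∈ → All.lookup prs (proj₁ (∈-filter⁻ P? p∈)))
    no-prime : ∀ p → Prime p → p ∣ M → ¬ p ∣ a₀ + j * Q
    no-prime p p-pr p∣M p∣a with p ∣? Q | p ∣? a₀
    ... | yes p∣Q | _        = a₀⊥Q p p-pr p∣Q (∣m+n∣m⇒∣n (subst (p ∣_) (ℕ.+-comm a₀ (j * Q)) p∣a) (∣n⇒∣m*n j p∣Q))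
    ... | no  p∤Q | no  p∤a₀ = p∤a₀ (∣m+n∣m⇒∣n (subst (p ∣_) (ℕ.+-comm a₀ (j * Q)) p∣a)
                                 (∣m⇒∣m*n Q (∈⇒∣product (∈-filter⁺ P? (complete p p-pr p∣M) (p∤Q , p∤a₀)))))
    ... | no  p∤Q | yes p∣a₀ with euclidsLemma j Q p-pr (∣m+n∣m⇒∣n p∣a p∣a₀)
    ...   | inj₁ p∣j = proj₂ (proj₂ (∈-filter⁻ P? {xs = fs} (factorisationHasAllPrimeFactors p-pr p∣j prs′))) p∣a₀
    ...   | inj₂ p∣Q = p∤Q p∣Q

  -- Q ≡ n mod 2 for Q = 1 + q + ⋯ + q^(n-1) with q odd.
  geometric-parity : ∀ m n → ∃ λ k → (n + 2 * k) * (2 * m) ≡ suc (2 * m) ^ n ∸ 1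
  geometric-parity m n = let k , eq = go n in k , sym (trans (cong (_∸ 1) eq) refl)
    where
    step : ∀ m n k → suc (2 * m) * suc ((n + 2 * k) * (2 * m)) ≡ suc ((suc n + 2 * (k + m * (n + 2 * k))) * (2 * m))
    step = solve-∀
    go : ∀ n → ∃ λ k → suc (2 * m) ^ n ≡ suc ((n + 2 * k) * (2 * m))
    go zero    = 0 , refl
    go (suc n) with go n
    -- With A = n + 2k the next quotient is 1 + (1 + 2m) A = 1 + A + 2 (m A), so k grows by m A.
    ... | k , eq = k + m * (n + 2 * k) , trans (cong (suc (2 * m) *_) eq) (step m n k)

  -- `geometric-parity` writes q^n - 1 as (n + 2k)(q - 1); cancelling q - 1 gives Q = n + 2k with n
  -- odd.
  quotient-odd : ∀ {q n Q} → q % 4 ≡ 1 → n % 2 ≡ 1 → q ≢ 1 → Q * (q ∸ 1) ≡ q ^ n ∸ 1 → ∃ λ k → Q ≡ suc (2 * k)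
  quotient-odd {q} {n} {Q} q%4 n%2 q≢1 Qq₁≡ = h + k , trans Q≡ (trans (cong (_+ 2 * k) n≡) (sum h k))
    where
    m = q / 4 * 2
    h = n / 2
    q≡ : q ≡ suc (2 * m)
    q≡ = trans (m≡m%n+[m/n]*n q 4) (cong₂ _+_ q%4 (four (q / 4)))
      where
      four : ∀ t → t * 4 ≡ 2 * (t * 2)
      four = solve-∀
    n≡ : n ≡ suc (2 * h)
    n≡ = trans (m≡m%n+[m/n]*n n 2) (cong₂ _+_ n%2 (ℕ.*-comm h 2))
    k = proj₁ (geometric-parity m n)
    2m≢0 : 2 * m ≢ 0
    2m≢0 eq = q≢1 (trans q≡ (cong suc eq))
    Q≡ : Q ≡ n + 2 * k
    Q≡ = ℕ.*-cancelʳ-≡ Q (n + 2 * k) (2 * m) {{ℕ.≢-nonZero 2m≢0}}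
      (trans (cong (Q *_) (sym (cong (_∸ 1) q≡))) (trans Qq₁≡ (trans (cong (λ a → a ^ n ∸ 1) q≡) (sym (proj₂ (geometric-parity m n))))))
    sum : ∀ h k → suc (2 * h) + 2 * k ≡ suc (2 * (h + k))
    sum = solve-∀

  -- (k + 1) inverts 2 modulo Q = 2k + 1.
  double-half : ∀ i k → i * suc k * 2 ≡ i + i * suc (2 * k)
  double-half = solve-∀

-- From the numerical hypothesis to an exponent prime to Q.

module CoprimeSupport where
  open RationalSums
  open ResidueKernels
  open Sieve
  open TraceForm
  open SquarefreeDivisors
  open import Data.Nat as ℕ using (ℕ; zero; suc; _≤_; _^_; s≤s; z≤n)
  import Data.Nat.Properties as ℕ
  open import Data.Nat.Divisibility
  open import Data.Nat.Primality using (Prime; euclidsLemma)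
  open import Data.List using (List; []; _∷_; length)
  open import Data.Nat.ListAction using (product)
  open import Data.List.Membership.Propositional using (_∈_)
  open import Data.Nat.Primality.Factorisation using (factorisationHasAllPrimeFactors)
  open import Data.List.Relation.Unary.All as All using (All; []; _∷_)
  open import Data.List.Relation.Unary.Unique.Propositional using (Unique)
  open import Data.Product using (∃; _×_; _,_)
  open import Data.Sum using ([_,_]′)
  open import Data.Rational as ℚ using (ℚ; 0ℚ; 1ℚ; positive)
  import Data.Rational.Properties as ℚ
  open import Data.Integer as ℤ using (ℤ)
  open import Relation.Nullary using (¬_)
  open import Relation.Binary.PropositionalEquality using (_≡_; _≢_; refl; sym; trans; cong; cong₂; subst; subst₂)
  open import Tactic.RingSolver using (solve-∀)

  *-cancelʳ-pos : ∀ {a b c} → 0ℚ ℚ.< c → a ℚ.* c ℚ.≤ b ℚ.* c → a ℚ.≤ b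
  *-cancelʳ-pos {c = c} 0<c = ℚ.*-cancelʳ-≤-pos c {{positive 0<c}}

  ÷-* : ∀ a d (0<d : 0ℚ ℚ.< d) → ℚ._÷_ a d {{ℚ.>-nonZero 0<d}} ℚ.* d ≡ a
  ÷-* a d 0<d = trans (ℚ.*-assoc a _ d) (trans (cong (a ℚ.*_) (ℚ.*-inverseˡ d {{ℚ.>-nonZero 0<d}})) (ℚ.*-identityʳ a))

  ℤ→ℚ-pred : ∀ s → ℤ→ℚ (ℤ.+ s ℤ.- ℤ.+ 1) ≡ ι s ℚ.- 1ℚ
  ℤ→ℚ-pred zero    = refl
  ℤ→ℚ-pred (suc s) = trans (lem (ι s)) (cong (ℚ._- 1ℚ) (sym (ι-+ 1 s)))
    where
    lem : ∀ a → a ≡ 1ℚ ℚ.+ a ℚ.- 1ℚ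
    lem = solve-∀ ℚ-ring

  -- b = K₀ / (W c) is at least the square root of q₁² X because X ≥ (W c)², which keeps everything rational.
  sieve-constant : ∀ {c X q₁ Wk pw δ s K} → 0ℚ ℚ.< δ → c ℚ.* δ ≡ s ℚ.- 1ℚ ℚ.+ (δ ℚ.+ δ) → 0ℚ ℚ.< c → 0ℚ ℚ.< q₁ → 0ℚ ℚ.< X →
    0ℚ ℚ.< Wk → pw ℚ.≤ Wk → (1ℚ ℚ.+ 1ℚ) ℚ.* (c ℚ.* c) ℚ.* (Wk ℚ.* Wk) ℚ.< X → q₁ ℚ.* X ℚ.≤ K →
    ∃ λ b → 0ℚ ℚ.≤ b × q₁ ℚ.* X ℚ.* q₁ ℚ.≤ b ℚ.* b ×
      (∀ t → K ℚ.- (pw ℚ.- 1ℚ) ℚ.* b ℚ.≤ t → 0ℚ ℚ.< δ ℚ.* t ℚ.- (s ℚ.- (1ℚ ℚ.- δ)) ℚ.* (pw ℚ.* b))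
  sieve-constant {c} {X} {q₁} {Wk} {pw} {δ} {s} {K} 0<δ cδ≡ 0<c 0<q₁ 0<X 0<Wk pw≤Wk hyp K₀≤K = b , ℚ.<⇒≤ 0<b , D≤b² , positive-main
    where
    u K₀ b : ℚ
    u = Wk ℚ.* c
    K₀ = q₁ ℚ.* X
    0<u : 0ℚ ℚ.< u
    0<u = *-pos 0<Wk 0<c
    b = ℚ._÷_ K₀ u {{ℚ.>-nonZero 0<u}}
    bu≡K₀ : b ℚ.* u ≡ K₀
    bu≡K₀ = ÷-* K₀ u 0<u
    0<b : 0ℚ ℚ.< b
    0<b = ℚ.*-cancelʳ-<-nonNeg u {{ℚ.nonNegative (ℚ.<⇒≤ 0<u)}} (subst₂ ℚ._<_ (sym (ℚ.*-zeroˡ u)) (sym bu≡K₀) (*-pos 0<q₁ 0<X))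
    uu≤X : u ℚ.* u ℚ.≤ X
    uu≤X = ℚ.≤-trans (subst₂ ℚ._≤_ (ℚ.+-identityʳ (u ℚ.* u)) (double Wk c) (ℚ.+-monoʳ-≤ (u ℚ.* u) (square-nonNeg u))) (ℚ.<⇒≤ hyp)
      where
      double : ∀ w c → w ℚ.* c ℚ.* (w ℚ.* c) ℚ.+ w ℚ.* c ℚ.* (w ℚ.* c) ≡ (1ℚ ℚ.+ 1ℚ) ℚ.* (c ℚ.* c) ℚ.* (w ℚ.* w)
      double = solve-∀ ℚ-ring
    D≤b² : q₁ ℚ.* X ℚ.* q₁ ℚ.≤ b ℚ.* b
    D≤b² = *-cancelʳ-pos (*-pos 0<u 0<u) (begin
      q₁ ℚ.* X ℚ.* q₁ ℚ.* (u ℚ.* u)   ≤⟨ *-monoˡ-≤ (*-nonNeg (ℚ.<⇒≤ (*-pos 0<q₁ 0<X)) (ℚ.<⇒≤ 0<q₁)) uu≤X ⟩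
      q₁ ℚ.* X ℚ.* q₁ ℚ.* X           ≡⟨ ℚ.*-assoc K₀ q₁ X ⟩
      K₀ ℚ.* K₀                       ≡⟨ cong₂ ℚ._*_ bu≡K₀ bu≡K₀ ⟨
      b ℚ.* u ℚ.* (b ℚ.* u)           ≡⟨ medial b u ⟩
      b ℚ.* b ℚ.* (u ℚ.* u)           ∎)
      where
      open ℚ.≤-Reasoning
      medial : ∀ b u → b ℚ.* u ℚ.* (b ℚ.* u) ≡ b ℚ.* b ℚ.* (u ℚ.* u)
      medial = solve-∀ ℚ-ring
    pwcb≤K : pw ℚ.* c ℚ.* b ℚ.≤ K
    pwcb≤K = begin
      pw ℚ.* c ℚ.* b   ≡⟨ rotate pw c b ⟩
      c ℚ.* b ℚ.* pw   ≤⟨ *-monoˡ-≤ (ℚ.<⇒≤ (*-pos 0<c 0<b)) pw≤Wk ⟩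
      c ℚ.* b ℚ.* Wk   ≡⟨ rotate′ c b Wk ⟩
      b ℚ.* u          ≡⟨ bu≡K₀ ⟩
      K₀               ≤⟨ K₀≤K ⟩
      K                ∎
      where
      open ℚ.≤-Reasoning
      rotate : ∀ p c b → p ℚ.* c ℚ.* b ≡ c ℚ.* b ℚ.* p
      rotate = solve-∀ ℚ-ring
      rotate′ : ∀ c b w → c ℚ.* b ℚ.* w ≡ b ℚ.* (w ℚ.* c)
      rotate′ = solve-∀ ℚ-ring
    positive-main : ∀ t → K ℚ.- (pw ℚ.- 1ℚ) ℚ.* b ℚ.≤ t → 0ℚ ℚ.< δ ℚ.* t ℚ.- (s ℚ.- (1ℚ ℚ.- δ)) ℚ.* (pw ℚ.* b)
    positive-main t K≤t = begin-strict
      -- The margin δ b is what remains even if pw c b reaches K; it comes from the 1 in pw - 1.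
      0ℚ                                                                     <⟨ *-pos 0<δ 0<b ⟩
      δ ℚ.* b                                                                ≡⟨ ℚ.+-identityʳ (δ ℚ.* b) ⟨
      δ ℚ.* b ℚ.+ 0ℚ                                                         ≤⟨ ℚ.+-monoʳ-≤ (δ ℚ.* b) (*-nonNeg (ℚ.<⇒≤ 0<δ) (≤⇒0≤- pwcb≤K)) ⟩
      δ ℚ.* b ℚ.+ δ ℚ.* (K ℚ.- pw ℚ.* c ℚ.* b)                               ≡⟨ expose δ b K pw c ⟩
      δ ℚ.* (K ℚ.+ b) ℚ.- c ℚ.* δ ℚ.* (pw ℚ.* b)                             ≡⟨ cong (λ a → δ ℚ.* (K ℚ.+ b) ℚ.- a ℚ.* (pw ℚ.* b)) cδ≡ ⟩
      δ ℚ.* (K ℚ.+ b) ℚ.- (s ℚ.- 1ℚ ℚ.+ (δ ℚ.+ δ)) ℚ.* (pw ℚ.* b)            ≡⟨ regroup δ b K pw s ⟩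
      δ ℚ.* (K ℚ.- (pw ℚ.- 1ℚ) ℚ.* b) ℚ.- (s ℚ.- (1ℚ ℚ.- δ)) ℚ.* (pw ℚ.* b)  ≤⟨ ℚ.+-monoˡ-≤ (ℚ.- ((s ℚ.- (1ℚ ℚ.- δ)) ℚ.* (pw ℚ.* b))) (*-monoˡ-≤ (ℚ.<⇒≤ 0<δ) K≤t) ⟩
      δ ℚ.* t ℚ.- (s ℚ.- (1ℚ ℚ.- δ)) ℚ.* (pw ℚ.* b)                          ∎
      where
      open ℚ.≤-Reasoning
      expose : ∀ δ b K p c → δ ℚ.* b ℚ.+ δ ℚ.* (K ℚ.- p ℚ.* c ℚ.* b) ≡ δ ℚ.* (K ℚ.+ b) ℚ.- c ℚ.* δ ℚ.* (p ℚ.* b)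
      expose = solve-∀ ℚ-ring
      regroup : ∀ δ b K p s → δ ℚ.* (K ℚ.+ b) ℚ.- (s ℚ.- 1ℚ ℚ.+ (δ ℚ.+ δ)) ℚ.* (p ℚ.* b) ≡ δ ℚ.* (K ℚ.- (p ℚ.- 1ℚ) ℚ.* b) ℚ.- (s ℚ.- (1ℚ ℚ.- δ)) ℚ.* (p ℚ.* b)
      regroup = solve-∀ ℚ-ring

  c-pos : ∀ {c δ} ps → δ ≡ 1ℚ ℚ.- sumRecip ps → 0ℚ ℚ.< δ → c ℚ.* δ ≡ ι (length ps) ℚ.- 1ℚ ℚ.+ (δ ℚ.+ δ) → 0ℚ ℚ.< c
  c-pos {c} {δ} ps δ≡ 0<δ cδ≡ = ℚ.*-cancelʳ-<-nonNeg δ {{ℚ.nonNegative (ℚ.<⇒≤ 0<δ)}} (subst₂ ℚ._<_ (sym (ℚ.*-zeroˡ δ)) (sym cδ≡) (numerator ps δ≡))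
    where
    numerator : ∀ ps → δ ≡ 1ℚ ℚ.- sumRecip ps → 0ℚ ℚ.< ι (length ps) ℚ.- 1ℚ ℚ.+ (δ ℚ.+ δ)
    -- Without sieving primes δ is 1 and the numerator is 0 - 1 + 2.
    numerator []       refl = ℚ.positive⁻¹ 1ℚ
    numerator (p ∷ ps) _    = ℚ.+-mono-≤-< {0ℚ} {ι (length (p ∷ ps)) ℚ.- 1ℚ} (≤⇒0≤- (ι-mono-≤ {1} {length (p ∷ ps)} (s≤s z≤n)))
      (ℚ.+-mono-< 0<δ 0<δ)

  -- Only the total weight and the autocorrelation of `w` enter, so the field has disappeared; `X`
  -- stands for q^(n-2) and `q₁` for q - 1. The primes of `k` are expanded in full, at the cost of
  -- `W k`, while those of `ps` are sieved to first order, at the cost of `δ`.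
  coprime-support :
    (M Q q₁ : ℕ) (w : ℕ → ℚ) (M≢0 : M ≢ 0) (Q≢0 : Q ≢ 0) (M≡Qq₁ : M ≡ Q ℕ.* q₁) (w-periodic : Periodic M w) (0≤w : ∀ i → 0ℚ ℚ.≤ w i)
    (X : ℚ) (1≤X : 1ℚ ℚ.≤ X) (1≤q₁ : 1 ≤ q₁)
    (∑w≡ : ∑ M w ≡ (1ℚ ℚ.+ ι q₁) ℚ.* X ℚ.- 1ℚ)
    (correlation : ∀ t → ∑ M (λ y → w y ℚ.* w (y ℕ.+ t)) ≡ (X ℚ.- 1ℚ) ℚ.+ ((1ℚ ℚ.+ ι q₁) ℚ.* X ℚ.- X) ℚ.* 𝟙 (Q ∣? t))
    (k : ℕ) (ps : List ℕ) → All Prime ps → Unique ps → All (_∣ Q) ps → All (λ p → ¬ p ∣ k) ps → Q ≡ k ℕ.* product ps →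
    (δ : ℚ) → δ ≡ 1ℚ ℚ.- sumRecip ps → 0ℚ ℚ.< δ → (c : ℚ) → c ℚ.* δ ≡ ι (length ps) ℚ.- 1ℚ ℚ.+ (δ ℚ.+ δ) →
    (1ℚ ℚ.+ 1ℚ) ℚ.* (c ℚ.* c) ℚ.* (ι (W k) ℚ.* ι (W k)) ℚ.< X →
    ∃ λ i → w i ≢ 0ℚ × (∀ r → Prime r → r ∣ Q → ¬ r ∣ i)
  coprime-support M Q q₁ w M≢0 Q≢0 M≡Qq₁ w-periodic 0≤w X 1≤X 1≤q₁ ∑w≡ correlation k ps prs uniq ps∣Q ps∤k Q≡ δ δ≡ 0<δ c cδ≡ hyp =
    from-factors (distinct-prime-factors k k≢0)
    where
    Goal : Set
    Goal = ∃ λ i → w i ≢ 0ℚ × (∀ r → Prime r → r ∣ Q → ¬ r ∣ i)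

    k≢0 : k ≢ 0
    k≢0 refl = Q≢0 Q≡

    k∣Q : k ∣ Q
    k∣Q = subst (k ∣_) (sym Q≡) (m∣m*n (product ps))

    M≡q₁Q : M ≡ q₁ ℕ.* Q
    M≡q₁Q = trans M≡Qq₁ (ℕ.*-comm Q q₁)

    module A = Autocorrelated M Q w M≢0 (divides q₁ M≡q₁Q) w-periodic (X ℚ.- 1ℚ) ((1ℚ ℚ.+ ι q₁) ℚ.* X ℚ.- X) correlation

    D′≡ : A.D′ ≡ ι q₁ ℚ.* X ℚ.* ι q₁
    D′≡ = cong₂ ℚ._*_ (lem (ι q₁) X) (trans (cong (λ m → ∑ m (λ t → 𝟙 (Q ∣? t))) M≡q₁Q) (∑-multiples Q≢0 q₁))
      where
      lem : ∀ a x → (1ℚ ℚ.+ a) ℚ.* x ℚ.- x ≡ a ℚ.* x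
      lem = solve-∀ ℚ-ring

    K₀≤K : ι q₁ ℚ.* X ℚ.≤ ∑ M w
    K₀≤K = subst (ι q₁ ℚ.* X ℚ.≤_) (sym (trans ∑w≡ (lem (ι q₁) X)))
      (subst (ℚ._≤ ι q₁ ℚ.* X ℚ.+ (X ℚ.- 1ℚ)) (ℚ.+-identityʳ (ι q₁ ℚ.* X)) (ℚ.+-monoʳ-≤ (ι q₁ ℚ.* X) (≤⇒0≤- 1≤X)))
      where
      lem : ∀ a x → (1ℚ ℚ.+ a) ℚ.* x ℚ.- 1ℚ ≡ a ℚ.* x ℚ.+ (x ℚ.- 1ℚ)
      lem = solve-∀ ℚ-ring

    div-ps : A.Divisors ps
    div-ps = A.divisors prs uniq ps∣Q

    from-factors : (∃ λ ks → All Prime ks × Unique ks × All (_∣ k) ks × (∀ p → Prime p → p ∣ k → p ∈ ks)) → Goal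
    from-factors (ks , ks-prime , ks-unique , ks∣k , ks-complete) = from-constant
      (sieve-constant {c} {X} {ι q₁} {ι (W k)} {pw} {δ} {ι (length ps)} {∑ M w}
        0<δ cδ≡ 0<c (1≤⇒0< (ι q₁) (ι-mono-≤ {1} {q₁} 1≤q₁)) (1≤⇒0< X 1≤X)
        (1≤⇒0< (ι (W k)) (ι-mono-≤ {1} {W k} (ℕ.≤-trans (ℕ.m^n>0 2 (length ks)) 2^≤W)))
        (ι-mono-≤ {2 ^ length ks} {W k} 2^≤W) hyp K₀≤K)
      where
      pw : ℚ
      pw = ι (2 ^ length ks)

      1≤⇒0< : ∀ a → 1ℚ ℚ.≤ a → 0ℚ ℚ.< a
      1≤⇒0< a = ℚ.<-≤-trans (ℚ.positive⁻¹ 1ℚ)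

      0<c : 0ℚ ℚ.< c
      0<c = c-pos ps δ≡ 0<δ cδ≡

      2^≤W : 2 ^ length ks ≤ W k
      2^≤W = 2^length≤W k≢0 ks-prime ks-unique ks∣k

      div-ks : A.Divisors ks
      div-ks = A.divisors ks-prime ks-unique (All.map (λ r∣k → ∣-trans r∣k k∣Q) ks∣k)

      to-goal : (∃ λ i → w i ≢ 0ℚ × All (λ p → ¬ p ∣ i) ks × All (λ p → ¬ p ∣ i) ps) → Goal
      to-goal (i , w≢0 , ∤ks , ∤ps) = i , w≢0 , i⊥Q
        where
        i⊥Q : ∀ r → Prime r → r ∣ Q → ¬ r ∣ i
        i⊥Q r r-pr r∣Q r∣i = [ (λ r∣k → All.lookup ∤ks (ks-complete r r-pr r∣k) r∣i)
                             , (λ r∣ps → All.lookup ∤ps (factorisationHasAllPrimeFactors r-pr r∣ps prs) r∣i) ]′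
                             (euclidsLemma k (product ps) r-pr (subst (r ∣_) Q≡ r∣Q))

      from-constant : (∃ λ b → 0ℚ ℚ.≤ b × ι q₁ ℚ.* X ℚ.* ι q₁ ℚ.≤ b ℚ.* b ×
        (∀ t → ∑ M w ℚ.- (pw ℚ.- 1ℚ) ℚ.* b ℚ.≤ t → 0ℚ ℚ.< δ ℚ.* t ℚ.- (ι (length ps) ℚ.- (1ℚ ℚ.- δ)) ℚ.* (pw ℚ.* b))) → Goal
      from-constant (b , 0≤b , bound , positive-main) = to-goal (A.sieve b 0≤b D′≤b² ks ps div-ks div-ps
          -- A prime divisor of k cannot occur in `ps`, whose members do not divide k.
          (All.map (λ {r} r∤k → All.map (λ { s∣k refl → r∤k s∣k }) ks∣k) ps∤k) 0≤w main)
        where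
        D′≤b² : A.D′ ℚ.≤ b ℚ.* b
        D′≤b² = subst (ℚ._≤ b ℚ.* b) (sym D′≡) bound

        pow₂≡ : ∀ rs → A.pow₂ rs ≡ ι (2 ^ length rs)
        pow₂≡ []       = refl
        pow₂≡ (_ ∷ rs) = trans (cong₂ ℚ._+_ (pow₂≡ rs) (pow₂≡ rs))
          (trans (sym (ι-+ (2 ^ length rs) (2 ^ length rs))) (cong (λ m → ι (2 ^ length rs ℕ.+ m)) (sym (ℕ.+-identityʳ (2 ^ length rs)))))

        main : 0ℚ ℚ.< (1ℚ ℚ.- sumRecip ps) ℚ.* A.T ks [] ℚ.- (ι (length ps) ℚ.- sumRecip ps) ℚ.* (A.pow₂ ks ℚ.* b)
        main = subst₂ (λ d a → 0ℚ ℚ.< d ℚ.* A.T ks [] ℚ.- (ι (length ps) ℚ.- a) ℚ.* (A.pow₂ ks ℚ.* b))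
          δ≡ (trans (cong (λ a → 1ℚ ℚ.- a) δ≡) (lem (sumRecip ps)))
          (subst (λ x → 0ℚ ℚ.< δ ℚ.* A.T ks [] ℚ.- (ι (length ps) ℚ.- (1ℚ ℚ.- δ)) ℚ.* (x ℚ.* b)) (sym (pow₂≡ ks))
            (positive-main (A.T ks []) (subst (λ x → ∑ M w ℚ.- (x ℚ.- 1ℚ) ℚ.* b ℚ.≤ A.T ks []) (pow₂≡ ks) (A.T-main b 0≤b D′≤b² ks div-ks))))
          where
          lem : ∀ a → 1ℚ ℚ.- (1ℚ ℚ.- a) ≡ a
          lem = solve-∀ ℚ-ring

-- Back to the field: free elements, square roots of exponents, and the theorem.

open NumberTheory
open RationalSums
open FiniteFields
open TraceForm
open SquarefreeDivisors
open CoprimeSupport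
import Algebra.Properties.CommutativeSemiring.Exp
open import Data.Nat as ℕ using (ℕ; suc; _≤_; _%_; _∸_; _^_; s≤s; z≤n)
import Data.Nat.Properties as ℕ
open import Data.Nat.Divisibility
open import Data.Nat.Primality using (Prime)
open import Data.List using (List; []; _∷_; length)
open import Data.Nat.ListAction using (product)
open import Data.List.Relation.Unary.All using (All; []; _∷_)
open import Data.List.Relation.Unary.Unique.Propositional using (Unique)
open import Data.Product using (∃; _×_; _,_)
open import Data.Sum using ([_,_]′)
open import Data.Rational as ℚ using (ℚ; 0ℚ; 1ℚ)
import Data.Rational.Properties as ℚ
open import Data.Integer as ℤ using (ℤ)
open import Relation.Nullary using (¬_)
open import Relation.Nullary.Decidable using (decidable-stable)
open import Relation.Binary.PropositionalEquality using (_≡_; _≢_; refl; sym; trans; cong; cong₂; subst)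
open import Tactic.RingSolver using (solve-∀)
open import Data.Nat.Tactic.RingSolver using () renaming (solve-∀ to ℕ-solve-∀)

module TraceZeroPowers
  {N : ℕ} (F : FiniteField N) (p e q n₂ : ℕ) (p-pr : Prime p) (q≡pᵉ : q ≡ p ^ e) (1<q : 1 ℕ.< q) (N≡qⁿ : N ≡ q ^ suc (suc n₂))
  (g : FiniteField.Carrier F) (M Q q₁ : ℕ) (ord : FieldTheory.IsOrder F g M) (1+M≡N : suc M ≡ N) (1+q₁≡q : suc q₁ ≡ q) (M≡Qq₁ : M ≡ Q ℕ.* q₁)
  where

  open FieldTheory F
    using (Carrier; _≈_; 0#; _≟_; n≢0; IsOrder-≉0; ^-≉0; ^-+; ^-≈⇒∣; *-congˡ; zeroʳ; pow≡^; reflexive)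
    renaming (_^_ to _^ᶠ_; _*_ to _*ᶠ_; trans to ≈-trans; sym to ≈-sym)
  module Exp = Algebra.Properties.CommutativeSemiring.Exp (FiniteField.commutativeSemiring F)

  n : ℕ
  n = suc (suc n₂)

  module Linear = TraceTheory.Linear F p e q n₂ p-pr q≡pᵉ 1<q N≡qⁿ
  module Rooted = Linear.Rooted g M Q q₁ ord 1+M≡N 1+q₁≡q M≡Qq₁
  open Linear using (tr; tr-cong; Tr≡tr; tr-*-Fixed)
  open Rooted using (w; Q≢0; Q∣⇒fixed; powers)

  ι-q^suc : ι (q ^ suc n₂) ≡ (1ℚ ℚ.+ ι q₁) ℚ.* ι (q ^ n₂)
  ι-q^suc = trans (ι-* q (q ^ n₂)) (cong (ℚ._* ι (q ^ n₂)) (trans (cong ι (sym 1+q₁≡q)) (ι-+ 1 q₁)))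

  trace-zero-exponent : (k : ℕ) (ps : List ℕ) → All Prime ps → Unique ps → All (_∣ Q) ps → All (λ p → ¬ p ∣ k) ps → Q ≡ k ℕ.* product ps →
    (δ : ℚ) → δ ≡ 1ℚ ℚ.- sumRecip ps → 0ℚ ℚ.< δ → (c : ℚ) → c ℚ.* δ ≡ ι (length ps) ℚ.- 1ℚ ℚ.+ (δ ℚ.+ δ) →
    (1ℚ ℚ.+ 1ℚ) ℚ.* (c ℚ.* c) ℚ.* (ι (W k) ℚ.* ι (W k)) ℚ.< ι (q ^ n₂) →
    ∃ λ i → tr n (g ^ᶠ i) ≈ 0# × (∀ r → Prime r → r ∣ Q → ¬ r ∣ i)
  trace-zero-exponent k ps prs uniq ps∣Q ps∤k Q≡ δ δ≡ 0<δ c cδ≡ hyp = to-trace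
    (coprime-support M Q q₁ w (n≢0 ord) Q≢0 M≡Qq₁ Rooted.w-periodic (λ i → 𝟙-nonNeg (tr n (g ^ᶠ i) ≟ 0#))
      (ι (q ^ n₂)) (ι-mono-≤ {1} {q ^ n₂} (ℕ.m^n>0 q {{ℕ.>-nonZero (ℕ.<-trans (s≤s z≤n) 1<q)}} n₂))
      (ℕ.s≤s⁻¹ (subst (1 ℕ.<_) (sym 1+q₁≡q) 1<q))
      (trans Rooted.∑-w (cong (ℚ._- 1ℚ) ι-q^suc))
      (λ t → trans (Rooted.correlation t) (cong (λ a → (ι (q ^ n₂) ℚ.- 1ℚ) ℚ.+ (a ℚ.- ι (q ^ n₂)) ℚ.* 𝟙 (Q ∣? t)) ι-q^suc))
      k ps prs uniq ps∣Q ps∤k Q≡ δ δ≡ 0<δ c cδ≡ hyp)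
    where
    to-trace : (∃ λ i → w i ≢ 0ℚ × (∀ r → Prime r → r ∣ Q → ¬ r ∣ i)) → ∃ λ i → tr n (g ^ᶠ i) ≈ 0# × (∀ r → Prime r → r ∣ Q → ¬ r ∣ i)
    to-trace (i , w≢0 , i⊥Q) = i , decidable-stable (tr n (g ^ᶠ i) ≟ 0#) (λ ≉0 → w≢0 (𝟙-no (tr n (g ^ᶠ i) ≟ 0#) ≉0)) , i⊥Q

  -- Exponents of the same element differ by a multiple of M, so divisibility by a divisor of M
  -- depends only on the element.
  log-∣ : ∀ {d} → d ∣ M → ∀ x y → g ^ᶠ x ≈ g ^ᶠ y → d ∣ y → d ∣ x
  log-∣ {d} d∣M x y eq d∣y = [ (λ x≤y → up (ℕ.m≤n⇒∃[o]m+o≡n x≤y)) , (λ y≤x → down (ℕ.m≤n⇒∃[o]m+o≡n y≤x)) ]′ (ℕ.≤-total x y)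
    where
    up : (∃ λ o → x ℕ.+ o ≡ y) → d ∣ x
    up (o , refl) = ∣m+n∣m⇒∣n (subst (d ∣_) (ℕ.+-comm x o) d∣y) (∣-trans d∣M (^-≈⇒∣ ord x o eq))
    down : (∃ λ o → y ℕ.+ o ≡ x) → d ∣ x
    down (o , refl) = ∣m∣n⇒∣m+n d∣y (∣-trans d∣M (^-≈⇒∣ ord y o (≈-sym eq)))

  -- If g^a = ζ^d and ζ = g^l, then d divides l d and hence a by `log-∣`; a prime factor of d would
  -- divide both a and M.
  coprime⇒free : ∀ a → (∀ r → Prime r → r ∣ M → ¬ r ∣ a) → IsFree F M (g ^ᶠ a)
  coprime⇒free a a⊥M = ^-≉0 a (IsOrder-≉0 ord) , only-1
    where
    only-1 : ∀ d ζ → d ∣ M → ¬ ζ ≈ 0# → g ^ᶠ a ≈ pow F ζ d → d ≡ 1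
    -- Coprimality of d and M, applied to the common divisor d itself, says that d is 1.
    only-1 d ζ d∣M ζ≉0 ξ≈ζᵈ = coprime-by-primes {d} {M} (λ d≡0 → n≢0 ord (0∣⇒≡0 (subst (_∣ M) d≡0 d∣M)))
        (λ r r-pr r∣d r∣M → a⊥M r r-pr r∣M (∣-trans r∣d (d∣a (powers ζ ζ≉0)))) (∣-refl , d∣M)
      where
      d∣a : (∃ λ l → l ℕ.< M × g ^ᶠ l ≈ ζ) → d ∣ a
      d∣a (l , _ , gˡ≈ζ) = log-∣ d∣M a (l ℕ.* d)
        (≈-trans ξ≈ζᵈ (≈-trans (reflexive (pow≡^ ζ d)) (≈-trans (Exp.^-congˡ d (≈-sym gˡ≈ζ)) (Exp.^-assocʳ g l d)))) (n∣m*n l)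

  -- The square is g^(cQ) g^i, and the first factor lies in 𝔽_q, so it comes out of the trace.
  trace-square : ∀ i a c → tr n (g ^ᶠ i) ≈ 0# → a ℕ.* 2 ≡ c ℕ.* Q ℕ.+ i → Tr F q n (pow F (g ^ᶠ a) 2) ≈ 0#
  trace-square i a c trace-i exponent = ≈-trans (reflexive (Tr≡tr n (pow F (g ^ᶠ a) 2))) (≈-trans (tr-cong n square)
    (≈-trans (tr-*-Fixed n (g ^ᶠ (c ℕ.* Q)) (g ^ᶠ i) (Q∣⇒fixed (n∣m*n c))) (≈-trans (*-congˡ trace-i) (zeroʳ _))))
    where
    square : pow F (g ^ᶠ a) 2 ≈ g ^ᶠ (c ℕ.* Q) *ᶠ g ^ᶠ i
    square = ≈-trans (reflexive (pow≡^ (g ^ᶠ a) 2)) (≈-trans (Exp.^-assocʳ g a 2)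
      (≈-trans (reflexive (cong (g ^ᶠ_) exponent)) (^-+ g (c ℕ.* Q) i)))

  square-root : ∀ h → Q ≡ suc (2 ℕ.* h) → (∃ λ i → tr n (g ^ᶠ i) ≈ 0# × (∀ r → Prime r → r ∣ Q → ¬ r ∣ i)) →
                ∃ λ ξ → IsFree F M ξ × Tr F q n (pow F ξ 2) ≈ 0#
  square-root h Q-odd (i , trace-i , i⊥Q) = finish (coprime-lift M Q a₀ (n≢0 ord) a₀⊥Q)
    where
    a₀ : ℕ
    a₀ = i ℕ.* suc h
    2a₀≡ : a₀ ℕ.* 2 ≡ i ℕ.+ i ℕ.* Q
    2a₀≡ = trans (double-half i h) (cong (λ m → i ℕ.+ i ℕ.* m) (sym Q-odd))
    a₀⊥Q : ∀ r → Prime r → r ∣ Q → ¬ r ∣ a₀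
    -- As 2 a₀ = i + i Q, a common prime of a₀ and Q would divide i.
    a₀⊥Q r r-pr r∣Q r∣a₀ = i⊥Q r r-pr r∣Q (∣m+n∣m⇒∣n (subst (r ∣_) (trans 2a₀≡ (ℕ.+-comm i (i ℕ.* Q))) (∣m⇒∣m*n 2 r∣a₀)) (∣n⇒∣m*n i r∣Q))
    finish : (∃ λ j → ∀ r → Prime r → r ∣ M → ¬ r ∣ a₀ ℕ.+ j ℕ.* Q) → ∃ λ ξ → IsFree F M ξ × Tr F q n (pow F ξ 2) ≈ 0#
    -- The multiplier i + 2j of Q comes from doubling: 2 (a₀ + j Q) = i + (i + 2j) Q.
    finish (j , a⊥M) = g ^ᶠ a , coprime⇒free a a⊥M , trace-square i a (i ℕ.+ j ℕ.* 2) trace-i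
        (trans (ℕ.*-distribʳ-+ 2 a₀ (j ℕ.* Q)) (trans (cong (ℕ._+ j ℕ.* Q ℕ.* 2) 2a₀≡) (lem i j Q)))
      where
      a : ℕ
      a = a₀ ℕ.+ j ℕ.* Q
      lem : ∀ i j Q → i ℕ.+ i ℕ.* Q ℕ.+ j ℕ.* Q ℕ.* 2 ≡ (i ℕ.+ j ℕ.* 2) ℕ.* Q ℕ.+ i
      lem = ℕ-solve-∀

prime-power>1 : ∀ {q} → IsPrimePower q → 1 ℕ.< q
prime-power>1 (p , e , p-pr , 1≤e , refl) = ℕ.^-monoʳ-< p (prime>1 p-pr) {0} {e} 1≤e

theorem5p15 :
    (q n : ℕ) → IsPrimePower q → q % 4 ≡ 1 → 3 ≤ n → n % 2 ≡ 1 →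
    (F : FiniteField (q ^ n)) →
    (Q : ℕ) → Q ℕ.* (q ∸ 1) ≡ q ^ n ∸ 1 →
    (k : ℕ) (ps : List ℕ) →
    All Prime ps → Unique ps → All (λ p → p ∣ Q) ps → All (λ p → ¬ (p ∣ k)) ps →
    Q ≡ k ℕ.* product ps →
    (δpos : ℚ.0ℚ ℚ.< (ℚ.1ℚ ℚ.- sumRecip ps)) →
    let δ = ℚ.1ℚ ℚ.- sumRecip ps
        c = ℚ._÷_ (ℤ→ℚ (ℤ.+ length ps ℤ.- ℤ.+ 1)) δ {{ℚ.>-nonZero δpos}} ℚ.+ ℕ→ℚ 2
    in ℕ→ℚ 2 ℚ.* (c ℚ.* c) ℚ.* (ℕ→ℚ (W k) ℚ.* ℕ→ℚ (W k)) ℚ.< ℕ→ℚ (q ^ (n ∸ 2)) →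
    ∃ λ ξ → IsFree F (q ^ n ∸ 1) ξ × FiniteField._≈_ F (Tr F q n (pow F ξ 2)) (FiniteField.0# F)
theorem5p15 q (suc (suc n₂)) q-pp@(p , e , p-pr , 1≤e , q≡pᵉ) q%4 (s≤s (s≤s _)) n%2 F Q Qq₁≡ k ps prs uniq ps∣Q ps∤k Q≡ δpos hyp =
  rooted (FieldTheory.primitive-root F) (quotient-odd {q} {n} q%4 n%2 (λ q≡1 → ℕ.<⇒≢ 1<q (sym q≡1)) Qq₁≡)
  where
  n : ℕ
  n = suc (suc n₂)
  1<q : 1 ℕ.< q
  1<q = prime-power>1 q-pp
  1+q₁≡q : suc (q ∸ 1) ≡ q
  1+q₁≡q = ℕ.m+[n∸m]≡n (ℕ.<⇒≤ 1<q)
  δ c₀ : ℚ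
  δ = ℚ.1ℚ ℚ.- sumRecip ps
  c₀ = ℚ._÷_ (ℤ→ℚ (ℤ.+ length ps ℤ.- ℤ.+ 1)) δ {{ℚ.>-nonZero δpos}}
  -- Multiplying by δ clears the division; the sieve knows the constant only through this identity
  -- and the hypothesis.
  cδ≡ : (c₀ ℚ.+ ℕ→ℚ 2) ℚ.* δ ≡ ι (length ps) ℚ.- 1ℚ ℚ.+ (δ ℚ.+ δ)
  cδ≡ = trans (ℚ.*-distribʳ-+ δ c₀ (ℕ→ℚ 2))
    (cong₂ ℚ._+_ (trans (÷-* (ℤ→ℚ (ℤ.+ length ps ℤ.- ℤ.+ 1)) δ δpos) (ℤ→ℚ-pred (length ps))) (lem δ))
    where
    lem : ∀ a → (1ℚ ℚ.+ 1ℚ) ℚ.* a ≡ a ℚ.+ a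
    lem = solve-∀ ℚ-ring
  rooted : (∃ λ g → ∃ λ M → FieldTheory.IsOrder F g M × suc M ≡ q ^ n) → (∃ λ h → Q ≡ suc (2 ℕ.* h)) →
           ∃ λ ξ → IsFree F (q ^ n ∸ 1) ξ × FiniteField._≈_ F (Tr F q n (pow F ξ 2)) (FiniteField.0# F)
  rooted (g , M , ord , 1+M≡N) (h , Q-odd) =
      subst (λ m → ∃ λ ξ → IsFree F m ξ × FiniteField._≈_ F (Tr F q n (pow F ξ 2)) (FiniteField.0# F)) M≡N∸1
        (S.square-root h Q-odd (S.trace-zero-exponent k ps prs uniq ps∣Q ps∤k Q≡ δ refl δpos (c₀ ℚ.+ ℕ→ℚ 2) cδ≡ hyp))
    where
    M≡N∸1 : M ≡ q ^ n ∸ 1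
    M≡N∸1 = cong (_∸ 1) 1+M≡N
    module S = TraceZeroPowers F p e q n₂ p-pr q≡pᵉ 1<q refl g M Q (q ∸ 1) ord 1+M≡N 1+q₁≡q (trans M≡N∸1 (sym Qq₁≡))
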